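{- Let $v$ and $k$ be integers with $v \geq 8$ and $0 \leq k \leq v$ such that one of the following holds: (i) $v \equiv 2 \pmod 6$ and $k \equiv 3, 4$ or $5 \pmod 6$; or (ii) $v \equiv 3 \pmod 6$ and $k \equiv 4$ or $5 \pmod 6$; or (iii) $v \equiv 4 \pmod 6$ and $k \equiv 5 \pmod 6$. Then there exists a large set $\operatorname{LS}_2[3](2,k,v)$, i.e. the set of all $k$-dimensional subspaces of a $v$-dimensional vector space $V$ over $\operatorname{GF}(2)$ can be partitioned into three pairwise disjoint sets $\mathcal{B}_1,\mathcal{B}_2,\mathcal{B}_3$ such that each $(V,\mathcal{B}_i)$ is a $2$-$(v,k,\lambda)_2$ subspace design, where $\lambda = \frac{1}{3}\binom{v-2}{k-2}_2$.
   Context: For a vector space $V$ of dimension $v$ over the finite field $\operatorname{GF}(q)$, a $k$-subspace is a subspace of dimension $k$. A (simple) $t$-$(v,k,\lambda)_q$ subspace design is a pair $(V,\mathcal{B})$ where $\mathcal{B}$ is a set of $k$-subspaces of $V$ (blocks) such that every $t$-subspace of $V$ is contained in exactly $\lambda$ blocks. The Gaussian binomial coefficient is $\binom{n}{m}_q = \frac{(q^n-1)\cdots(q^{n-m+1}-1)}{(q^m-1)\cdots(q-1)}$ for $0\le m\le n$ and $0$ otherwise; it counts the $m$-subspaces of an $n$-dimensional space. A large set $\operatorname{LS}_q[N](t,k,v)$ is a partition of the set of all $k$-subspaces of $V$ into $N$ pairwise disjoint sets $\mathcal{B}_1,\dots,\mathcal{B}_N$ such that each $(V,\mathcal{B}_i)$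 is a $t$-$(v,k,\lambda)_q$ design; necessarily $\lambda = \binom{v-t}{k-t}_q / N$. -}

module Defs where

open import Data.Bool using (Bool; true; false; _xor_; if_then_else_)
open import Data.Nat using (ℕ; zero; suc; _+_; _*_; _∸_; _^_; NonZero)
open import Data.Nat.DivMod using (_/_)
open import Data.Fin using (Fin)
open import Data.Vec using (Vec; []; _∷_; replicate; zipWith)
open import Data.List using (List; length)
open import Data.List.Relation.Unary.All using (All)
open import Data.List.Relation.Unary.Any using (Any)
open import Data.List.Relation.Unary.AllPairs using (AllPairs)
open import Data.Product using (Σ; ∃; _×_; _,_)
open import Relation.Binary.PropositionalEquality using (_≡_)
open import Relation.Nullary using (¬_)
open import Function.Bundles using (_⇔_)

-- The ambient space V = GF(2)^v, GF(2) = Bool with xor as addition.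
Pt : ℕ → Set
Pt v = Vec Bool v

0V : ∀ {v} → Pt v
0V = replicate _ false

_⊕_ : ∀ {v} → Pt v → Pt v → Pt v
_⊕_ = zipWith _xor_

lincomb : ∀ {v k} → Vec Bool k → Vec (Pt v) k → Pt v
lincomb []       []       = 0V
lincomb (c ∷ cs) (b ∷ bs) = if c then b ⊕ lincomb cs bs else lincomb cs bs

LinIndep : ∀ {v k} → Vec (Pt v) k → Set
LinIndep {k = k} bs = ∀ (c : Vec Bool k) → lincomb c bs ≡ 0V → c ≡ replicate k false

SubsetV : ℕ → Set
SubsetV v = Pt v → Bool

_∈S_ : ∀ {v} → Pt v → SubsetV v → Set
x ∈S S = S x ≡ true

_≐_ : ∀ {v} → SubsetV v → SubsetV v → Set
S ≐ T = ∀ x → S x ≡ T x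

_⊆S_ : ∀ {v} → SubsetV v → SubsetV v → Set
S ⊆S T = ∀ x → x ∈S S → x ∈S T

IsSubspace : (v k : ℕ) → SubsetV v → Set
IsSubspace v k W = Σ (Vec (Pt v) k) λ b →
  LinIndep b × (∀ x → (x ∈S W) ⇔ (∃ λ (c : Vec Bool k) → lincomb c b ≡ x))

-- Gaussian binomial coefficient [n choose m]_q, via the q-Pascal recursion
-- [n+1, m+1]_q = [n, m]_q + q^(m+1) [n, m+1]_q, [n,0]=1, [0,m+1]=0.
gauss : (q n m : ℕ) → ℕ
gauss q n       zero    = 1
gauss q zero    (suc m) = 0
gauss q (suc n) (suc m) = gauss q n m + q ^ (suc m) * gauss q n (suc m)

-- Block class B = { W k-subspace : col W ≡ i } is a t-(v,k,λ)_2 design: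
-- every t-subspace T lies in exactly λ blocks (counted up to equality of subsets).
IsDesignClass : (v t k lam : ℕ) → (SubsetV v → Set) → Set
IsDesignClass v t k lam B =
  ∀ (T : SubsetV v) → IsSubspace v t T →
    Σ (List (SubsetV v)) λ L →
      length L ≡ lam
      × AllPairs (λ W W′ → ¬ (W ≐ W′)) L
      × All (λ W → IsSubspace v k W × B W × (T ⊆S W)) L
      × (∀ W → IsSubspace v k W → B W → T ⊆S W → Any (W ≐_) L)

-- A large set LS_2[N](t,k,v): a partition of all k-subspaces of GF(2)^v into N
-- classes (given by a colouring col, well defined on subsets), each class a
-- t-(v,k,λ)_2 design with λ = [v-t choose k-t]_2 / N.
LargeSet₂ : (N t k v : ℕ) → .{{NonZero N}} → Set
LargeSet₂ N t k v =
  Σ (SubsetV v → Fin N) λ col →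
    (∀ W W′ → W ≐ W′ → col W ≡ col W′)
    × (∀ (i : Fin N) → IsDesignClass v t k (gauss 2 (v ∸ t) (k ∸ t) / N)
                           (λ W → IsSubspace v k W × col W ≡ i))

{-# OPTIONS --safe #-}
module Submission where

-- Fix a complete flag V_0 < V_1 < … of GF(2)^v and let a path record, for a subspace K, at which steps the
-- dimension of K ∩ V_x grows.  If K has dimension at least 6, cut its path at the sixth growing step: K is then
-- determined by its part A in V_x, its part B in the quotient by V_{x+1}, and a free choice of extension.  Colouring
-- K by the sum (mod 3) of the colours of A and B, every subspace T sees the colours equally often as soon as A or B
-- does so for the corresponding piece of T; this reduces the dimension of K by 6, and dually the codimension.  Together
-- with the hyperplane (Pascal) recursion this leaves the large sets with v = 8 and k = 3, 4, 5, which are found by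
-- computer as colourings compatible with subgroups of ΓL(1, 2^8), the group being allowed to permute the colours.

open import Defs
open import Data.Bool using (Bool; true; false; T; not; if_then_else_; _∧_; _∨_; _xor_)
open import Data.Bool.Properties using (xor-assoc; xor-comm; xor-same; xor-identityʳ; ∧-distribˡ-xor; ∧-zeroʳ; ∧-identityʳ; ∨-zeroʳ; ∨-identityʳ) renaming (_≟_ to _≟ᵇ_)
open import Data.Fin using (Fin; zero; suc; combine; remQuot)
open import Data.Fin.Patterns using (0F; 1F; 2F)
open import Data.Fin.Properties using (combine-injective; combine-remQuot; injective⇒≤)
open import Data.List using (List; []; _∷_; _++_; concatMap; cartesianProductWith; filter; length; upTo)
import Data.List as List
open import Data.List.Membership.Propositional using (_∈_)
open import Data.List.Membership.Propositional.Properties using (∈-map⁺; ∈-map⁻; ∈-++⁺ˡ; ∈-++⁺ʳ; ∈-cartesianProductWith⁺; ∈-cartesianProductWith⁻; ∈-filter⁺; ∈-filter⁻; ∈-upTo⁺)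
open import Data.List.Membership.Propositional.Properties.WithK using (unique∧set⇒bag)
open import Data.List.Properties using (length-map)
open import Data.List.Relation.Binary.BagAndSetEquality using (∼bag⇒↭)
import Data.List.Relation.Binary.Permutation.Propositional as Perm
open import Data.List.Relation.Unary.All as All using (All; [])
import Data.List.Relation.Unary.All.Properties as All
open import Data.List.Relation.Unary.AllPairs as AllPairs using (AllPairs; []; _∷_)
import Data.List.Relation.Unary.AllPairs.Properties as AllPairs
open import Data.List.Relation.Unary.Any as Any using (Any; here; there)
import Data.List.Relation.Unary.Any.Properties as Any
open import Data.List.Relation.Unary.Unique.Propositional using (Unique)
import Data.List.Relation.Unary.Unique.Propositional.Properties as Unique
open import Data.Nat using (ℕ; zero; suc; _+_; _*_; _∸_; _^_; _≤_; _<_; z≤n; s≤s; _≤?_; _<?_; _≡ᵇ_; _≤ᵇ_; _%_; _/_; NonZero; >-nonZero; >-nonZero⁻¹)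
open import Data.Nat.Divisibility using (_∣_; divides; m%n≡0⇒n∣m)
open import Data.Nat.DivMod
open import Data.Nat.Properties
open import Data.Nat.Tactic.RingSolver using (solve-∀)
open import Data.Product using (Σ; ∃; _×_; _,_; proj₁; proj₂)
open import Data.Sum using (_⊎_; inj₁; inj₂)
open import Data.Vec using (Vec; []; _∷_; zipWith; replicate; map)
open import Data.Vec.Properties using (zipWith-assoc; zipWith-comm; zipWith-identityˡ; zipWith-identityʳ; map-cong)
open import Function using (_∘_; id)
open import Function.Bundles using (mk⇔; Equivalence)
open import Relation.Binary.PropositionalEquality hiding (J)
open import Relation.Nullary using (¬_; Dec; yes; no; contradiction)

-- What closes the induction is the strength that it claims. For dimension k and codimension l = v -
-- k the colours are balanced over every T of dimension at most (k mod 6) + (l mod 6) - 6, capped at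
-- 2. A first piece of dimension 5 and codimension b is then balanced over any space of dimension
-- below b mod 6, so it can fail only when T ∩ V_x has at least that dimension. The codimensions of
-- the two pieces add up to l and residues are subadditive, so what is then left of T is small
-- enough for the second piece. The three cases of the theorem together say 2 ≤ v mod 6 < k mod 6,
-- which gives (k mod 6) + (l mod 6) = (v mod 6) + 6 and hence strength 2. The base colourings are
-- not stored subspace by subspace (there are 200787 subspaces for k = 4). The colour is read from a
-- small table at a numerical key of the subspace, built from the discrete logarithms of its points
-- so that the chosen multiplications fix it and the Frobenius map negates it.

-- Finite sums.

∑ : {A : Set} → List A → (A → ℕ) → ℕ
∑ []       f = 0
∑ (x ∷ xs) f = f x + ∑ xs f

module _ {A : Set} where

  ∑-cong : (xs : List A) {f g : A → ℕ} → (∀ x → f x ≡ g x) → ∑ xs f ≡ ∑ xs g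
  ∑-cong []       p = refl
  ∑-cong (x ∷ xs) p = cong₂ _+_ (p x) (∑-cong xs p)

  ∑-++ : (xs ys : List A) (f : A → ℕ) → ∑ (xs ++ ys) f ≡ ∑ xs f + ∑ ys f
  ∑-++ []       ys f = refl
  ∑-++ (x ∷ xs) ys f = trans (cong (f x +_) (∑-++ xs ys f)) (sym (+-assoc (f x) _ _))

  ∑-map : {B : Set} (h : B → A) (xs : List B) (f : A → ℕ) → ∑ (List.map h xs) f ≡ ∑ xs (f ∘ h)
  ∑-map h []       f = refl
  ∑-map h (x ∷ xs) f = cong (f (h x) +_) (∑-map h xs f)

  ∑-cartesianProductWith : {B C : Set} (h : B → C → A) (xs : List B) (ys : List C) (f : A → ℕ) →
    ∑ (cartesianProductWith h xs ys) f ≡ ∑ xs (λ x → ∑ ys (f ∘ h x))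
  ∑-cartesianProductWith h []       ys f = refl
  ∑-cartesianProductWith h (x ∷ xs) ys f = trans (∑-++ (List.map (h x) ys) _ f)
    (cong₂ _+_ (∑-map (h x) ys f) (∑-cartesianProductWith h xs ys f))

  ∑-0 : (xs : List A) → ∑ xs (λ _ → 0) ≡ 0
  ∑-0 []       = refl
  ∑-0 (x ∷ xs) = ∑-0 xs

  ∑-+ : (xs : List A) (f g : A → ℕ) → ∑ xs (λ x → f x + g x) ≡ ∑ xs f + ∑ xs g
  ∑-+ []       f g = refl
  ∑-+ (x ∷ xs) f g = trans (cong (f x + g x +_) (∑-+ xs f g)) (shuffle (f x) (g x) (∑ xs f) (∑ xs g))
    where
    shuffle : ∀ a b c d → (a + b) + (c + d) ≡ (a + c) + (b + d)
    shuffle = solve-∀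

  ∑-* : (c : ℕ) (xs : List A) (f : A → ℕ) → ∑ xs (λ x → c * f x) ≡ c * ∑ xs f
  ∑-* c []       f = sym (*-zeroʳ c)
  ∑-* c (x ∷ xs) f = trans (cong (c * f x +_) (∑-* c xs f)) (sym (*-distribˡ-+ c (f x) _))

∑-swap : {A B : Set} (xs : List A) (ys : List B) (f : A → B → ℕ) →
  ∑ xs (λ x → ∑ ys (f x)) ≡ ∑ ys (λ y → ∑ xs (λ x → f x y))
∑-swap []       ys f = sym (∑-0 ys)
∑-swap (x ∷ xs) ys f = trans (cong (∑ ys (f x) +_) (∑-swap xs ys f)) (sym (∑-+ ys (f x) _))

-- Indicators and canonical forms of subspaces.

𝟙 : Bool → ℕ
𝟙 b = if b then 1 else 0

𝟙-∧ : ∀ a b → 𝟙 (a ∧ b) ≡ 𝟙 a * 𝟙 b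
𝟙-∧ true  b = sym (+-identityʳ (𝟙 b))
𝟙-∧ false b = refl

_==_ : Bool → Bool → Bool
true  == b = b
false == b = not b

_==ᵛ_ : ∀ {n} → Vec Bool n → Vec Bool n → Bool
[]       ==ᵛ []       = true
(a ∷ as) ==ᵛ (b ∷ bs) = (a == b) ∧ (as ==ᵛ bs)

-- The subspaces of GF(2)^v of dimension k: ov K is GF(2) × K, and up K f is the graph {(f x , x) : x ∈ K} of a
-- linear functional, where f lists the values of the functional on the canonical basis of K.
data Gr : ℕ → ℕ → Set where
  nil : Gr 0 0
  ov  : ∀ {v k} → Gr v k → Gr (suc v) (suc k)
  up  : ∀ {v k} → Gr v k → Vec Bool k → Gr (suc v) k

allVec : ∀ n → List (Vec Bool n)
allVec zero    = [] ∷ []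
allVec (suc n) = List.map (false ∷_) (allVec n) ++ List.map (true ∷_) (allVec n)

allGr : ∀ v k → List (Gr v k)
ovs   : ∀ v k → List (Gr (suc v) k)
allGr zero    zero    = nil ∷ []
allGr zero    (suc k) = []
allGr (suc v) k       = ovs v k ++ cartesianProductWith up (allGr v k) (allVec k)
ovs v zero    = []
ovs v (suc k) = List.map ov (allGr v k)

∑-allVec : ∀ n (f : Vec Bool (suc n) → ℕ) →
  ∑ (allVec (suc n)) f ≡ ∑ (allVec n) (f ∘ (false ∷_)) + ∑ (allVec n) (f ∘ (true ∷_))
∑-allVec n f = trans (∑-++ (List.map (false ∷_) (allVec n)) _ f)
  (cong₂ _+_ (∑-map (false ∷_) (allVec n) f) (∑-map (true ∷_) (allVec n) f))

∑-allGr : ∀ v k (φ : Gr (suc v) k → ℕ) →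
  ∑ (allGr (suc v) k) φ ≡ ∑ (ovs v k) φ + ∑ (allGr v k) (λ K → ∑ (allVec k) (φ ∘ up K))
∑-allGr v k φ = trans (∑-++ (ovs v k) _ φ) (cong (∑ (ovs v k) φ +_)
  (∑-cartesianProductWith up (allGr v k) (allVec k) φ))

∑-ovs : ∀ v k (φ : Gr (suc v) (suc k) → ℕ) → ∑ (ovs v (suc k)) φ ≡ ∑ (allGr v k) (φ ∘ ov)
∑-ovs v k φ = ∑-map ov (allGr v k) φ

∑-small : ∀ v k (φ : Gr v k → ℕ) → v < k → ∑ (allGr v k) φ ≡ 0
∑-small zero    (suc k) φ p = refl
∑-small (suc v) (suc k) φ (s≤s p) = trans (∑-allGr v (suc k) φ)
  (cong₂ _+_ (trans (∑-ovs v k φ) (∑-small v k _ p)) (∑-small v (suc k) _ (m≤n⇒m≤1+n p)))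

-- Sums over the subspaces containing a given one.

res : ∀ {v t k} → Gr v t → Gr v k → Vec Bool k → Vec Bool t
res nil      nil      f           = []
res (ov T)   (ov K)   (a ∷ f)     = a ∷ res T K f
res (up T h) (ov K)   (false ∷ f) = res T K f
-- A point of `up T h` is (h x , x), so a functional with value 1 on the first unit vector picks up
-- the extra summand `h`.
res (up T h) (ov K)   (true ∷ f)  = zipWith _xor_ h (res T K f)
-- Default value: here T is not contained in K.
res (ov T)   (up K _) f           = false ∷ res T K f
res (up T h) (up K _) f           = res T K f

le : ∀ {v t k} → Gr v t → Gr v k → Bool
le nil      nil      = true
le (ov T)   (ov K)   = le T K
le (ov T)   (up K f) = false
le (up T g) (ov K)   = le T K
le (up T g) (up K f) = le T K ∧ (res T K f ==ᵛ g)

S : ∀ {v t} → Gr v t → ∀ k → (Gr v k → ℕ) → ℕ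
S {v} T k φ = ∑ (allGr v k) (λ K → 𝟙 (le T K) * φ K)

ext : ∀ {v t k} → Gr v t → Gr v k → Vec Bool t → (Vec Bool k → ℕ) → ℕ
ext {k = k} T K g ψ = ∑ (allVec k) (λ f → 𝟙 (res T K f ==ᵛ g) * ψ f)

S-cong : ∀ {v t} (T : Gr v t) k {φ χ : Gr v k → ℕ} → (∀ K → le T K ≡ true → φ K ≡ χ K) → S T k φ ≡ S T k χ
S-cong {v} T k {φ} {χ} p = ∑-cong (allGr v k) h
  where
  h : ∀ K → 𝟙 (le T K) * φ K ≡ 𝟙 (le T K) * χ K
  h K with le T K in eq
  ... | true  = cong (_+ 0) (p K eq)
  ... | false = refl

S-0 : ∀ {v t} (T : Gr v t) k → S T k (λ _ → 0) ≡ 0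
S-0 {v} T k = trans (∑-cong (allGr v k) (λ K → *-zeroʳ (𝟙 (le T K)))) (∑-0 (allGr v k))

S-* : ∀ {v t} (T : Gr v t) k c (φ : Gr v k → ℕ) → S T k (λ K → c * φ K) ≡ c * S T k φ
S-* {v} T k c φ = trans (∑-cong (allGr v k) (λ K → mid (𝟙 (le T K)) c (φ K))) (∑-* c (allGr v k) _)
  where
  mid : ∀ a b c → a * (b * c) ≡ b * (a * c)
  mid = solve-∀

S-+ : ∀ {v t} (T : Gr v t) k (φ χ : Gr v k → ℕ) → S T k (λ K → φ K + χ K) ≡ S T k φ + S T k χ
S-+ {v} T k φ χ = trans (∑-cong (allGr v k) (λ K → *-distribˡ-+ (𝟙 (le T K)) (φ K) (χ K))) (∑-+ (allGr v k) _ _)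

S-∑ : ∀ {v t} (T : Gr v t) k {B : Set} (ys : List B) (φ : B → Gr v k → ℕ) →
  S T k (λ K → ∑ ys (λ y → φ y K)) ≡ ∑ ys (λ y → S T k (φ y))
S-∑ T k []       φ = S-0 T k
S-∑ T k (y ∷ ys) φ = trans (S-+ T k (φ y) _) (cong (S T k (φ y) +_) (S-∑ T k ys φ))

S-small : ∀ {v t} (T : Gr v t) k (φ : Gr v k → ℕ) → v < k → S T k φ ≡ 0
S-small T k φ p = ∑-small _ k _ p

S-ov-suc : ∀ {v t} (T : Gr v t) k (φ : Gr (suc v) (suc k) → ℕ) → S (ov T) (suc k) φ ≡ S T k (φ ∘ ov)
S-ov-suc {v} T k φ = trans (∑-allGr v (suc k) _) (trans (cong₂ _+_ (∑-ovs v k _)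
  (trans (∑-cong (allGr v (suc k)) (λ K → ∑-0 (allVec (suc k)))) (∑-0 (allGr v (suc k))))) (+-identityʳ _))

S-ov-zero : ∀ {v t} (T : Gr v t) (φ : Gr (suc v) 0 → ℕ) → S (ov T) 0 φ ≡ 0
S-ov-zero {v} T φ = trans (∑-allGr v 0 _) (trans (∑-cong (allGr v 0) (λ K → ∑-0 (allVec 0))) (∑-0 (allGr v 0)))

Sup : ∀ {v t} (T : Gr v t) (g : Vec Bool t) k → (Gr (suc v) k → ℕ) → ℕ
Sup T g k φ = S T k (λ K → ext T K g (φ ∘ up K))

private
  Sup-eq : ∀ {v t} (T : Gr v t) (g : Vec Bool t) k (φ : Gr (suc v) k → ℕ) →
    ∑ (allGr v k) (λ K → ∑ (allVec k) (λ f → 𝟙 (le (up T g) (up K f)) * φ (up K f))) ≡ Sup T g k φ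
  Sup-eq {v} T g k φ = ∑-cong (allGr v k) (λ K → trans
    (∑-cong (allVec k) (λ f → trans (cong (_* φ (up K f)) (𝟙-∧ (le T K) (res T K f ==ᵛ g)))
                                    (*-assoc (𝟙 (le T K)) _ (φ (up K f)))))
    (∑-* (𝟙 (le T K)) (allVec k) _))

-- The q-Pascal recursion relative to T: a space containing a graph either contains the first unit
-- vector, or is itself a graph over some K containing T, with a functional that extends `g`.
S-up-suc : ∀ {v t} (T : Gr v t) g k (φ : Gr (suc v) (suc k) → ℕ) →
  S (up T g) (suc k) φ ≡ S T k (φ ∘ ov) + Sup T g (suc k) φ
S-up-suc {v} T g k φ = trans (∑-allGr v (suc k) _) (cong₂ _+_ (∑-ovs v k _) (Sup-eq T g (suc k) φ))

S-up-zero : ∀ {v t} (T : Gr v t) g (φ : Gr (suc v) 0 → ℕ) → S (up T g) 0 φ ≡ Sup T g 0 φ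
S-up-zero {v} T g φ = trans (∑-allGr v 0 _) (Sup-eq T g 0 φ)

ext-0 : ∀ {v t k} (T : Gr v t) (K : Gr v k) g → ext T K g (λ _ → 0) ≡ 0
ext-0 {k = k} T K g = trans (∑-cong (allVec k) (λ f → *-zeroʳ (𝟙 (res T K f ==ᵛ g)))) (∑-0 (allVec k))

_⊞ᵛ_ : ∀ {n} → Vec Bool n → Vec Bool n → Vec Bool n
_⊞ᵛ_ = zipWith _xor_

==ᵛ-shift : ∀ {n} (h r g : Vec Bool n) → ((h ⊞ᵛ r) ==ᵛ g) ≡ (r ==ᵛ (h ⊞ᵛ g))
==ᵛ-shift []      []      []      = refl
==ᵛ-shift (a ∷ h) (b ∷ r) (c ∷ g) = cong₂ _∧_ (bit a b c) (==ᵛ-shift h r g)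
  where
  bit : ∀ a b c → ((a xor b) == c) ≡ (b == (a xor c))
  bit true  true  true  = refl
  bit true  true  false = refl
  bit true  false true  = refl
  bit true  false false = refl
  bit false b     c     = refl

ext-ovov : ∀ {v t k} (T : Gr v t) (K : Gr v k) b g (ψ : Vec Bool (suc k) → ℕ) →
  ext (ov T) (ov K) (b ∷ g) ψ ≡ ext T K g (ψ ∘ (b ∷_))
ext-ovov {k = k} T K false g ψ = trans (∑-allVec k _) (trans (cong₂ _+_ refl (∑-0 (allVec k))) (+-identityʳ _))
ext-ovov {k = k} T K true  g ψ = trans (∑-allVec k _) (cong (_+ ext T K g (ψ ∘ (true ∷_))) (∑-0 (allVec k)))

ext-upov : ∀ {v t k} (T : Gr v t) h (K : Gr v k) g (ψ : Vec Bool (suc k) → ℕ) →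
  ext (up T h) (ov K) g ψ ≡ ext T K g (ψ ∘ (false ∷_)) + ext T K (h ⊞ᵛ g) (ψ ∘ (true ∷_))
ext-upov {k = k} T h K g ψ = trans (∑-allVec k _) (cong (ext T K g (ψ ∘ (false ∷_)) +_)
  (∑-cong (allVec k) (λ f → cong (λ z → 𝟙 z * ψ (true ∷ f)) (==ᵛ-shift h (res T K f) g))))

∧-trueˡ : ∀ {a b} → a ∧ b ≡ true → a ≡ true
∧-trueˡ {true} p = refl

∧-trueʳ : ∀ {a b} → a ∧ b ≡ true → b ≡ true
∧-trueʳ {true} p = p

le⇒≤ : ∀ {v t k} (T : Gr v t) (K : Gr v k) → le T K ≡ true → t ≤ k
le⇒≤ nil      nil      p = z≤n
le⇒≤ (ov T)   (ov K)   p = s≤s (le⇒≤ T K p)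
le⇒≤ (up T g) (ov K)   p = m≤n⇒m≤1+n (le⇒≤ T K p)
le⇒≤ (up T g) (up K f) p = le⇒≤ T K (∧-trueˡ p)

-- Restriction of functionals from K to T is onto, and its kernel has dimension k - t; all fibres
-- therefore have 2^(k - t) elements.
ext-count : ∀ {v t k} (T : Gr v t) (K : Gr v k) g c → le T K ≡ true → ext T K g (λ _ → c) ≡ 2 ^ (k ∸ t) * c
ext-count nil nil [] c p = +-identityʳ _
ext-count (ov T) (ov K) (b ∷ g) c p = trans (ext-ovov T K b g _) (ext-count T K g c p)
ext-count {t = t} (up T h) (ov {k = k} K) g c p = begin
  ext (up T h) (ov K) g (λ _ → c)                         ≡⟨ ext-upov T h K g _ ⟩
  ext T K g (λ _ → c) + ext T K (h ⊞ᵛ g) (λ _ → c)         ≡⟨ cong₂ _+_ (ext-count T K g c p) (ext-count T K _ c p) ⟩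
  2 ^ (k ∸ t) * c + 2 ^ (k ∸ t) * c                        ≡⟨ double (2 ^ (k ∸ t)) c ⟩
  2 ^ suc (k ∸ t) * c                                      ≡⟨ cong (λ z → 2 ^ z * c) (sym (+-∸-assoc 1 (le⇒≤ T K p))) ⟩
  2 ^ (suc k ∸ t) * c                                      ∎
  where
  open ≡-Reasoning
  double : ∀ a c → a * c + a * c ≡ 2 * a * c
  double = solve-∀
ext-count (up T h) (up K _) g c p = ext-count T K g c (∧-trueˡ p)

-- Cutting a subspace along the flag.

-- An inductive form of x + w = v, so that definitions can descend to V_x along a subspace without
-- transport.
data Cut : ℕ → ℕ → ℕ → Set where
  here  : ∀ {w} → Cut 0 w w
  there : ∀ {x w v} → Cut x w v → Cut (suc x) w (suc v)

-- The canonical basis orders its vectors by their last nonzero coordinate, so its first `a` vectors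
-- span K ∩ V_x when this has dimension `a`; truncating a functional is then restricting it. The
-- padding is reached only for a > k, where `J` vanishes.
takeP : ∀ a {k} → Vec Bool k → Vec Bool a
takeP zero    f       = []
takeP (suc a) []      = false ∷ takeP a []
takeP (suc a) (b ∷ f) = b ∷ takeP a f

takeP-⊞ : ∀ a {k} (f g : Vec Bool k) → takeP a (f ⊞ᵛ g) ≡ takeP a f ⊞ᵛ takeP a g
takeP-⊞ zero    f       g       = refl
takeP-⊞ (suc a) []      []      = cong (false ∷_) (takeP-⊞ a [] [])
takeP-⊞ (suc a) (b ∷ f) (c ∷ g) = cong ((b xor c) ∷_) (takeP-⊞ a f g)

-- The product of α (K ∩ V_x) and β (image of K in the quotient by V_x) if K ∩ V_x has dimension
-- `a`, and 0 otherwise. The first piece is built inside `α`, which is precomposed with each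
-- constructor passed on the way down.
J : ∀ {x w v k} → Cut x w v → (a : ℕ) → (Gr x a → ℕ) → (∀ {r} → Gr w r → ℕ) → Gr v k → ℕ
J (there c) a       α β (up K f) = J c a (λ A → α (up A (takeP a f))) β K
J here      zero    α β K        = α nil * β K
J here      (suc a) α β K        = 0
J (there c) zero    α β (ov K)   = 0
J (there c) (suc a) α β (ov K)   = J c a (α ∘ ov) β K

J-cong : ∀ {x w v k} (c : Cut x w v) a {α α′ : Gr x a → ℕ} (β : ∀ {r} → Gr w r → ℕ) (K : Gr v k) →
  (∀ A → α A ≡ α′ A) → J c a α β K ≡ J c a α′ β K
J-cong here      zero    β K        p = cong (_* β K) (p nil)
J-cong here      (suc a) β K        p = refl
J-cong (there c) zero    β (ov K)   p = refl
J-cong (there c) (suc a) β (ov K)   p = J-cong c a β K (p ∘ ov)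
J-cong (there c) a       β (up K f) p = J-cong c a β K (λ A → p (up A (takeP a f)))

J-+ : ∀ {x w v k} (c : Cut x w v) a (α α′ : Gr x a → ℕ) (β : ∀ {r} → Gr w r → ℕ) (K : Gr v k) →
  J c a (λ A → α A + α′ A) β K ≡ J c a α β K + J c a α′ β K
J-+ here      zero    α α′ β K        = *-distribʳ-+ (β K) (α nil) (α′ nil)
J-+ here      (suc a) α α′ β K        = refl
J-+ (there c) zero    α α′ β (ov K)   = refl
J-+ (there c) (suc a) α α′ β (ov K)   = J-+ c a _ _ β K
J-+ (there c) a       α α′ β (up K f) = J-+ c a _ _ β K

J-zero : ∀ {x w v k} (c : Cut x w v) a (α : Gr x a → ℕ) (β : ∀ {r} → Gr w r → ℕ) (K : Gr v k) → k < a → J c a α β K ≡ 0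
J-zero here      (suc a) α β K        p = refl
J-zero (there c) (suc a) α β (ov K)   (s≤s p) = J-zero c a _ β K p
J-zero (there c) (suc a) α β (up K f) p = J-zero c (suc a) _ β K p

-- T ∩ V_x and the image of T in the quotient by V_x, given as a relation so that proofs can recurse
-- on it together with the cut.
data Split : ∀ {x w v tA tR t} → Cut x w v → Gr x tA → Gr w tR → Gr v t → Set where
  here : ∀ {w t} {T : Gr w t} → Split here nil T T
  ov   : ∀ {x w v tA tR t} {c : Cut x w v} {TA : Gr x tA} {TR : Gr w tR} {T : Gr v t} →
         Split c TA TR T → Split (there c) (ov TA) TR (ov T)
  up   : ∀ {x w v tA tR t} {c : Cut x w v} {TA : Gr x tA} {TR : Gr w tR} {T : Gr v t} →
         Split c TA TR T → (g : Vec Bool t) → Split (there c) (up TA (takeP tA g)) TR (up T g)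

split : ∀ {x w v t} (c : Cut x w v) (T : Gr v t) →
  ∃ λ tA → ∃ λ tR → Σ (Gr x tA) λ TA → Σ (Gr w tR) λ TR → tA + tR ≡ t × Split c TA TR T
split here      T        = _ , _ , _ , _ , refl , here
split (there c) (ov T)   with split c T
... | _ , _ , _ , _ , e , s = _ , _ , _ , _ , cong suc e , ov s
split (there c) (up T g) with split c T
... | _ , _ , _ , _ , e , s = _ , _ , _ , _ , e , up s g

-- Functionals extending g from T to K restrict to functionals extending g from T ∩ V_x to K ∩ V_x,
-- with fibres of constant size.
ext-J : ∀ {x w v tA tR t k} {c : Cut x w v} {TA : Gr x tA} {TR : Gr w tR} {T : Gr v t} → Split c TA TR T →
  (K : Gr v k) → le T K ≡ true → ∀ a r → a + r ≡ k → (g : Vec Bool t)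
  (ψ : Gr x a → Vec Bool a → ℕ) (β : ∀ {r} → Gr w r → ℕ) →
  ext T K g (λ f → J c a (λ A → ψ A (takeP a f)) β K)
    ≡ J c a (λ A → 2 ^ (r ∸ tR) * ext TA A (takeP tA g) (ψ A)) β K
ext-J {tR = tR} {T = T} here K p zero r refl g ψ β =
  trans (ext-count T K g _ p) (assoc (2 ^ (r ∸ tR)) (ψ nil []) (β K))
  where
  assoc : ∀ a b c → a * (b * c) ≡ a * (b + 0 + 0) * c
  assoc = solve-∀
ext-J {T = T} here K p (suc a) r e g ψ β = ext-0 T K g
ext-J (ov {T = T} s) (ov K) p zero r e (b ∷ g) ψ β = trans (ext-ovov T K b g _) (ext-0 T K g)
ext-J {tR = tR} (ov {tA = tA} {c = c} {TA} {TR} {T} s) (ov K) p (suc a) r e (b ∷ g) ψ β =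
  trans (ext-ovov T K b g _)
  (trans (ext-J s K p a r (suc-injective e) g (λ A f → ψ (ov A) (b ∷ f)) β)
         (J-cong c a β K (λ A → cong (2 ^ (r ∸ tR) *_) (sym (ext-ovov TA A b (takeP tA g) (ψ (ov A)))))))
ext-J (up {T = T} s h) (ov K) p zero r e g ψ β =
  trans (ext-upov T h K g _) (cong₂ _+_ (ext-0 T K g) (ext-0 T K (h ⊞ᵛ g)))
ext-J {tR = tR} (up {tA = tA} {c = c} {TA} {TR} {T} s h) (ov K) p (suc a) r e g ψ β = begin
  ext (up T h) (ov K) g _
    ≡⟨ ext-upov T h K g _ ⟩
  ext T K g (λ f → J c a (λ A → ψ (ov A) (false ∷ takeP a f)) β K)
    + ext T K (h ⊞ᵛ g) (λ f → J c a (λ A → ψ (ov A) (true ∷ takeP a f)) β K)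
    ≡⟨ cong₂ _+_ (ext-J s K p a r (suc-injective e) g (λ A f → ψ (ov A) (false ∷ f)) β)
                 (ext-J s K p a r (suc-injective e) (h ⊞ᵛ g) (λ A f → ψ (ov A) (true ∷ f)) β) ⟩
  J c a (λ A → m * ext TA A (takeP tA g) (ψ (ov A) ∘ (false ∷_))) β K
    + J c a (λ A → m * ext TA A (takeP tA (h ⊞ᵛ g)) (ψ (ov A) ∘ (true ∷_))) β K
    ≡⟨ sym (J-+ c a _ _ β K) ⟩
  J c a (λ A → m * ext TA A (takeP tA g) (ψ (ov A) ∘ (false ∷_)) + m * ext TA A (takeP tA (h ⊞ᵛ g)) (ψ (ov A) ∘ (true ∷_))) β K
    ≡⟨ J-cong c a β K (λ A → trans (sym (*-distribˡ-+ m _ _)) (cong (m *_)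
         (trans (cong (λ z → ext TA A (takeP tA g) (ψ (ov A) ∘ (false ∷_)) + ext TA A z (ψ (ov A) ∘ (true ∷_))) (takeP-⊞ tA h g))
                (sym (ext-upov TA (takeP tA h) A (takeP tA g) (ψ (ov A))))))) ⟩
  J (there c) (suc a) (λ A → m * ext (up TA (takeP tA h)) A (takeP tA g) (ψ A)) β (ov K) ∎
  where
  open ≡-Reasoning
  m = 2 ^ (r ∸ tR)
ext-J (up {c = c} s h) (up K f) p a r e g ψ β =
  ext-J s K (∧-trueˡ p) a r e g (λ A → ψ (up A (takeP a f))) β

private
  fold-ov : ∀ P E O U s → P * E * (O * s) + P * (E * U * s) ≡ (E * P) * ((O + U) * s)
  fold-ov = solve-∀

  fold-up : ∀ P E U s → P * (E * U * s) ≡ (E * P) * (U * s)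
  fold-up = solve-∀

-- The spaces K with K ∩ V_x = A and image B correspond to the linear maps from B to V_x / A, and K
-- contains T when the map has prescribed values on `TR`. This leaves 2^((x - a)(r - tR)) choices
-- whatever A and B are, so the two pieces vary independently.
S-J : ∀ {x w v tA tR t} {c : Cut x w v} {TA : Gr x tA} {TR : Gr w tR} {T : Gr v t} → Split c TA TR T →
  ∀ k a r → a + r ≡ k → (α : Gr x a → ℕ) (β : ∀ {r} → Gr w r → ℕ) →
  S T k (J c a α β) ≡ 2 ^ ((x ∸ a) * (r ∸ tR)) * (S TA a α * S TR r β)
S-J {T = T} here k zero r refl α β = trans (S-* T r (α nil) β) (one (α nil) (S T r β))
  where
  one : ∀ a b → a * b ≡ 1 * ((1 * a + 0) * b)
  one = solve-∀
S-J {tR = tR} {TR = TR} {T} here k (suc a) r e α β =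
  trans (S-0 T k) (sym (*-zeroʳ (2 ^ ((0 ∸ suc a) * (r ∸ tR)))))
S-J {tR = tR} (ov {x = x} {TA = TA} {TR} {T} s) zero zero r e α β =
  trans (S-ov-zero T _) (sym (trans (cong (λ z → 2 ^ (suc x * (r ∸ tR)) * (z * S TR r β)) (S-ov-zero TA α)) (*-zeroʳ (2 ^ (suc x * (r ∸ tR))))))
S-J {tR = tR} (ov {x = x} {TA = TA} {TR} {T} s) (suc k) zero r e α β =
  trans (S-ov-suc T k _) (trans (S-0 T k)
  (sym (trans (cong (λ z → 2 ^ (suc x * (r ∸ tR)) * (z * S TR r β)) (S-ov-zero TA α)) (*-zeroʳ (2 ^ (suc x * (r ∸ tR)))))))
S-J {tR = tR} (ov {x = x} {TA = TA} {TR} {T} s) (suc k) (suc a) r e α β =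
  trans (S-ov-suc T k _) (trans (S-J s k a r (suc-injective e) (α ∘ ov) β)
  (cong (λ z → 2 ^ ((x ∸ a) * (r ∸ tR)) * (z * S TR r β)) (sym (S-ov-suc TA a α))))
S-J {tR = tR} (up {x = x} {tA = tA} {c = c} {TA} {TR} {T} s g) k a r e α β = go k a e α
  where
  open ≡-Reasoning
  E = 2 ^ (r ∸ tR)
  g′ = takeP tA g
  upper : ∀ k a → a + r ≡ k → (α : Gr (suc x) a → ℕ) →
    Sup T g k (J (there c) a α β) ≡ 2 ^ ((x ∸ a) * (r ∸ tR)) * (E * Sup TA g′ a α * S TR r β)
  upper k a e α = begin
    S T k (λ K → ext T K g (λ f → J c a (λ A → α (up A (takeP a f))) β K))
      ≡⟨ S-cong T k (λ K p → ext-J s K p a r e g (λ A f → α (up A f)) β) ⟩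
    S T k (J c a (λ A → E * ext TA A g′ (α ∘ up A)) β)
      ≡⟨ S-J s k a r e _ β ⟩
    2 ^ ((x ∸ a) * (r ∸ tR)) * (S TA a (λ A → E * ext TA A g′ (α ∘ up A)) * S TR r β)
      ≡⟨ cong (λ z → 2 ^ ((x ∸ a) * (r ∸ tR)) * (z * S TR r β)) (S-* TA a E _) ⟩
    2 ^ ((x ∸ a) * (r ∸ tR)) * (E * Sup TA g′ a α * S TR r β) ∎
  step : ∀ a → a ≤ x → 2 ^ ((suc x ∸ a) * (r ∸ tR)) ≡ E * 2 ^ ((x ∸ a) * (r ∸ tR))
  step a p = trans (cong (λ z → 2 ^ (z * (r ∸ tR))) (+-∸-assoc 1 p)) (^-distribˡ-+-* 2 (r ∸ tR) _)
  up-small : ∀ a (α : Gr (suc x) a → ℕ) → ¬ a ≤ x → Sup TA g′ a α ≡ 0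
  up-small a α p = S-small TA a _ (≰⇒> p)
  go : ∀ k a → a + r ≡ k → (α : Gr (suc x) a → ℕ) →
    S (up T g) k (J (there c) a α β) ≡ 2 ^ ((suc x ∸ a) * (r ∸ tR)) * (S (up TA g′) a α * S TR r β)
  go zero zero e α = begin
    S (up T g) 0 (J (there c) 0 α β)                      ≡⟨ S-up-zero T g _ ⟩
    Sup T g 0 (J (there c) 0 α β)                         ≡⟨ upper 0 0 e α ⟩
    2 ^ (x * (r ∸ tR)) * (E * Sup TA g′ 0 α * S TR r β)   ≡⟨ fold-up (2 ^ (x * (r ∸ tR))) E (Sup TA g′ 0 α) (S TR r β) ⟩
    (E * 2 ^ (x * (r ∸ tR))) * (Sup TA g′ 0 α * S TR r β) ≡⟨ cong₂ (λ y z → y * (z * S TR r β)) (sym (step 0 z≤n)) (sym (S-up-zero TA g′ α)) ⟩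
    2 ^ (suc x * (r ∸ tR)) * (S (up TA g′) 0 α * S TR r β) ∎
  go (suc k) zero e α = begin
    S (up T g) (suc k) (J (there c) 0 α β)                ≡⟨ S-up-suc T g k _ ⟩
    S T k (λ _ → 0) + Sup T g (suc k) (J (there c) 0 α β) ≡⟨ cong₂ _+_ (S-0 T k) (upper (suc k) 0 e α) ⟩
    2 ^ (x * (r ∸ tR)) * (E * Sup TA g′ 0 α * S TR r β)   ≡⟨ fold-up (2 ^ (x * (r ∸ tR))) E (Sup TA g′ 0 α) (S TR r β) ⟩
    (E * 2 ^ (x * (r ∸ tR))) * (Sup TA g′ 0 α * S TR r β) ≡⟨ cong₂ (λ y z → y * (z * S TR r β)) (sym (step 0 z≤n)) (sym (S-up-zero TA g′ α)) ⟩
    2 ^ (suc x * (r ∸ tR)) * (S (up TA g′) 0 α * S TR r β) ∎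
  go (suc k) (suc a) e α = trans (S-up-suc T g k _) (trans
    (cong₂ _+_ (S-J s k a r (suc-injective e) (α ∘ ov) β) (upper (suc k) (suc a) e α))
    (trans (last (suc a ≤? x)) (cong (λ z → 2 ^ ((x ∸ a) * (r ∸ tR)) * (z * S TR r β)) (sym (S-up-suc TA g′ a α)))))
    where
    O = S TA a (α ∘ ov)
    U = Sup TA g′ (suc a) α
    s′ = S TR r β
    P = 2 ^ ((x ∸ suc a) * (r ∸ tR))
    last : _ → 2 ^ ((x ∸ a) * (r ∸ tR)) * (O * s′) + P * (E * U * s′) ≡ 2 ^ ((x ∸ a) * (r ∸ tR)) * ((O + U) * s′)
    last (yes q) = begin
      2 ^ ((x ∸ a) * (r ∸ tR)) * (O * s′) + P * (E * U * s′) ≡⟨ cong (λ z → z * (O * s′) + P * (E * U * s′)) (trans (step (suc a) q) (*-comm E P)) ⟩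
      P * E * (O * s′) + P * (E * U * s′)                    ≡⟨ fold-ov P E O U s′ ⟩
      (E * P) * ((O + U) * s′)                               ≡⟨ cong (_* ((O + U) * s′)) (sym (step (suc a) q)) ⟩
      2 ^ ((x ∸ a) * (r ∸ tR)) * ((O + U) * s′) ∎
    -- For a ≥ x the truncated exponent stops growing, but `U` then runs over spaces of dimension a
    -- + 1 in dimension x and is 0.
    last (no q) rewrite up-small (suc a) α q = none (2 ^ ((x ∸ a) * (r ∸ tR))) P E O s′
      where
      none : ∀ Q P E O s → Q * (O * s) + P * (E * 0 * s) ≡ Q * ((O + 0) * s)
      none = solve-∀

-- Points, coordinates and bases of the canonical forms.

dot : ∀ {n} → Vec Bool n → Vec Bool n → Bool
dot []      []      = false
dot (a ∷ f) (b ∷ c) = (a ∧ b) xor dot f c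

coords : ∀ {v k} → Gr v k → Pt v → Vec Bool k
coords nil      []       = []
coords (ov K)   (x ∷ xs) = x ∷ coords K xs
coords (up K f) (x ∷ xs) = coords K xs

mem : ∀ {v k} → Gr v k → SubsetV v
mem nil      []       = true
mem (ov K)   (x ∷ xs) = mem K xs
mem (up K f) (x ∷ xs) = mem K xs ∧ (x == dot f (coords K xs))

emb : ∀ {v k} → Gr v k → Vec Bool k → Pt v
emb nil      []       = []
emb (ov K)   (c ∷ cs) = c ∷ emb K cs
emb (up K f) cs       = dot f cs ∷ emb K cs

basis : ∀ {v k} → Gr v k → Vec (Pt v) k
basis nil      = []
basis (ov K)   = (true ∷ 0V) ∷ map (false ∷_) (basis K)
basis (up K f) = zipWith _∷_ f (basis K)

∧-true : ∀ {a b} → a ≡ true → b ≡ true → a ∧ b ≡ true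
∧-true refl refl = refl

==-refl : ∀ a → (a == a) ≡ true
==-refl true  = refl
==-refl false = refl

==⇒≡ : ∀ a b → (a == b) ≡ true → a ≡ b
==⇒≡ true  true  p = refl
==⇒≡ false false p = refl

==ᵛ-refl : ∀ {n} (a : Vec Bool n) → (a ==ᵛ a) ≡ true
==ᵛ-refl []      = refl
==ᵛ-refl (b ∷ a) = cong₂ _∧_ (==-refl b) (==ᵛ-refl a)

==ᵛ⇒≡ : ∀ {n} (a b : Vec Bool n) → (a ==ᵛ b) ≡ true → a ≡ b
==ᵛ⇒≡ []      []      p = refl
==ᵛ⇒≡ (x ∷ a) (y ∷ b) p = cong₂ _∷_ (==⇒≡ x y (∧-trueˡ p)) (==ᵛ⇒≡ a b (∧-trueʳ {x == y} p))

⊕-identityˡ : ∀ {n} (x : Pt n) → 0V ⊕ x ≡ x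
⊕-identityˡ = zipWith-identityˡ (λ _ → refl)

⊕-identityʳ : ∀ {n} (x : Pt n) → x ⊕ 0V ≡ x
⊕-identityʳ = zipWith-identityʳ xor-identityʳ

⊕-assoc : ∀ {n} (x y z : Pt n) → (x ⊕ y) ⊕ z ≡ x ⊕ (y ⊕ z)
⊕-assoc = zipWith-assoc xor-assoc

⊕-comm : ∀ {n} (x y : Pt n) → x ⊕ y ≡ y ⊕ x
⊕-comm = zipWith-comm xor-comm

⊕-self : ∀ {n} (x : Pt n) → x ⊕ x ≡ 0V
⊕-self []      = refl
⊕-self (b ∷ x) = cong₂ _∷_ (xor-same b) (⊕-self x)

⊕-cancel : ∀ {n} (x y : Pt n) → x ⊕ y ≡ 0V → x ≡ y
⊕-cancel x y e = begin
  x              ≡⟨ sym (⊕-identityʳ x) ⟩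
  x ⊕ 0V         ≡⟨ cong (x ⊕_) (sym (⊕-self y)) ⟩
  x ⊕ (y ⊕ y)    ≡⟨ sym (⊕-assoc x y y) ⟩
  (x ⊕ y) ⊕ y    ≡⟨ cong (_⊕ y) e ⟩
  0V ⊕ y         ≡⟨ ⊕-identityˡ y ⟩
  y              ∎
  where open ≡-Reasoning

dot-0 : ∀ {n} (f : Vec Bool n) → dot f 0V ≡ false
dot-0 []      = refl
dot-0 (a ∷ f) = cong₂ _xor_ (∧-zeroʳ a) (dot-0 f)

xor-mid : ∀ a b c d → (a xor b) xor (c xor d) ≡ (a xor c) xor (b xor d)
xor-mid a b c d = trans (xor-assoc a b (c xor d)) (trans (cong (a xor_)
  (trans (sym (xor-assoc b c d)) (trans (cong (_xor d) (xor-comm b c)) (xor-assoc c b d))))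
  (sym (xor-assoc a c (b xor d))))

dot-⊕ : ∀ {n} (f c d : Vec Bool n) → dot f (c ⊕ d) ≡ dot f c xor dot f d
dot-⊕ []      []      []      = refl
dot-⊕ (a ∷ f) (b ∷ c) (e ∷ d) = trans (cong₂ _xor_ (∧-distribˡ-xor a b e) (dot-⊕ f c d)) (xor-mid (a ∧ b) (a ∧ e) (dot f c) (dot f d))

coords-0 : ∀ {v k} (K : Gr v k) → coords K 0V ≡ 0V
coords-0 nil      = refl
coords-0 (ov K)   = cong (false ∷_) (coords-0 K)
coords-0 (up K f) = coords-0 K

coords-⊕ : ∀ {v k} (K : Gr v k) x y → coords K (x ⊕ y) ≡ coords K x ⊕ coords K y
coords-⊕ nil      []       []       = refl
coords-⊕ (ov K)   (x ∷ xs) (y ∷ ys) = cong ((x xor y) ∷_) (coords-⊕ K xs ys)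
coords-⊕ (up K f) (x ∷ xs) (y ∷ ys) = coords-⊕ K xs ys

dot-coords-0 : ∀ {v k} (K : Gr v k) f → dot f (coords K 0V) ≡ false
dot-coords-0 K f = trans (cong (dot f) (coords-0 K)) (dot-0 f)

mem-0 : ∀ {v k} (K : Gr v k) → mem K 0V ≡ true
mem-0 nil      = refl
mem-0 (ov K)   = mem-0 K
mem-0 (up K f) = cong₂ _∧_ (mem-0 K) (cong (false ==_) (dot-coords-0 K f))

mem-⊕ : ∀ {v k} (K : Gr v k) x y → mem K x ≡ true → mem K y ≡ true → mem K (x ⊕ y) ≡ true
mem-⊕ nil      []       []       p q = refl
mem-⊕ (ov K)   (x ∷ xs) (y ∷ ys) p q = mem-⊕ K xs ys p q
mem-⊕ (up K f) (x ∷ xs) (y ∷ ys) p q = ∧-true (mem-⊕ K xs ys (∧-trueˡ p) (∧-trueˡ q))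
  (trans (cong₂ _==_ (cong₂ _xor_ x≡ y≡) (trans (cong (dot f) (coords-⊕ K xs ys)) (dot-⊕ f (coords K xs) (coords K ys))))
         (==-refl (dot f (coords K xs) xor dot f (coords K ys))))
  where
  x≡ : x ≡ dot f (coords K xs)
  x≡ = ==⇒≡ x (dot f (coords K xs)) (∧-trueʳ {mem K xs} p)
  y≡ : y ≡ dot f (coords K ys)
  y≡ = ==⇒≡ y (dot f (coords K ys)) (∧-trueʳ {mem K ys} q)

coords-emb : ∀ {v k} (K : Gr v k) c → coords K (emb K c) ≡ c
coords-emb nil      []       = refl
coords-emb (ov K)   (c ∷ cs) = cong (c ∷_) (coords-emb K cs)
coords-emb (up K f) cs       = coords-emb K cs

mem-emb : ∀ {v k} (K : Gr v k) c → mem K (emb K c) ≡ true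
mem-emb nil      []       = refl
mem-emb (ov K)   (c ∷ cs) = mem-emb K cs
mem-emb (up K f) cs       = cong₂ _∧_ (mem-emb K cs) (trans (cong (λ z → dot f cs == dot f z) (coords-emb K cs)) (==-refl (dot f cs)))

emb-coords : ∀ {v k} (K : Gr v k) x → mem K x ≡ true → emb K (coords K x) ≡ x
emb-coords nil      []       p = refl
emb-coords (ov K)   (x ∷ xs) p = cong (x ∷_) (emb-coords K xs p)
emb-coords (up K f) (x ∷ xs) p = cong₂ _∷_ (sym (==⇒≡ x (dot f (coords K xs)) (∧-trueʳ {mem K xs} p))) (emb-coords K xs (∧-trueˡ p))

lincomb-false : ∀ {v n} (c : Vec Bool n) (bs : Vec (Pt v) n) → lincomb c (map (false ∷_) bs) ≡ false ∷ lincomb c bs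
lincomb-false []          []       = refl
lincomb-false (true ∷ c)  (b ∷ bs) = cong ((false ∷ b) ⊕_) (lincomb-false c bs)
lincomb-false (false ∷ c) (b ∷ bs) = lincomb-false c bs

lincomb-zip : ∀ {v n} (c f : Vec Bool n) (bs : Vec (Pt v) n) → lincomb c (zipWith _∷_ f bs) ≡ dot f c ∷ lincomb c bs
lincomb-zip []          []      []       = refl
lincomb-zip (true ∷ c)  (a ∷ f) (b ∷ bs) = trans (cong ((a ∷ b) ⊕_) (lincomb-zip c f bs))
  (cong (λ z → (z xor dot f c) ∷ (b ⊕ lincomb c bs)) (sym (∧-identityʳ a)))
lincomb-zip (false ∷ c) (a ∷ f) (b ∷ bs) = trans (lincomb-zip c f bs) (cong (λ z → (z xor dot f c) ∷ lincomb c bs) (sym (∧-zeroʳ a)))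

lincomb-basis : ∀ {v k} (K : Gr v k) c → lincomb c (basis K) ≡ emb K c
lincomb-basis nil      []          = refl
lincomb-basis (ov K)   (true ∷ c)  = trans (cong ((true ∷ 0V) ⊕_) (lincomb-false c (basis K)))
  (cong (true ∷_) (trans (⊕-identityˡ _) (lincomb-basis K c)))
lincomb-basis (ov K)   (false ∷ c) = trans (lincomb-false c (basis K)) (cong (false ∷_) (lincomb-basis K c))
lincomb-basis (up K f) c           = trans (lincomb-zip c f (basis K)) (cong (dot f c ∷_) (lincomb-basis K c))

LinIndep-basis : ∀ {v k} (K : Gr v k) → LinIndep (basis K)
LinIndep-basis K c e = trans (sym (coords-emb K c)) (trans (cong (coords K) (trans (sym (lincomb-basis K c)) e)) (coords-0 K))

mem-isSubspace : ∀ {v k} (K : Gr v k) → IsSubspace v k (mem K)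
mem-isSubspace K = basis K , LinIndep-basis K , λ x → mk⇔
  (λ p → coords K x , trans (lincomb-basis K _) (emb-coords K x p))
  (λ { (c , refl) → trans (cong (mem K) (lincomb-basis K c)) (mem-emb K c) })

∑-mem : ∀ {v k} (K : Gr v k) (ψ : Pt v → ℕ) →
  ∑ (allVec v) (λ y → 𝟙 (mem K y) * ψ y) ≡ ∑ (allVec k) (ψ ∘ emb K)
∑-mem nil ψ = cong (_+ 0) (*-identityˡ (ψ []))
∑-mem (ov {v} {k} K) ψ = trans (∑-allVec v _) (trans
  (cong₂ _+_ (∑-mem K (ψ ∘ (false ∷_))) (∑-mem K (ψ ∘ (true ∷_)))) (sym (∑-allVec k _)))
∑-mem (up {v} {k} K f) ψ = begin
  ∑ (allVec (suc v)) (λ y → 𝟙 (mem (up K f) y) * ψ y)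
    ≡⟨ ∑-allVec v _ ⟩
  ∑ (allVec v) (λ y → 𝟙 (mem K y ∧ (false == d y)) * ψ (false ∷ y)) + ∑ (allVec v) (λ y → 𝟙 (mem K y ∧ (true == d y)) * ψ (true ∷ y))
    ≡⟨ sym (∑-+ (allVec v) _ _) ⟩
  ∑ (allVec v) (λ y → 𝟙 (mem K y ∧ (false == d y)) * ψ (false ∷ y) + 𝟙 (mem K y ∧ (true == d y)) * ψ (true ∷ y))
    ≡⟨ ∑-cong (allVec v) (λ y → pick (mem K y) (d y) (λ b → ψ (b ∷ y))) ⟩
  ∑ (allVec v) (λ y → 𝟙 (mem K y) * ψ (d y ∷ y))
    ≡⟨ ∑-mem K (λ y → ψ (d y ∷ y)) ⟩
  ∑ (allVec k) (λ c → ψ (d (emb K c) ∷ emb K c))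
    ≡⟨ ∑-cong (allVec k) (λ c → cong (λ z → ψ (dot f z ∷ emb K c)) (coords-emb K c)) ⟩
  ∑ (allVec k) (ψ ∘ emb (up K f)) ∎
  where
  open ≡-Reasoning
  d : Pt v → Bool
  d y = dot f (coords K y)
  pick : ∀ m b (χ : Bool → ℕ) → 𝟙 (m ∧ (false == b)) * χ false + 𝟙 (m ∧ (true == b)) * χ true ≡ 𝟙 m * χ b
  pick false b     χ = refl
  pick true  true  χ = refl
  pick true  false χ = +-identityʳ _

∑-const : ∀ n c → ∑ (allVec n) (λ _ → c) ≡ 2 ^ n * c
∑-const zero    c = refl
∑-const (suc n) c = trans (∑-allVec n _) (trans (cong₂ _+_ (∑-const n c) (∑-const n c))
  (trans (sym (*-distribʳ-+ c (2 ^ n) (2 ^ n))) (cong (λ z → (2 ^ n + z) * c) (sym (+-identityʳ (2 ^ n))))))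

allIn : ∀ {v n k} → Vec (Pt v) n → Gr v k → Bool
allIn []       K = true
allIn (x ∷ xs) K = mem K x ∧ allIn xs K

dots : ∀ {v k n} → Gr v k → Vec Bool k → Vec (Pt v) n → Vec Bool n
dots K f = map (λ b → dot f (coords K b))

allIn-false : ∀ {v n k} (bs : Vec (Pt v) n) (K : Gr v k) → allIn (map (false ∷_) bs) (ov K) ≡ allIn bs K
allIn-false []       K = refl
allIn-false (b ∷ bs) K = cong (mem K b ∧_) (allIn-false bs K)

allIn-zip-ov : ∀ {v n k} (g : Vec Bool n) (bs : Vec (Pt v) n) (K : Gr v k) → allIn (zipWith _∷_ g bs) (ov K) ≡ allIn bs K
allIn-zip-ov []      []       K = refl
allIn-zip-ov (_ ∷ g) (b ∷ bs) K = cong (mem K b ∧_) (allIn-zip-ov g bs K)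

==-comm : ∀ a b → (a == b) ≡ (b == a)
==-comm true  true  = refl
==-comm true  false = refl
==-comm false true  = refl
==-comm false false = refl

∧-swap : ∀ a b c d → (a ∧ b) ∧ (c ∧ d) ≡ (a ∧ c) ∧ (b ∧ d)
∧-swap false b     c     d = refl
∧-swap true  true  c     d = refl
∧-swap true  false true  d = refl
∧-swap true  false false d = refl

allIn-zip-up : ∀ {v n k} (g : Vec Bool n) (bs : Vec (Pt v) n) (K : Gr v k) f →
  allIn (zipWith _∷_ g bs) (up K f) ≡ allIn bs K ∧ (dots K f bs ==ᵛ g)
allIn-zip-up []      []       K f = refl
allIn-zip-up (a ∷ g) (b ∷ bs) K f = trans
  (cong₂ (λ y z → (mem K b ∧ y) ∧ z) (==-comm a _) (allIn-zip-up g bs K f)) (∧-swap (mem K b) _ _ _)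

dots-ov-false : ∀ {v k n} (K : Gr v k) a f (bs : Vec (Pt v) n) → dots (ov K) (a ∷ f) (map (false ∷_) bs) ≡ dots K f bs
dots-ov-false K a f []       = refl
dots-ov-false K a f (b ∷ bs) = cong₂ _∷_ (cong (_xor dot f (coords K b)) (∧-zeroʳ a)) (dots-ov-false K a f bs)

res-dots : ∀ {v t k} (T : Gr v t) (K : Gr v k) f → le T K ≡ true → res T K f ≡ dots K f (basis T)
res-dots nil      nil      f           p = refl
res-dots (ov T)   (ov K)   (a ∷ f)     p = cong₂ _∷_
  (sym (trans (cong₂ _xor_ (∧-identityʳ a) (dot-coords-0 K f)) (xor-identityʳ a)))
  (trans (res-dots T K f p) (sym (dots-ov-false K a f (basis T))))
res-dots (up T h) (ov K)   (false ∷ f) p = trans (res-dots T K f p) (go h (basis T))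
  where
  go : ∀ {n} (h : Vec Bool n) (bs : Vec (Pt _) n) → dots K f bs ≡ dots (ov K) (false ∷ f) (zipWith _∷_ h bs)
  go []      []       = refl
  go (_ ∷ h) (b ∷ bs) = cong (_ ∷_) (go h bs)
res-dots (up T h) (ov K)   (true ∷ f)  p = trans (cong (h ⊞ᵛ_) (res-dots T K f p)) (go h (basis T))
  where
  go : ∀ {n} (h : Vec Bool n) (bs : Vec (Pt _) n) → h ⊞ᵛ dots K f bs ≡ dots (ov K) (true ∷ f) (zipWith _∷_ h bs)
  go []      []       = refl
  go (_ ∷ h) (b ∷ bs) = cong (_ ∷_) (go h bs)
res-dots (up T h) (up K g) f           p = trans (res-dots T K f (∧-trueˡ p)) (go h (basis T))
  where
  go : ∀ {n} (h : Vec Bool n) (bs : Vec (Pt _) n) → dots K f bs ≡ dots (up K g) f (zipWith _∷_ h bs)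
  go []      []       = refl
  go (_ ∷ h) (b ∷ bs) = cong (_ ∷_) (go h bs)

-- Links the recursive test to geometry: a subspace contains T as soon as it contains a basis of T,
-- and in the graph case `res` gives the values of the functional on that basis.
le-allIn : ∀ {v t k} (T : Gr v t) (K : Gr v k) → le T K ≡ allIn (basis T) K
le-allIn nil      nil      = refl
le-allIn (ov T)   (ov K)   = trans (le-allIn T K) (trans (sym (allIn-false (basis T) K)) (cong (_∧ allIn (map (false ∷_) (basis T)) (ov K)) (sym (mem-0 K))))
le-allIn (ov T)   (up K f) rewrite dot-coords-0 K f | ∧-zeroʳ (mem K 0V) = refl
le-allIn (up T g) (ov K)   = trans (le-allIn T K) (sym (allIn-zip-ov g (basis T) K))
le-allIn (up T g) (up K f) with le T K in eq
... | true  = sym (trans (allIn-zip-up g (basis T) K f) (cong₂ _∧_ (trans (sym (le-allIn T K)) eq) (cong (_==ᵛ g) (sym (res-dots T K f eq)))))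
... | false = sym (trans (allIn-zip-up g (basis T) K f) (cong (_∧ (dots K f (basis T) ==ᵛ g)) (trans (sym (le-allIn T K)) eq)))

lincomb-mem : ∀ {v n k} (K : Gr v k) (c : Vec Bool n) (bs : Vec (Pt v) n) → allIn bs K ≡ true → mem K (lincomb c bs) ≡ true
lincomb-mem K []          []       p = mem-0 K
lincomb-mem K (true ∷ c)  (b ∷ bs) p = mem-⊕ K b _ (∧-trueˡ p) (lincomb-mem K c bs (∧-trueʳ {mem K b} p))
lincomb-mem K (false ∷ c) (b ∷ bs) p = lincomb-mem K c bs (∧-trueʳ {mem K b} p)

le⇒⊆ : ∀ {v t k} (T : Gr v t) (K : Gr v k) → le T K ≡ true → mem T ⊆S mem K
le⇒⊆ T K p x q = subst (λ z → mem K z ≡ true) (trans (lincomb-basis T _) (emb-coords T x q))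
  (lincomb-mem K (coords T x) (basis T) (trans (sym (le-allIn T K)) p))

allIn-basis : ∀ {v t} (T : Gr v t) → allIn (basis T) T ≡ true
allIn-basis nil      = refl
allIn-basis (ov T)   = ∧-true (mem-0 T) (trans (allIn-false (basis T) T) (allIn-basis T))
allIn-basis (up T g) = trans (allIn-zip-up g (basis T) T g) (∧-true (allIn-basis T) (trans (cong (_==ᵛ g) (dots-basis T g)) (==ᵛ-refl g)))
  where
  dots-basis : ∀ {v k} (K : Gr v k) f → dots K f (basis K) ≡ f
  dots-basis nil      []      = refl
  dots-basis (ov K)   (a ∷ f) = cong₂ _∷_ (trans (cong₂ _xor_ (∧-identityʳ a) (dot-coords-0 K f)) (xor-identityʳ a))
    (trans (dots-ov-false K a f (basis K)) (dots-basis K f))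
  dots-basis (up K g) f       = trans (go g (basis K)) (dots-basis K f)
    where
    go : ∀ {n} (h : Vec Bool n) (bs : Vec (Pt _) n) → dots (up K g) f (zipWith _∷_ h bs) ≡ dots K f bs
    go []      []       = refl
    go (_ ∷ h) (b ∷ bs) = cong (_ ∷_) (go h bs)

allIn-⊆ : ∀ {v n t k} (bs : Vec (Pt v) n) (T : Gr v t) (K : Gr v k) → mem T ⊆S mem K → allIn bs T ≡ true → allIn bs K ≡ true
allIn-⊆ []       T K s p = refl
allIn-⊆ (b ∷ bs) T K s p = ∧-true (s b (∧-trueˡ p)) (allIn-⊆ bs T K s (∧-trueʳ {mem T b} p))

⊆⇒le : ∀ {v t k} (T : Gr v t) (K : Gr v k) → mem T ⊆S mem K → le T K ≡ true
⊆⇒le T K s = trans (le-allIn T K) (allIn-⊆ (basis T) T K s (allIn-basis T))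

-- The canonical form of a subset.

fullSpace : ∀ {v} → ∃ (Gr v) → ∃ (Gr (suc v))
fullSpace (k , K) = suc k , ov K

graphSpace : ∀ {v} → (Pt v → Bool) → ∃ (Gr v) → ∃ (Gr (suc v))
graphSpace h (k , K) = k , up K (map h (basis K))

-- Total on all subsets, because a colouring must be a function on `SubsetV`; the result is
-- meaningful when W is closed under addition and contains 0. If the first unit vector is missing, W
-- is a graph over its projection, and the functional at x is the truth value of (1 , x) ∈ W.
canon : ∀ {v} → SubsetV v → ∃ (Gr v)
canon {zero}  W = 0 , nil
canon {suc v} W = if W (true ∷ 0V) then fullSpace (canon (W ∘ (false ∷_)))
  else graphSpace (W ∘ (true ∷_)) (canon (λ x → W (false ∷ x) ∨ W (true ∷ x)))

-- Makes every colouring of canonical forms well defined on subsets up to `≐`; pointwise equality is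
-- carried through the recursion, so no function extensionality is involved.
canon-cong : ∀ {v} {W W′ : SubsetV v} → W ≐ W′ → canon W ≡ canon W′
canon-cong {zero}  p = refl
canon-cong {suc v} {W} {W′} p
  rewrite p (true ∷ 0V)
        | canon-cong {v} {W ∘ (false ∷_)} {W′ ∘ (false ∷_)} (p ∘ (false ∷_))
        | canon-cong {v} {λ x → W (false ∷ x) ∨ W (true ∷ x)} {λ x → W′ (false ∷ x) ∨ W′ (true ∷ x)} (λ x → cong₂ _∨_ (p (false ∷ x)) (p (true ∷ x)))
  = cong (if W′ (true ∷ 0V) then fullSpace (canon (W′ ∘ (false ∷_))) else_)
      (cong (λ z → _ , up _ z) (map-cong (p ∘ (true ∷_)) (basis (proj₂ (canon (λ x → W′ (false ∷ x) ∨ W′ (true ∷ x)))))))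

dots-basis : ∀ {v k} (K : Gr v k) f → dots K f (basis K) ≡ f
dots-basis K f = ==ᵛ⇒≡ _ f (∧-trueʳ {allIn (basis K) K} (trans (sym (allIn-zip-up f (basis K) K f)) (allIn-basis (up K f))))

private
  graph-total : ∀ m d → (m ∧ (false == d)) ∨ (m ∧ (true == d)) ≡ m
  graph-total false d     = refl
  graph-total true  true  = refl
  graph-total true  false = refl

canon-mem : ∀ {v k} (K : Gr v k) → canon (mem K) ≡ (k , K)
canon-mem nil      = refl
canon-mem (ov K)   rewrite mem-0 K | canon-mem K = refl
canon-mem (up K f)
  rewrite mem-0 K | dot-coords-0 K f
        | canon-cong {W = λ x → (mem K x ∧ (false == dot f (coords K x))) ∨ (mem K x ∧ (true == dot f (coords K x)))} {mem K}
            (λ x → graph-total (mem K x) (dot f (coords K x)))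
        | canon-mem K
  = cong (λ z → _ , up K z) (trans (cut (basis K) (allIn-basis K)) (dots-basis K f))
  where
  cut : ∀ {n} (bs : Vec (Pt _) n) → allIn bs K ≡ true → map (λ b → mem K b ∧ (true == dot f (coords K b))) bs ≡ dots K f bs
  cut []       p = refl
  cut (b ∷ bs) p = cong₂ _∷_ (cong (_∧ dot f (coords K b)) (∧-trueˡ p)) (cut bs (∧-trueʳ {mem K b} p))

mem-injective : ∀ {v k} (K K′ : Gr v k) → mem K ≐ mem K′ → K ≡ K′
mem-injective K K′ p = same (trans (sym (canon-mem K)) (trans (canon-cong p) (canon-mem K′)))
  where
  same : ∀ {v k} {K K′ : Gr v k} → _≡_ {A = ∃ (Gr v)} (k , K) (k , K′) → K ≡ K′
  same refl = refl

record Closed {v} (W : SubsetV v) : Set where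
  field
    has-0 : W 0V ≡ true
    has-⊕ : ∀ x y → W x ≡ true → W y ≡ true → W (x ⊕ y) ≡ true
open Closed

private
  bool-ext : ∀ {a b} → (a ≡ true → b ≡ true) → (b ≡ true → a ≡ true) → a ≡ b
  bool-ext {true}  {true}  p q = refl
  bool-ext {true}  {false} p q = sym (p refl)
  bool-ext {false} {true}  p q = q refl
  bool-ext {false} {false} p q = refl

mem-canon : ∀ {v} (W : SubsetV v) → Closed W → mem (proj₂ (canon W)) ≐ W
mem-canon {zero}  W cl [] = sym (has-0 cl)
mem-canon {suc v} W cl x with W (true ∷ 0V) in e
mem-canon {suc v} W cl (b ∷ x) | true = trans (mem-canon (W ∘ (false ∷_)) cl₀ x) (shift b)
  where
  cl₀ : Closed (W ∘ (false ∷_))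
  cl₀ = record { has-0 = has-0 cl ; has-⊕ = λ x y → has-⊕ cl (false ∷ x) (false ∷ y) }
  shift : ∀ b → W (false ∷ x) ≡ W (b ∷ x)
  shift false = refl
  shift true  = bool-ext
    (λ p → subst (λ z → W (true ∷ z) ≡ true) (⊕-identityˡ x) (has-⊕ cl _ _ e p))
    (λ p → subst (λ z → W (false ∷ z) ≡ true) (⊕-identityˡ x) (has-⊕ cl _ _ e p))
mem-canon {suc v} W cl (b ∷ x) | false = trans (cong (_∧ (b == dot (map h (basis K)) (coords K x))) (mem-canon W′ cl′ x)) (final b)
  where
  W′ : SubsetV v
  W′ x = W (false ∷ x) ∨ W (true ∷ x)
  h : Pt v → Bool
  h = W ∘ (true ∷_)
  pick : ∀ x → W′ x ≡ true → W (h x ∷ x) ≡ true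
  pick x p with W (true ∷ x) in q
  ... | true  = q
  ... | false = trans (sym (∨-identityʳ _)) p
  from : ∀ b x → W (b ∷ x) ≡ true → W′ x ≡ true
  from false x p = cong (_∨ W (true ∷ x)) p
  from true  x p = trans (cong (W (false ∷ x) ∨_) p) (∨-zeroʳ _)
  -- If (0 , x) and (1 , x) were both in W, their sum, the first unit vector, would be too, against
  -- `e`.
  unique : ∀ b x → W (b ∷ x) ≡ true → h x ≡ b
  unique true  x p = p
  unique false x p with W (true ∷ x) in q
  ... | false = refl
  ... | true  = trans (sym (subst (λ z → W (true ∷ z) ≡ true) (⊕-self x) (has-⊕ cl _ _ q p))) e
  sum : ∀ x y → W′ x ≡ true → W′ y ≡ true → W ((h x xor h y) ∷ (x ⊕ y)) ≡ true
  sum x y p q = has-⊕ cl _ _ (pick x p) (pick y q)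
  cl′ : Closed W′
  cl′ = record { has-0 = from false _ (has-0 cl) ; has-⊕ = λ x y p q → from _ _ (sum x y p q) }
  K : Gr v (proj₁ (canon W′))
  K = proj₂ (canon W′)
  mem⇒W′ : ∀ x → mem K x ≡ true → W′ x ≡ true
  mem⇒W′ x p = trans (sym (mem-canon W′ cl′ x)) p
  -- By uniqueness the sum of (h x , x) and (h y , y) is the point over x + y, so `h` is additive on
  -- the projection and determined by its values on the basis of `K`.
  h-lincomb : ∀ {n} (c : Vec Bool n) (bs : Vec (Pt v) n) → allIn bs K ≡ true → h (lincomb c bs) ≡ dot (map h bs) c
  h-lincomb []          []       p = e
  h-lincomb (true ∷ c)  (b ∷ bs) p = trans
    (unique _ _ (sum b (lincomb c bs) (mem⇒W′ b (∧-trueˡ p)) (mem⇒W′ _ (lincomb-mem K c bs (∧-trueʳ {mem K b} p)))))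
    (cong₂ _xor_ (sym (∧-identityʳ (h b))) (h-lincomb c bs (∧-trueʳ {mem K b} p)))
  h-lincomb (false ∷ c) (b ∷ bs) p = trans (h-lincomb c bs (∧-trueʳ {mem K b} p)) (cong (_xor dot (map h bs) c) (sym (∧-zeroʳ (h b))))
  functional : W′ x ≡ true → dot (map h (basis K)) (coords K x) ≡ h x
  functional p = trans (sym (h-lincomb (coords K x) (basis K) (allIn-basis K)))
    (cong h (trans (lincomb-basis K _) (emb-coords K x (trans (mem-canon W′ cl′ x) p))))
  final : ∀ b → W′ x ∧ (b == dot (map h (basis K)) (coords K x)) ≡ W (b ∷ x)
  final b = bool-ext
    (λ p → trans (cong (λ z → W (z ∷ x)) (trans (==⇒≡ b _ (∧-trueʳ {W′ x} p)) (functional (∧-trueˡ p)))) (pick x (∧-trueˡ p)))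
    (λ p → ∧-true (from b x p) (trans (cong (b ==_) (trans (functional (from b x p)) (unique b x p))) (==-refl b)))

-- Dimension by counting.

toFin : ∀ {n} → Vec Bool n → Fin (2 ^ n)
toFin []          = zero
toFin (false ∷ c) = combine {2} zero (toFin c)
toFin (true  ∷ c) = combine {2} (suc zero) (toFin c)

toFin-injective : ∀ {n} (c d : Vec Bool n) → toFin c ≡ toFin d → c ≡ d
toFin-injective []          []          p = refl
toFin-injective (false ∷ c) (false ∷ d) p = cong (false ∷_) (toFin-injective c d (proj₂ (combine-injective {2} zero (toFin c) zero (toFin d) p)))
toFin-injective (true ∷ c)  (true ∷ d)  p = cong (true ∷_) (toFin-injective c d (proj₂ (combine-injective {2} (suc zero) (toFin c) (suc zero) (toFin d) p)))
toFin-injective (false ∷ c) (true ∷ d)  p with () ← proj₁ (combine-injective {2} zero (toFin c) (suc zero) (toFin d) p)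
toFin-injective (true ∷ c)  (false ∷ d) p with () ← proj₁ (combine-injective {2} (suc zero) (toFin c) zero (toFin d) p)

fromFin : ∀ {n} (i : Fin (2 ^ n)) → ∃ λ c → toFin {n} c ≡ i
fromFin {zero}  zero = [] , refl
fromFin {suc n} i = go (proj₁ (remQuot {2} (2 ^ n) i)) (fromFin {n} (proj₂ (remQuot {2} (2 ^ n) i))) (combine-remQuot {2} (2 ^ n) i)
  where
  go : ∀ (b : Fin 2) {j : Fin (2 ^ n)} → (∃ λ c → toFin {n} c ≡ j) → combine b j ≡ i → ∃ λ c → toFin {suc n} c ≡ i
  go zero       (c , refl) e = false ∷ c , e
  go (suc zero) (c , refl) e = true ∷ c , e

-- Comparing the cardinalities 2^m and 2^n takes the place of an exchange argument for bases.
injection⇒≤ : ∀ {m n} (f : Vec Bool m → Vec Bool n) → (∀ c d → f c ≡ f d → c ≡ d) → m ≤ n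
injection⇒≤ {m} {n} f inj with m ≤? n
... | yes p = p
... | no  p = contradiction (injective⇒≤ {f = g} (λ {i} {j} → g-injective i j)) (<⇒≱ (^-monoʳ-< 2 (s≤s (s≤s z≤n)) (≰⇒> p)))
  where
  g : Fin (2 ^ m) → Fin (2 ^ n)
  g i = toFin (f (proj₁ (fromFin {m} i)))
  g-injective : ∀ i j → g i ≡ g j → i ≡ j
  g-injective i j e = trans (sym (proj₂ (fromFin {m} i)))
    (trans (cong toFin (inj _ _ (toFin-injective _ _ e))) (proj₂ (fromFin {m} j)))

lincomb-⊕ : ∀ {v n} (c d : Vec Bool n) (bs : Vec (Pt v) n) → lincomb (c ⊕ d) bs ≡ lincomb c bs ⊕ lincomb d bs
lincomb-⊕ []          []          []       = sym (⊕-identityˡ 0V)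
lincomb-⊕ (false ∷ c) (false ∷ d) (b ∷ bs) = lincomb-⊕ c d bs
lincomb-⊕ (true ∷ c)  (false ∷ d) (b ∷ bs) = trans (cong (b ⊕_) (lincomb-⊕ c d bs)) (sym (⊕-assoc b _ _))
lincomb-⊕ (false ∷ c) (true ∷ d)  (b ∷ bs) = begin
  b ⊕ lincomb (c ⊕ d) bs              ≡⟨ cong (b ⊕_) (lincomb-⊕ c d bs) ⟩
  b ⊕ (lincomb c bs ⊕ lincomb d bs)   ≡⟨ sym (⊕-assoc b _ _) ⟩
  (b ⊕ lincomb c bs) ⊕ lincomb d bs   ≡⟨ cong (_⊕ lincomb d bs) (⊕-comm b _) ⟩
  (lincomb c bs ⊕ b) ⊕ lincomb d bs   ≡⟨ ⊕-assoc _ b _ ⟩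
  lincomb c bs ⊕ (b ⊕ lincomb d bs)   ∎
  where open ≡-Reasoning
lincomb-⊕ (true ∷ c)  (true ∷ d)  (b ∷ bs) = begin
  lincomb (c ⊕ d) bs                          ≡⟨ lincomb-⊕ c d bs ⟩
  lincomb c bs ⊕ lincomb d bs                 ≡⟨ sym (⊕-identityˡ _) ⟩
  0V ⊕ (lincomb c bs ⊕ lincomb d bs)          ≡⟨ cong (_⊕ (lincomb c bs ⊕ lincomb d bs)) (sym (⊕-self b)) ⟩
  (b ⊕ b) ⊕ (lincomb c bs ⊕ lincomb d bs)     ≡⟨ ⊕-assoc b b _ ⟩
  b ⊕ (b ⊕ (lincomb c bs ⊕ lincomb d bs))     ≡⟨ cong (b ⊕_) (sym (⊕-assoc b _ _)) ⟩
  b ⊕ ((b ⊕ lincomb c bs) ⊕ lincomb d bs)     ≡⟨ cong (λ z → b ⊕ (z ⊕ lincomb d bs)) (⊕-comm b _) ⟩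
  b ⊕ ((lincomb c bs ⊕ b) ⊕ lincomb d bs)     ≡⟨ cong (b ⊕_) (⊕-assoc _ b _) ⟩
  b ⊕ (lincomb c bs ⊕ (b ⊕ lincomb d bs))     ≡⟨ sym (⊕-assoc b _ _) ⟩
  (b ⊕ lincomb c bs) ⊕ (b ⊕ lincomb d bs)     ∎
  where open ≡-Reasoning

lincomb-0 : ∀ {v n} (bs : Vec (Pt v) n) → lincomb 0V bs ≡ 0V
lincomb-0 []       = refl
lincomb-0 (b ∷ bs) = lincomb-0 bs

lincomb-injective : ∀ {v k} (bs : Vec (Pt v) k) → LinIndep bs → ∀ c d → lincomb c bs ≡ lincomb d bs → c ≡ d
lincomb-injective bs li c d e = ⊕-cancel c d (li (c ⊕ d)
  (trans (lincomb-⊕ c d bs) (trans (cong (_⊕ lincomb d bs) e) (⊕-self _))))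

-- The canonical form comes with some dimension k′. Coordinates with respect to the given basis and
-- to the canonical one inject each coordinate space into the other, which forces k′ = k.
subspace⇒Gr : ∀ {v k} {W : SubsetV v} → IsSubspace v k W → Σ (Gr v k) λ K → mem K ≐ W
subspace⇒Gr {v} {k} {W} (bs , li , iff) = subst (λ j → Σ (Gr v j) λ K → mem K ≐ W) (≤-antisym k′≤k k≤k′) (K , K≐W)
  where
  to : ∀ x → W x ≡ true → ∃ λ c → lincomb c bs ≡ x
  to x = Equivalence.to (iff x)
  from : ∀ c → W (lincomb c bs) ≡ true
  from c = Equivalence.from (iff _) (c , refl)
  closed : Closed W
  closed = record
    { has-0 = subst (λ z → W z ≡ true) (lincomb-0 bs) (from 0V)
    ; has-⊕ = λ x y p q → let c , e = to x p ; d , e′ = to y q in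
        subst (λ z → W z ≡ true) (trans (lincomb-⊕ c d bs) (cong₂ _⊕_ e e′)) (from (c ⊕ d)) }
  k′ = proj₁ (canon W)
  K : Gr v k′
  K = proj₂ (canon W)
  K≐W : mem K ≐ W
  K≐W = mem-canon W closed
  k≤k′ : k ≤ k′
  k≤k′ = injection⇒≤ (λ c → coords K (lincomb c bs)) λ c d e → lincomb-injective bs li c d
    (trans (sym (emb-coords K _ (trans (K≐W _) (from c)))) (trans (cong (emb K) e) (emb-coords K _ (trans (K≐W _) (from d)))))
  inW : ∀ c → W (emb K c) ≡ true
  inW c = trans (sym (K≐W _)) (mem-emb K c)
  k′≤k : k′ ≤ k
  k′≤k = injection⇒≤ (λ c → proj₁ (to _ (inW c))) λ c d e → trans (sym (coords-emb K c)) (trans (cong (coords K)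
    (trans (sym (proj₂ (to _ (inW c)))) (trans (cong (λ z → lincomb z bs) e) (proj₂ (to _ (inW d)))))) (coords-emb K d))

-- The enumerations are complete and free of repetitions.

∈-allVec : ∀ {n} (c : Vec Bool n) → c ∈ allVec n
∈-allVec []          = here refl
∈-allVec (false ∷ c) = ∈-++⁺ˡ (∈-map⁺ (false ∷_) (∈-allVec c))
∈-allVec (true ∷ c)  = ∈-++⁺ʳ _ (∈-map⁺ (true ∷_) (∈-allVec c))

∈-allGr : ∀ {v k} (K : Gr v k) → K ∈ allGr v k
∈-allGr nil              = here refl
∈-allGr (ov K)           = ∈-++⁺ˡ (∈-map⁺ ov (∈-allGr K))
∈-allGr (up {v} {k} K f) = ∈-++⁺ʳ (ovs v k) (∈-cartesianProductWith⁺ up (∈-allGr K) (∈-allVec f))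

allVec-unique : ∀ n → Unique (allVec n)
allVec-unique zero    = [] ∷ []
allVec-unique (suc n) = Unique.++⁺ (Unique.map⁺ (λ { refl → refl }) (allVec-unique n)) (Unique.map⁺ (λ { refl → refl }) (allVec-unique n)) disjoint
  where
  disjoint : ∀ {c} → ¬ (c ∈ List.map (false ∷_) (allVec n) × c ∈ List.map (true ∷_) (allVec n))
  disjoint (p , q) with ∈-map⁻ (false ∷_) p | ∈-map⁻ (true ∷_) q
  ... | _ , _ , refl | _ , _ , ()

allGr-unique : ∀ v k → Unique (allGr v k)
allGr-unique zero    zero    = [] ∷ []
allGr-unique zero    (suc k) = []
allGr-unique (suc v) k       = Unique.++⁺ (ovs-unique k) (Unique.cartesianProductWith⁺ up (λ { refl → refl , refl }) (allGr-unique v k) (allVec-unique k)) (disjoint k)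
  where
  ovs-unique : ∀ k → Unique (ovs v k)
  ovs-unique zero    = []
  ovs-unique (suc k) = Unique.map⁺ (λ { refl → refl }) (allGr-unique v k)
  disjoint : ∀ k {K} → ¬ (K ∈ ovs v k × K ∈ cartesianProductWith up (allGr v k) (allVec k))
  disjoint (suc k) (p , q) with ∈-map⁻ ov p | ∈-cartesianProductWith⁻ up (allGr v (suc k)) (allVec (suc k)) q
  ... | _ , _ , refl | _ , _ , _ , _ , ()

-- Colours modulo 3 and balanced triples.

_⊞_ : Fin 3 → Fin 3 → Fin 3
0F ⊞ j  = j
1F ⊞ 0F = 1F
1F ⊞ 1F = 2F
1F ⊞ 2F = 0F
2F ⊞ 0F = 2F
2F ⊞ 1F = 0F
2F ⊞ 2F = 1F

neg : Fin 3 → Fin 3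
neg 0F = 0F
neg 1F = 2F
neg 2F = 1F

_⊟_ : Fin 3 → Fin 3 → Fin 3
i ⊟ j = i ⊞ neg j

_==ᶠ_ : Fin 3 → Fin 3 → Bool
0F ==ᶠ 0F = true
1F ==ᶠ 1F = true
2F ==ᶠ 2F = true
_  ==ᶠ _  = false

F3 : List (Fin 3)
F3 = 0F ∷ 1F ∷ 2F ∷ []

convolution : ∀ a b i → 𝟙 ((a ⊞ b) ==ᶠ i) ≡ ∑ F3 (λ j → 𝟙 (a ==ᶠ j) * 𝟙 (b ==ᶠ (i ⊟ j)))
convolution 0F 0F 0F = refl
convolution 0F 0F 1F = refl
convolution 0F 0F 2F = refl
convolution 0F 1F 0F = refl
convolution 0F 1F 1F = refl
convolution 0F 1F 2F = refl
convolution 0F 2F 0F = refl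
convolution 0F 2F 1F = refl
convolution 0F 2F 2F = refl
convolution 1F 0F 0F = refl
convolution 1F 0F 1F = refl
convolution 1F 0F 2F = refl
convolution 1F 1F 0F = refl
convolution 1F 1F 1F = refl
convolution 1F 1F 2F = refl
convolution 1F 2F 0F = refl
convolution 1F 2F 1F = refl
convolution 1F 2F 2F = refl
convolution 2F 0F 0F = refl
convolution 2F 0F 1F = refl
convolution 2F 0F 2F = refl
convolution 2F 1F 0F = refl
convolution 2F 1F 1F = refl
convolution 2F 1F 2F = refl
convolution 2F 2F 0F = refl
convolution 2F 2F 1F = refl
convolution 2F 2F 2F = refl

Bal : (Fin 3 → ℕ) → Set
Bal f = ∀ i j → f i ≡ f j

Bal-cong : {f g : Fin 3 → ℕ} → (∀ i → f i ≡ g i) → Bal g → Bal f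
Bal-cong p b i j = trans (p i) (trans (b i j) (sym (p j)))

Bal-∑ : {A : Set} (xs : List A) (f : A → Fin 3 → ℕ) → (∀ x → Bal (f x)) → Bal (λ i → ∑ xs (λ x → f x i))
Bal-∑ xs f b i j = ∑-cong xs (λ x → b x i j)

Bal-+ : {f g : Fin 3 → ℕ} → Bal f → Bal g → Bal (λ i → f i + g i)
Bal-+ b c i j = cong₂ _+_ (b i j) (c i j)

Bal-* : {f : Fin 3 → ℕ} (m : ℕ) → Bal f → Bal (λ i → m * f i)
Bal-* m b i j = cong (m *_) (b i j)

-- One constant factor suffices. If Q is constant, no term depends on i; if P is constant, i only
-- permutes the values of Q that are summed. The factor `m` is the number of gluings of the two
-- pieces.
Bal-convolution : (P Q : Fin 3 → ℕ) (m : ℕ) → Bal P ⊎ Bal Q → Bal (λ i → ∑ F3 (λ j → m * (P j * Q (i ⊟ j))))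
Bal-convolution P Q m (inj₂ b) i i′ = ∑-cong F3 (λ j → cong (λ z → m * (P j * z)) (b (i ⊟ j) (i′ ⊟ j)))
Bal-convolution P Q m (inj₁ b) i i′ = trans (to i) (sym (to i′))
  where
  to : ∀ i → ∑ F3 (λ j → m * (P j * Q (i ⊟ j))) ≡ m * P 0F * (Q 0F + Q 1F + Q 2F)
  to i rewrite b 1F 0F | b 2F 0F = cases i
    where
    perm : ∀ m p a b c → m * (p * a) + (m * (p * b) + (m * (p * c) + 0)) ≡ m * p * (a + b + c)
    perm = solve-∀
    cases : ∀ i → ∑ F3 (λ j → m * (P 0F * Q (i ⊟ j))) ≡ m * P 0F * (Q 0F + Q 1F + Q 2F)
    cases 0F = trans (perm m (P 0F) (Q 0F) (Q 2F) (Q 1F)) (cong (m * P 0F *_) (acb (Q 0F) (Q 2F) (Q 1F)))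
      where
      acb : ∀ a c b → a + c + b ≡ a + b + c
      acb = solve-∀
    cases 1F = trans (perm m (P 0F) (Q 1F) (Q 0F) (Q 2F)) (cong (m * P 0F *_) (cong (_+ Q 2F) (+-comm (Q 1F) (Q 0F))))
    cases 2F = trans (perm m (P 0F) (Q 2F) (Q 1F) (Q 0F)) (cong (m * P 0F *_) (cba (Q 2F) (Q 1F) (Q 0F)))
      where
      cba : ∀ c b a → c + b + a ≡ a + b + c
      cba = solve-∀

-- Colourings by first passage.

-- One colouring for all dimensions at once: where a space is cut depends on the space, so the
-- dimensions of its pieces are not known in advance.
Col : Set
Col = ∀ {v k} → Gr v k → Fin 3

N : ∀ {v k t} → (Gr v k → Fin 3) → Gr v t → Fin 3 → ℕ
N {k = k} c T i = S T k (λ K → 𝟙 (c K ==ᶠ i))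

-- `n` is one more than the strength, so n = 0 demands nothing. The cap at 2 is there because the
-- base colourings are only known to have strength 2.
Good : ∀ v k → ℕ → (Gr v k → Fin 3) → Set
Good v k n c = ∀ {t} (T : Gr v t) → t < n → t ≤ 2 → Bal (N c T)

-- A record, so that conversion never unfolds sums over concrete Grassmannians.
record IsGood (v k n : ℕ) (c : Gr v k → Fin 3) : Set where
  constructor isGood
  field good : Good v k n c

Cuts : ℕ → Set
Cuts v = ∃ λ x → ∃ λ w → Cut x w v

deeper : ∀ {v} → Cuts v → Cuts (suc v)
deeper (x , w , c) = suc x , w , there c

cuts : ∀ v → List (Cuts v)
cuts zero    = (0 , 0 , here) ∷ []
cuts (suc v) = (0 , suc v , here) ∷ List.map deeper (cuts v)

cut-sum : ∀ {x w v} → Cut x w v → x + w ≡ v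
cut-sum here      = refl
cut-sum (there c) = cong suc (cut-sum c)

J-large : ∀ {x w v k} (c : Cut x w v) a (α : Gr x a → ℕ) (β : ∀ {r} → Gr w r → ℕ) (K : Gr v k) → x < a → J c a α β K ≡ 0
J-large here      (suc a) α β K        p       = refl
J-large (there c) (suc a) α β (ov K)   (s≤s p) = J-large c a _ β K p
J-large (there c) (suc a) α β (up K f) p       = J-large c (suc a) _ β K (<-trans (n<1+n _) p)

-- First passage: the path of K is cut at its step ov number s + 1 (fpO) or up number s + 1 (fpU);
-- the pieces before and after that step are coloured independently.
fpO : ℕ → Col → Col → Col
-- Default for paths with too few steps of the wanted kind.
fpO s       cA cB nil      = 0F
fpO zero    cA cB (ov K)   = cA nil ⊞ cB K
fpO (suc s) cA cB (ov K)   = fpO s (cA ∘ ov) cB K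
fpO s       cA cB (up K f) = fpO s (λ {_} {a} A → cA (up A (takeP a f))) cB K

fpU : ℕ → Col → Col → Col
fpU s       cA cB nil      = 0F
fpU s       cA cB (ov K)   = fpU s (cA ∘ ov) cB K
fpU zero    cA cB (up K f) = cA nil ⊞ cB K
fpU (suc s) cA cB (up K f) = fpU s (λ {_} {a} A → cA (up A (takeP a f))) cB K

-- Counts the remainder only if it begins with an `ov` step. Together with a first piece of
-- dimension s this fixes the cut just before step s + 1, and that step itself is dropped.
tailO : Col → Fin 3 → ∀ {w r} → Gr w r → ℕ
tailO cB j nil      = 0
tailO cB j (ov B)   = 𝟙 (cB B ==ᶠ j)
tailO cB j (up B f) = 0

tailU : Col → Fin 3 → ∀ {w r} → Gr w r → ℕ
tailU cB j nil      = 0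
tailU cB j (ov B)   = 0
tailU cB j (up B f) = 𝟙 (cB B ==ᶠ j)

private
  ∑∑0 : {A B : Set} (xs : List A) (ys : List B) → ∑ xs (λ _ → ∑ ys (λ _ → 0)) ≡ 0
  ∑∑0 xs ys = trans (∑-cong xs (λ _ → ∑-0 ys)) (∑-0 xs)

  nothing : (p : Fin 3 → ℕ) → ∑ F3 (λ j → p j * 0) ≡ 0
  nothing p = trans (∑-cong F3 (λ j → *-zeroʳ (p j))) (∑-0 F3)

termO : ℕ → Col → Col → Fin 3 → ∀ {v k} → Gr v k → Cuts v → ℕ
termO s cA cB i K (x , w , c) = ∑ F3 (λ j → J c s (λ A → 𝟙 (cA A ==ᶠ j)) (tailO cB (i ⊟ j)) K)

-- Exactly one cut contributes, the one at step `ov` number s + 1, which exists because s < k; at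
-- this cut `convolution` splits the sum of the two colours.
fpO-sum : ∀ s (cA cB : Col) i {v k} (K : Gr v k) → s < k → 𝟙 (fpO s cA cB K ==ᶠ i) ≡ ∑ (cuts v) (termO s cA cB i K)
fpO-sum zero cA cB i (ov {v} K) p = trans (convolution (cA nil) (cB K) i) (trans (sym (+-identityʳ _))
  (cong (∑ F3 (λ j → 𝟙 (cA nil ==ᶠ j) * 𝟙 (cB K ==ᶠ (i ⊟ j))) +_)
    (sym (trans (∑-map deeper (cuts v) _) (∑∑0 (cuts v) F3)))))
fpO-sum (suc s) cA cB i (ov {v} K) (s≤s p) = trans (fpO-sum s (cA ∘ ov) cB i K p) (sym (∑-map deeper (cuts v) _))
fpO-sum zero cA cB i (up {v} K f) p = trans (fpO-sum zero _ cB i K p)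
  (sym (cong₂ _+_ (nothing (λ j → 𝟙 (cA nil ==ᶠ j))) (∑-map deeper (cuts v) _)))
fpO-sum (suc s) cA cB i (up {v} K f) p = trans (fpO-sum (suc s) _ cB i K p) (sym (∑-map deeper (cuts v) _))

-- A first piece with s `up` steps inside V_x has dimension x - s. The guard excludes x < s, where
-- truncated subtraction would let in pieces of dimension 0 with fewer than s `up` steps.
termU : ℕ → Col → Col → Fin 3 → ∀ {v k} → Gr v k → Cuts v → ℕ
termU s cA cB i K (x , w , c) with s ≤? x
... | yes _ = ∑ F3 (λ j → J c (x ∸ s) (λ A → 𝟙 (cA A ==ᶠ j)) (tailU cB (i ⊟ j)) K)
... | no  _ = 0

private
  termU-yes : ∀ s (cA cB : Col) i {v k} (K : Gr v k) (x w : ℕ) (c : Cut x w v) → s ≤ x →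
    termU s cA cB i K (x , w , c) ≡ ∑ F3 (λ j → J c (x ∸ s) (λ A → 𝟙 (cA A ==ᶠ j)) (tailU cB (i ⊟ j)) K)
  termU-yes s cA cB i K x w c p with s ≤? x
  ... | yes _ = refl
  ... | no  q = contradiction p q

  termU-no : ∀ s (cA cB : Col) i {v k} (K : Gr v k) (x w : ℕ) (c : Cut x w v) → ¬ s ≤ x → termU s cA cB i K (x , w , c) ≡ 0
  termU-no s cA cB i K x w c p with s ≤? x
  ... | yes q = contradiction q p
  ... | no  _ = refl

  termU-ov : ∀ s (cA cB : Col) i {v k} (K : Gr v k) (q : Cuts v) → termU s cA cB i (ov K) (deeper q) ≡ termU s (cA ∘ ov) cB i K q
  termU-ov s cA cB i K (x , w , c) with s ≤? x
  ... | yes p = trans (termU-yes s cA cB i (ov K) (suc x) w (there c) (m≤n⇒m≤1+n p))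
                  (∑-cong F3 (λ j → cong (λ a → J (there c) a (λ A → 𝟙 (cA A ==ᶠ j)) (tailU cB (i ⊟ j)) (ov K)) (+-∸-assoc 1 p)))
  ... | no  p with s ≤? suc x
  ...   | no  _ = refl
  ...   | yes q rewrite m≤n⇒m∸n≡0 (≰⇒> p) = refl

  termU-up : ∀ s (cA cB : Col) i {v k} (K : Gr v k) f (q : Cuts v) →
    termU (suc s) cA cB i (up K f) (deeper q) ≡ termU s (λ {_} {a} A → cA (up A (takeP a f))) cB i K q
  termU-up s cA cB i K f (x , w , c) with s ≤? x
  ... | yes p = termU-yes (suc s) cA cB i (up K f) (suc x) w (there c) (s≤s p)
  ... | no  p = termU-no (suc s) cA cB i (up K f) (suc x) w (there c) (p ∘ ≤-pred)

  termU-none : ∀ (cA cB : Col) i {v k} (K : Gr v k) f (q : Cuts v) → termU 0 cA cB i (up K f) (deeper q) ≡ 0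
  termU-none cA cB i K f (x , w , c) = trans (∑-cong F3 (λ j → J-large c (suc x) (λ A → 𝟙 (cA (up A (takeP (suc x) f)) ==ᶠ j)) (tailU cB (i ⊟ j)) K (n<1+n x))) (∑-0 F3)

fpU-sum : ∀ s (cA cB : Col) i {v k} (K : Gr v k) → s + k < v → 𝟙 (fpU s cA cB K ==ᶠ i) ≡ ∑ (cuts v) (termU s cA cB i K)
fpU-sum zero cA cB i (ov {v} K) (s≤s p) = trans (fpU-sum zero (cA ∘ ov) cB i K p) (sym (cong₂ _+_ (nothing (λ j → 𝟙 (cA nil ==ᶠ j)))
  (trans (∑-map deeper (cuts v) _) (∑-cong (cuts v) (termU-ov 0 cA cB i K)))))
fpU-sum (suc s) cA cB i (ov {v} {k} K) p = trans (fpU-sum (suc s) (cA ∘ ov) cB i K (≤-pred (subst (_< suc v) (+-suc (suc s) k) p)))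
  (sym (trans (∑-map deeper (cuts v) _) (∑-cong (cuts v) (termU-ov (suc s) cA cB i K))))
fpU-sum zero cA cB i (up {v} K f) p = trans (convolution (cA nil) (cB K) i) (trans (sym (+-identityʳ _))
  (cong (∑ F3 (λ j → 𝟙 (cA nil ==ᶠ j) * 𝟙 (cB K ==ᶠ (i ⊟ j))) +_)
    (sym (trans (∑-map deeper (cuts v) _) (trans (∑-cong (cuts v) (termU-none cA cB i K f)) (∑-0 (cuts v)))))))
fpU-sum (suc s) cA cB i (up {v} K f) p = trans (fpU-sum s _ cB i K (≤-pred p))
  (sym (trans (∑-map deeper (cuts v) _) (∑-cong (cuts v) (termU-up s cA cB i K f))))

-- Dropping the `ov` step replaces `ov T′` by T′, one dimension less, and `up T′ g` by T′ with the
-- same dimension; hence t′ ≤ t.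
tailO-Bal : ∀ (cB : Col) {w t} (T : Gr w t) r →
  (∀ {w′ r′ t′} (T′ : Gr w′ t′) → w ≡ suc w′ → r ≡ suc r′ → t′ ≤ t → Bal (N {k = r′} cB T′)) → Bal (λ j → S T r (tailO cB j))
tailO-Bal cB nil r h = Bal-cong (λ j → trans (S-cong nil r {tailO cB j} {λ _ → 0} (λ { nil _ → refl })) (S-0 nil r)) (λ _ _ → refl)
tailO-Bal cB (ov T) zero    h = Bal-cong (λ j → S-ov-zero T _) (λ _ _ → refl)
tailO-Bal cB (ov T) (suc r) h = Bal-cong (λ j → S-ov-suc T r _) (h T refl refl (n≤1+n _))
tailO-Bal cB (up T g) zero    h = Bal-cong (λ j → trans (S-up-zero T g _) (trans (S-cong T 0 (λ K _ → ext-0 T K g)) (S-0 T 0))) (λ _ _ → refl)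
tailO-Bal cB (up T g) (suc r) h = Bal-cong
  (λ j → trans (S-up-suc T g r _) (trans (cong (S T r (λ K → 𝟙 (cB K ==ᶠ j)) +_) (trans (S-cong T (suc r) (λ K _ → ext-0 T K g)) (S-0 T (suc r)))) (+-identityʳ _)))
  (h T refl refl ≤-refl)

-- No graph contains `ov T`, so that case counts nothing. Over `up T g` each remainder occurs once
-- for every extension of `g`, a constant number of times.
tailU-Bal : ∀ (cB : Col) {w t} (T : Gr w t) r →
  (∀ {w′ t′} (T′ : Gr w′ t′) → w ≡ suc w′ → t′ ≤ t → Bal (N {k = r} cB T′)) → Bal (λ j → S T r (tailU cB j))
tailU-Bal cB nil r h = Bal-cong (λ j → trans (S-cong nil r {tailU cB j} {λ _ → 0} (λ { nil _ → refl })) (S-0 nil r)) (λ _ _ → refl)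
tailU-Bal cB (ov T) zero    h = Bal-cong (λ j → S-ov-zero T _) (λ _ _ → refl)
tailU-Bal cB (ov T) (suc r) h = Bal-cong (λ j → trans (S-ov-suc T r _) (S-0 T r)) (λ _ _ → refl)
tailU-Bal cB (up {k = t} T g) r h = Bal-cong (free r) (Bal-* (2 ^ (r ∸ t)) (h T refl ≤-refl))
  where
  Sup-free : ∀ r j → Sup T g r (tailU cB j) ≡ 2 ^ (r ∸ t) * N {k = r} cB T j
  Sup-free r j = trans (S-cong T r (λ K p → ext-count T K g _ p)) (S-* T r (2 ^ (r ∸ t)) (λ K → 𝟙 (cB K ==ᶠ j)))
  free : ∀ r j → S (up T g) r (tailU cB j) ≡ 2 ^ (r ∸ t) * N {k = r} cB T j
  free zero    j = trans (S-up-zero T g _) (Sup-free 0 j)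
  free (suc r) j = trans (S-up-suc T g r _) (trans (cong (_+ Sup T g (suc r) (tailU cB j)) (S-0 T r)) (Sup-free (suc r) j))

private
  expand : ∀ {x w v tA tR t} {c : Cut x w v} {TA : Gr x tA} {TR : Gr w tR} {T : Gr v t} → Split c TA TR T →
    ∀ k a r → a + r ≡ k → (α : Fin 3 → Gr x a → ℕ) (β : Fin 3 → ∀ {r} → Gr w r → ℕ) → ∀ i →
    S T k (λ K → ∑ F3 (λ j → J c a (α j) (β (i ⊟ j)) K))
      ≡ ∑ F3 (λ j → 2 ^ ((x ∸ a) * (r ∸ tR)) * (S TA a (α j) * S TR r (β (i ⊟ j))))
  expand {c = c} {T = T} sp k a r e α β i = trans (S-∑ T k F3 (λ j → J c a (α j) (β (i ⊟ j))))
    (∑-cong F3 (λ j → S-J sp k a r e (α j) (β (i ⊟ j))))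

-- It is enough to treat each cut separately: there the count is a convolution of the counts of the
-- two pieces, and one balanced piece makes it balanced.
fpO-Bal : ∀ s (cA cB : Col) {v t} (T : Gr v t) r → let k = suc s + r in
  (∀ {x w tA tR} (c : Cut x w v) (TA : Gr x tA) (TR : Gr w tR) → tA + tR ≡ t →
    Bal (N {k = s} cA TA) ⊎ Bal (λ j → S TR (suc r) (tailO cB j))) →
  Bal (N {k = k} (fpO s cA cB) T)
fpO-Bal s cA cB {v} T r h = Bal-cong
  (λ i → trans (S-cong T (suc s + r) (λ K _ → fpO-sum s cA cB i K (m≤m+n (suc s) r))) (S-∑ T (suc s + r) (cuts v) (λ q K → termO s cA cB i K q)))
  (Bal-∑ (cuts v) _ each)
  where
  each : (q : Cuts v) → Bal (λ i → S T (suc s + r) (λ K → termO s cA cB i K q))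
  each (x , w , c) with split c T
  ... | _ , tR , TA , TR , e , sp = Bal-cong
    (expand sp (suc s + r) s (suc r) (+-suc s r) (λ j A → 𝟙 (cA A ==ᶠ j)) (λ j → tailO cB j))
    (Bal-convolution (N cA TA) (λ j → S TR (suc r) (tailO cB j)) (2 ^ ((x ∸ s) * (suc r ∸ tR))) (h c TA TR e))

fpU-Bal : ∀ s (cA cB : Col) {v t} (T : Gr v t) k → s + k < v →
  (∀ {w tA tR} a r (c : Cut (a + s) w v) (TA : Gr (a + s) tA) (TR : Gr w tR) → a + r ≡ k → tA + tR ≡ t →
    Bal (N {k = a} cA TA) ⊎ Bal (λ j → S TR r (tailU cB j))) →
  Bal (N {k = k} (fpU s cA cB) T)
fpU-Bal s cA cB {v} T k p h = Bal-cong
  (λ i → trans (S-cong T k (λ K _ → fpU-sum s cA cB i K p)) (S-∑ T k (cuts v) (λ q K → termU s cA cB i K q)))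
  (Bal-∑ (cuts v) _ each)
  where
  zeros : ∀ {f : Fin 3 → ℕ} → (∀ i → f i ≡ 0) → Bal f
  zeros z = Bal-cong z (λ _ _ → refl)
  each′ : ∀ x w (c : Cut x w v) a → x ≡ a + s → Bal (λ i → S T k (λ K → ∑ F3 (λ j → J c a (λ A → 𝟙 (cA A ==ᶠ j)) (tailU cB (i ⊟ j)) K)))
  each′ x w c a refl with a ≤? k
  ... | no  q = zeros (λ i → trans (S-cong T k (λ K _ → trans (∑-cong F3 (λ j → J-zero c a (λ A → 𝟙 (cA A ==ᶠ j)) (tailU cB (i ⊟ j)) K (≰⇒> q))) (∑-0 F3))) (S-0 T k))
  ... | yes q with split c T
  ...   | _ , tR , TA , TR , e , sp = Bal-cong
    (expand sp k a (k ∸ a) (m+[n∸m]≡n q) (λ j A → 𝟙 (cA A ==ᶠ j)) (λ j → tailU cB j))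
    (Bal-convolution (N cA TA) (λ j → S TR (k ∸ a) (tailU cB j)) (2 ^ ((a + s ∸ a) * (k ∸ a ∸ tR))) (h a (k ∸ a) c TA TR (m+[n∸m]≡n q) e))
  each : (q : Cuts v) → Bal (λ i → S T k (λ K → termU s cA cB i K q))
  each (x , w , c) with s ≤? x
  ... | yes q = each′ x w c (x ∸ s) (sym (m∸n+n≡m q))
  ... | no  q = zeros (λ i → S-0 T k)

-- The recursion modulo 6.

-- One more than the guaranteed strength in dimension k and codimension l. Since τ 5 b = b mod 6, a
-- first piece of dimension 5 retains the whole residue of its codimension; this is why cuts are
-- made after five steps.
τ : ℕ → ℕ → ℕ
τ k l = (k % 6 + l % 6) ∸ 5

%-subadditive : ∀ a b → (a + b) % 6 ≤ a % 6 + b % 6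
%-subadditive a b = ≤-trans (≤-reflexive (%-distribˡ-+ a b 6)) (m%n≤m (a % 6 + b % 6) 6)

-- A subspace splits over a cut into pieces of dimensions tA and tR; if the first box is not balanced
-- over its piece, the second one is.
second-box : ∀ {tA tR t p q e l} → tA + tR ≡ t → t < (p + l) ∸ 5 → l ≤ q + e → q ≤ tA → tR < (p + e) ∸ 5
second-box {tA} {tR} {t} {p} {q} {e} {l} refl lt sub le = m+n<o⇒m<o∸n (+-cancelˡ-< q _ _ (begin-strict
  q + (tR + 5)     ≡⟨ sym (+-assoc q tR 5) ⟩
  q + tR + 5       ≤⟨ +-monoˡ-≤ 5 (+-monoˡ-≤ tR le) ⟩
  tA + tR + 5      <⟨ m<o∸n⇒m+n<o (p + l) lt ⟩
  p + l            ≤⟨ +-monoʳ-≤ p sub ⟩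
  p + (q + e)      ≡⟨ swap p q e ⟩
  q + (p + e)      ∎))
  where
  open ≤-Reasoning
  swap : ∀ p q e → p + (q + e) ≡ q + (p + e)
  swap = solve-∀
  m<o∸n⇒m+n<o : ∀ {m} o {n} → m < o ∸ n → m + n < o
  m<o∸n⇒m+n<o {m} o {n} p = ≤-trans (+-monoˡ-≤ n p) (≤-reflexive (m∸n+n≡m {o} {n}
    (≮⇒≥ λ o<n → n≮0 (subst (m <_) (m≤n⇒m∸n≡0 (<⇒≤ o<n)) p))))
  m+n<o⇒m<o∸n : ∀ {m n o} → m + n < o → m < o ∸ n
  m+n<o⇒m<o∸n {m} {n} {o} p = subst (_< o ∸ n) (m+n∸n≡m m n) (∸-monoˡ-< p (m≤n+m n m))

-- The colour of K is that of its image in the quotient by the first unit vector, so that counts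
-- obey the q-Pascal recursion.
pascal : Col → Col
pascal c nil      = 0F
pascal c (ov K)   = c K
pascal c (up K f) = c K

module Recursion (box : Col)
  (box-Good : ∀ v k l → k + l ≡ v → k < 6 → l < 6 → v < 9 → IsGood v k ((k + l) ∸ 5) box) where

  step : Col → Col
  step c {v} {k} K with 6 ≤? k | 6 ≤? v ∸ k | 9 ≤? v
  ... | yes _ | _     | _     = fpO 5 c c K
  ... | no  _ | yes _ | _     = fpU 5 c c K
  ... | no  _ | no  _ | yes _ = pascal c K
  ... | no  _ | no  _ | no  _ = box K

  -- The argument is fuel: `colour n` has the claimed strength in all dimensions v < n.
  colour : ℕ → Col
  colour zero    K = 0F
  colour (suc n) K = step (colour n) K

  GoodBelow : ℕ → Col → Set
  GoodBelow n c = ∀ k l → k + l < n → Good (k + l) k (τ k l) c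

  private
    zeros : ∀ {f : Fin 3 → ℕ} → (∀ i → f i ≡ 0) → Bal f
    zeros z = Bal-cong z (λ _ _ → refl)

    split≤2 : ∀ {tA tR t} → tA + tR ≡ t → t ≤ 2 → tA ≤ 2 × tR ≤ 2
    split≤2 {tA} {tR} refl p = ≤-trans (m≤m+n tA tR) p , ≤-trans (m≤n+m tR tA) p

  -- The pieces have dimensions 5 and r and codimensions b and l′. The sixth `ov` step is dropped,
  -- so r has the residue of the original dimension, while the codimension is shared as l = b + l′.
  fpO-Good : ∀ n (c : Col) → GoodBelow n c → ∀ r l → 6 + r + l < suc n → Good (6 + r + l) (6 + r) (τ (6 + r) l) (fpO 5 c c)
  fpO-Good n c g r l lt {t} T t<τ t≤2 = fpO-Bal 5 c c T r split-case
    where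
    split-case : ∀ {x w tA tR} (q : Cut x w (6 + r + l)) (TA : Gr x tA) (TR : Gr w tR) → tA + tR ≡ t →
      Bal (N {k = 5} c TA) ⊎ Bal (λ j → S TR (suc r) (tailO c j))
    split-case {x} {zero}   q TA TR e = inj₂ (tailO-Bal c TR (suc r) (λ T′ ()))
    split-case {x} {suc w} {tA} {tR} q TA TR e with 5 ≤? x
    -- V_x is too small to contain a first piece of dimension 5.
    ... | no x≱5  = inj₁ (zeros (λ i → S-small TA 5 (λ K → 𝟙 (c K ==ᶠ i)) (≰⇒> x≱5)))
    ... | yes x≥5 = aligned (x ∸ 5) (sym (m+[n∸m]≡n x≥5)) TA
      where
      total : x + suc w ≡ 6 + r + l
      total = cut-sum q
      x+w<n : x + w < n
      x+w<n = ≤-pred (subst (_< suc n) (trans (sym total) (+-suc x w)) lt)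
      aligned : ∀ b → x ≡ 5 + b → (TA : Gr x tA) → Bal (N {k = 5} c TA) ⊎ Bal (λ j → S TR (suc r) (tailO c j))
      aligned b refl TA with tA <? b % 6
      ... | yes tA<b = inj₁ (g 5 b (≤-<-trans (m≤m+n (5 + b) w) x+w<n) TA
                          (subst (tA <_) (sym (m+n∸m≡n 5 (b % 6))) tA<b) (proj₁ (split≤2 e t≤2)))
      ... | no tA≮b = inj₂ (tailO-Bal c TR (suc r) tail)
        where
        tail : ∀ {w′ r′ t′} (T′ : Gr w′ t′) → suc w ≡ suc w′ → suc r ≡ suc r′ → t′ ≤ tR → Bal (N {k = r′} c T′)
        tail {t′ = t′} T′ refl refl t′≤tR with r ≤? w
        ... | no r≰w  = zeros (λ i → S-small T′ r (λ K → 𝟙 (c K ==ᶠ i)) (≰⇒> r≰w))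
        ... | yes r≤w = go (w ∸ r) (sym (m+[n∸m]≡n r≤w)) T′
          where
          go : ∀ l′ → w ≡ r + l′ → (T′ : Gr w t′) → Bal (N {k = r} c T′)
          go l′ refl T′ = g r l′ (≤-<-trans (m≤n+m (r + l′) (5 + b)) x+w<n) T′
            (≤-<-trans t′≤tR (second-box {p = r % 6} {q = b % 6} {e = l′ % 6} {l = l % 6} e t<τ
              (subst (λ z → z % 6 ≤ b % 6 + l′ % 6) (sym l≡b+l′) (%-subadditive b l′)) (≮⇒≥ tA≮b)))
            (≤-trans t′≤tR (proj₂ (split≤2 e t≤2)))
            where
            arrange : ∀ b r l′ → 5 + b + suc (r + l′) ≡ 6 + r + (b + l′)
            arrange = solve-∀
            l≡b+l′ : l ≡ b + l′
            l≡b+l′ = +-cancelˡ-≡ (6 + r) l (b + l′) (trans (sym total) (arrange b r l′))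

  -- Dimension and codimension change roles: the first piece has codimension 5, the dropped `up`
  -- step preserves the residue of the codimension, and the dimension is shared as k = a + r.
  fpU-Good : ∀ n (c : Col) → GoodBelow n c → ∀ k l → k + (6 + l) < suc n → Good (k + (6 + l)) k (τ k (6 + l)) (fpU 5 c c)
  fpU-Good n c g k l lt {t} T t<τ t≤2 = fpU-Bal 5 c c T k (subst (suc (5 + k) ≤_) (arrange₀ k l) (m≤m+n (6 + k) l)) split-case
    where
    arrange₀ : ∀ k l → 6 + k + l ≡ k + (6 + l)
    arrange₀ = solve-∀
    split-case : ∀ {w tA tR} a r (q : Cut (a + 5) w (k + (6 + l))) (TA : Gr (a + 5) tA) (TR : Gr w tR) → a + r ≡ k → tA + tR ≡ t →
      Bal (N {k = a} c TA) ⊎ Bal (λ j → S TR r (tailU c j))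
    split-case {zero}  a r q TA TR e e′ = inj₂ (tailU-Bal c TR r (λ T′ ()))
    split-case {suc w} {tA} {tR} a r q TA TR refl e with tA <? a % 6
    ... | yes tA<a = inj₁ (g a 5 (≤-<-trans (m≤m+n (a + 5) w) x+w<n) TA
                        (subst (tA <_) (sym (m+n∸n≡m (a % 6) 5)) tA<a) (proj₁ (split≤2 e t≤2)))
      where
      x+w<n : a + 5 + w < n
      x+w<n = ≤-pred (subst (_< suc n) (trans (sym (cut-sum q)) (+-suc (a + 5) w)) lt)
    ... | no tA≮a = inj₂ (tailU-Bal c TR r tail)
      where
      x+w<n : a + 5 + w < n
      x+w<n = ≤-pred (subst (_< suc n) (trans (sym (cut-sum q)) (+-suc (a + 5) w)) lt)
      arrange : ∀ a r l → a + r + (6 + l) ≡ a + 5 + suc (r + l)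
      arrange = solve-∀
      w≡r+l : w ≡ r + l
      w≡r+l = suc-injective (+-cancelˡ-≡ (a + 5) (suc w) (suc (r + l)) (trans (cut-sum q) (arrange a r l)))
      t<τ′ : t < (l % 6 + (a + r) % 6) ∸ 5
      t<τ′ = subst (λ z → t < z ∸ 5) (+-comm ((a + r) % 6) (l % 6)) t<τ
      tail : ∀ {w′ t′} (T′ : Gr w′ t′) → suc w ≡ suc w′ → t′ ≤ tR → Bal (N {k = r} c T′)
      tail {t′ = t′} T′ refl t′≤tR = go w≡r+l T′
        where
        go : w ≡ r + l → (T′ : Gr w t′) → Bal (N {k = r} c T′)
        go refl T′ = g r l (≤-<-trans (m≤n+m (r + l) (a + 5)) x+w<n) T′
          (≤-<-trans t′≤tR (subst (λ z → tR < z ∸ 5) (+-comm (l % 6) (r % 6))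
            (second-box {p = l % 6} {q = a % 6} {e = r % 6} {l = (a + r) % 6} e t<τ′ (%-subadditive a r) (≮⇒≥ tA≮a))))
          (≤-trans t′≤tR (proj₂ (split≤2 e t≤2)))

  pascal-Good : ∀ (c : Col) k l → (∀ {t} (T : Gr (k + suc l) t) → t ≤ 2 → Bal (N {k = k} c T)) → (∀ {t} (T : Gr (k + suc l) t) → t ≤ 2 → Bal (N {k = suc k} c T)) →
    ∀ {t} (T : Gr (suc k + suc l) t) → t ≤ 2 → Bal (N {k = suc k} (pascal c) T)
  pascal-Good c k l g₁ g₂ (ov T) t≤2 = Bal-cong (λ i → S-ov-suc T k _) (g₁ T (≤-trans (n≤1+n _) t≤2))
  pascal-Good c k l g₁ g₂ (up {k = t} T g) t≤2 = Bal-cong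
    (λ i → trans (S-up-suc T g k _) (cong (N {k = k} c T i +_)
      (trans (S-cong T (suc k) (λ K p → ext-count T K g _ p)) (S-* T (suc k) (2 ^ (suc k ∸ t)) (λ K → 𝟙 (c K ==ᶠ i))))))
    (Bal-+ (g₁ T t≤2) (Bal-* (2 ^ (suc k ∸ t)) (g₂ T t≤2)))

  private
    step-O : ∀ (c : Col) {v k} (K : Gr v k) → 6 ≤ k → step c K ≡ fpO 5 c c K
    step-O c {v} {k} K p with 6 ≤? k | 6 ≤? v ∸ k | 9 ≤? v
    ... | yes _ | _     | _     = refl
    ... | no  q | _     | _     = contradiction p q

    step-U : ∀ (c : Col) {v k} (K : Gr v k) → ¬ 6 ≤ k → 6 ≤ v ∸ k → step c K ≡ fpU 5 c c K
    step-U c {v} {k} K p p′ with 6 ≤? k | 6 ≤? v ∸ k | 9 ≤? v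
    ... | yes q | _     | _     = contradiction q p
    ... | no  _ | yes _ | _     = refl
    ... | no  _ | no q  | _     = contradiction p′ q

    step-P : ∀ (c : Col) {v k} (K : Gr v k) → ¬ 6 ≤ k → ¬ 6 ≤ v ∸ k → 9 ≤ v → step c K ≡ pascal c K
    step-P c {v} {k} K p p′ p″ with 6 ≤? k | 6 ≤? v ∸ k | 9 ≤? v
    ... | yes q | _     | _     = contradiction q p
    ... | no  _ | yes q | _     = contradiction q p′
    ... | no  _ | no _  | yes _ = refl
    ... | no  _ | no _  | no q  = contradiction p″ q

    step-B : ∀ (c : Col) {v k} (K : Gr v k) → ¬ 6 ≤ k → ¬ 6 ≤ v ∸ k → ¬ 9 ≤ v → step c K ≡ box K
    step-B c {v} {k} K p p′ p″ with 6 ≤? k | 6 ≤? v ∸ k | 9 ≤? v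
    ... | yes q | _     | _     = contradiction q p
    ... | no  _ | yes q | _     = contradiction q p′
    ... | no  _ | no _  | yes q = contradiction q p″
    ... | no  _ | no _  | no _  = refl

    Good-cong : ∀ {v k n} {c c′ : Gr v k → Fin 3} → (∀ K → c K ≡ c′ K) → Good v k n c′ → Good v k n c
    Good-cong {k = k} p g T t<n t≤2 = Bal-cong (λ i → S-cong T k (λ K _ → cong (λ z → 𝟙 (z ==ᶠ i)) (p K))) (g T t<n t≤2)

    τ-small : ∀ {k l} → k < 6 → l < 6 → τ k l ≡ (k + l) ∸ 5
    τ-small p q = cong₂ (λ y z → (y + z) ∸ 5) (m<n⇒m%n≡m p) (m<n⇒m%n≡m q)

    pred<6 : ∀ {k} → suc k < 6 → k < 6
    pred<6 = <-trans (n<1+n _)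

  -- Only the pairs (4,5), (5,4) and (5,5) occur. Both predecessors have v ≥ 8 and residues equal to
  -- the dimensions themselves, so `τ` is at least 3 and covers every t ≤ 2.
  pascal-step : ∀ n (c : Col) → GoodBelow n c → ∀ k l → suc k < 6 → suc l < 6 → 9 ≤ suc k + suc l → suc k + suc l < suc n →
    Good (suc k + suc l) (suc k) (τ (suc k) (suc l)) (pascal c)
  pascal-step n c g k l k<6 l<6 v≥9 lt T t<τ t≤2 = pascal-Good c k l g₁ g₂ T t≤2
    where
    large : ∀ {t m} → t ≤ 2 → 8 ≤ m → t < m ∸ 5
    large p q = ≤-trans (s≤s p) (∸-monoˡ-≤ 5 q)
    g₁ : ∀ {t} (T : Gr (k + suc l) t) → t ≤ 2 → Bal (N {k = k} c T)
    g₁ {t} T p = g k (suc l) (≤-pred lt) T (subst (t <_) (sym (τ-small (pred<6 k<6) l<6)) (large p (≤-pred v≥9))) p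
    g₂ : ∀ {t} (T : Gr (k + suc l) t) → t ≤ 2 → Bal (N {k = suc k} c T)
    g₂ {t} T p = subst (λ v → (T : Gr v t) → Bal (N {k = suc k} c T)) (sym (+-suc k l))
      (λ T → g (suc k) l (≤-pred (subst (_< suc n) (cong suc (+-suc k l)) lt)) T
        (subst (t <_) (sym (τ-small k<6 (pred<6 l<6))) (large p (≤-pred (subst (9 ≤_) (cong suc (+-suc k l)) v≥9)))) p) T

  step-Good : ∀ n (c : Col) → GoodBelow n c → GoodBelow (suc n) (step c)
  step-Good n c g k l lt = cases k l lt (6 ≤? k) (6 ≤? l) (9 ≤? k + l)
    where
    caseO : ∀ r l → 6 + r + l < suc n → Good (6 + r + l) (6 + r) (τ (6 + r) l) (step c)
    caseO r l lt = Good-cong (λ K → step-O c K (m≤m+n 6 r)) (fpO-Good n c g r l lt)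
    caseU : ∀ k l → ¬ 6 ≤ k → k + (6 + l) < suc n → Good (k + (6 + l)) k (τ k (6 + l)) (step c)
    caseU k l p lt = Good-cong (λ K → step-U c K p (subst (6 ≤_) (sym (m+n∸m≡n k (6 + l))) (m≤m+n 6 l))) (fpU-Good n c g k l lt)
    cases : ∀ k l → k + l < suc n → Dec (6 ≤ k) → Dec (6 ≤ l) → Dec (9 ≤ k + l) → Good (k + l) k (τ k l) (step c)
    cases k l lt (yes p) _ _ = subst (λ k → k + l < suc n → Good (k + l) k (τ k l) (step c)) (m+[n∸m]≡n p) (caseO (k ∸ 6) l) lt
    cases k l lt (no p) (yes q) _ = subst (λ l → k + l < suc n → Good (k + l) k (τ k l) (step c)) (m+[n∸m]≡n q) (caseU k (l ∸ 6) p) lt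
    cases k l lt (no p) (no q) (no s) = subst (λ z → Good (k + l) k z (step c)) (sym (τ-small (≰⇒> p) (≰⇒> q)))
      (Good-cong (λ K → step-B c K p (q ∘ subst (6 ≤_) (m+n∸m≡n k l)) s) (IsGood.good (box-Good (k + l) k l refl (≰⇒> p) (≰⇒> q) (≰⇒> s))))
    cases zero    l       lt (no p) (no q) (yes s) = contradiction (≤-trans (m≤n+m 6 3) s) q
    cases (suc k) zero    lt (no p) (no q) (yes s) = contradiction (≤-trans (m≤n+m 6 3) (subst (9 ≤_) (+-identityʳ (suc k)) s)) p
    cases (suc k) (suc l) lt (no p) (no q) (yes s) =
      Good-cong (λ K → step-P c K p (q ∘ subst (6 ≤_) (m+n∸m≡n (suc k) (suc l))) s) (pascal-step n c g k l (≰⇒> p) (≰⇒> q) s lt)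

  colour-Good : ∀ n → GoodBelow n (colour n)
  colour-Good zero    k l ()
  colour-Good (suc n) = step-Good n (colour n) (colour-Good n)

-- From balanced colourings to large sets.

length-filter-∑ : {A : Set} (p : A → Bool) (xs : List A) → length (filter (λ x → p x ≟ᵇ true) xs) ≡ ∑ xs (𝟙 ∘ p)
length-filter-∑ p []       = refl
length-filter-∑ p (x ∷ xs) with p x
... | true  = cong suc (length-filter-∑ p xs)
... | false = length-filter-∑ p xs

Gr⇒≤ : ∀ {v k} → Gr v k → k ≤ v
Gr⇒≤ nil      = z≤n
Gr⇒≤ (ov K)   = s≤s (Gr⇒≤ K)
Gr⇒≤ (up K f) = m≤n⇒m≤1+n (Gr⇒≤ K)

S-below : ∀ {v t} (T : Gr v t) k (φ : Gr v k → ℕ) → k < t → S T k φ ≡ 0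
S-below T k φ p = trans (S-cong T k {φ} {λ _ → 0} (λ K q → contradiction (le⇒≤ T K q) (<⇒≱ p))) (S-0 T k)

-- The recursion along T becomes the q-Pascal rule defining `gauss`: the spaces through the new unit
-- vector give the first summand, and the 2^(k - t) extensions of `g` give the power of 2 in the
-- second.
S-gauss : ∀ {v t} (T : Gr v t) k → t ≤ k → S T k (λ _ → 1) ≡ gauss 2 (v ∸ t) (k ∸ t)
S-gauss nil zero    p = refl
S-gauss nil (suc k) p = refl
S-gauss (ov T) (suc k) (s≤s p) = trans (S-ov-suc T k _) (S-gauss T k p)
S-gauss (up {v} {t} T g) k p = trans (count k p) (cong (λ z → gauss 2 z (k ∸ t)) (sym (+-∸-assoc 1 (Gr⇒≤ T))))
  where
  Sup-count : ∀ k → t ≤ k → Sup T g k (λ _ → 1) ≡ 2 ^ (k ∸ t) * gauss 2 (v ∸ t) (k ∸ t)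
  Sup-count k p = trans (S-cong T k (λ K q → ext-count T K g 1 q)) (trans (S-* T k (2 ^ (k ∸ t)) (λ _ → 1)) (cong (2 ^ (k ∸ t) *_) (S-gauss T k p)))
  count : ∀ k → t ≤ k → S (up T g) k (λ _ → 1) ≡ gauss 2 (suc (v ∸ t)) (k ∸ t)
  count zero    z≤n = trans (S-up-zero T g _) (Sup-count 0 z≤n)
  count (suc k) p with t ≤? k
  ... | yes q rewrite +-∸-assoc 1 q = trans (S-up-suc T g k _) (cong₂ _+_ (S-gauss T k q)
        (trans (Sup-count (suc k) p) (cong (λ z → 2 ^ z * gauss 2 (v ∸ t) z) (+-∸-assoc 1 q))))
  -- The boundary case t = k + 1: no k-space contains T, and only the graph over T itself is left.
  ... | no q = trans (S-up-suc T g k _) (trans (cong₂ _+_ (S-below T k _ (≰⇒> q)) (Sup-count (suc k) p)) (top (≤-antisym p (≰⇒> q))))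
    where
    top : t ≡ suc k → 2 ^ (suc k ∸ t) * gauss 2 (v ∸ t) (suc k ∸ t) ≡ gauss 2 (suc (v ∸ t)) (suc k ∸ t)
    top refl rewrite n∸n≡0 k = refl

colourOf : Col → ∀ {v} → SubsetV v → Fin 3
colourOf c W = c (proj₂ (canon W))

-- The blocks through T are the canonical forms passing the test. Three equal counts add up to the
-- number of all k-spaces containing T, so each is a third of `gauss` and the division in λ is
-- exact.
Good⇒LargeSet : ∀ (c : Col) v k → 2 ≤ k → (∀ (T : Gr v 2) → Bal (N {k = k} c T)) → LargeSet₂ 3 2 k v
Good⇒LargeSet c v k 2≤k bal = colourOf c , (λ W W′ p → cong (λ z → c (proj₂ z)) (canon-cong p)) , design
  where
  B : Fin 3 → SubsetV v → Set
  B i W = IsSubspace v k W × colourOf c W ≡ i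
  design : ∀ i → IsDesignClass v 2 k (gauss 2 (v ∸ 2) (k ∸ 2) / 3) (B i)
  design i T isT = blocks (subspace⇒Gr isT)
    where
    ==ᶠ⇒≡ : ∀ a b → (a ==ᶠ b) ≡ true → a ≡ b
    ==ᶠ⇒≡ 0F 0F p = refl
    ==ᶠ⇒≡ 1F 1F p = refl
    ==ᶠ⇒≡ 2F 2F p = refl
    ==ᶠ-refl : ∀ a → (a ==ᶠ a) ≡ true
    ==ᶠ-refl 0F = refl
    ==ᶠ-refl 1F = refl
    ==ᶠ-refl 2F = refl
    blocks : (Σ (Gr v 2) λ T₀ → mem T₀ ≐ T) → Σ (List (SubsetV v)) λ L →
      length L ≡ gauss 2 (v ∸ 2) (k ∸ 2) / 3 × AllPairs (λ W W′ → ¬ (W ≐ W′)) L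
        × All (λ W → IsSubspace v k W × B i W × (T ⊆S W)) L × (∀ W → IsSubspace v k W → B i W → T ⊆S W → Any (W ≐_) L)
    blocks (T₀ , T₀≐T) = List.map mem Ks , len , distinct , sound , complete
      where
      test : Gr v k → Bool
      test K = le T₀ K ∧ (c K ==ᶠ i)
      Ks : List (Gr v k)
      Ks = filter (λ K → test K ≟ᵇ true) (allGr v k)
      size : length Ks ≡ N {k = k} c T₀ i
      size = trans (length-filter-∑ test (allGr v k)) (∑-cong (allGr v k) (λ K → 𝟙-∧ (le T₀ K) (c K ==ᶠ i)))
      one-colour : ∀ a → ∑ F3 (λ j → 𝟙 (a ==ᶠ j)) ≡ 1
      one-colour 0F = refl
      one-colour 1F = refl
      one-colour 2F = refl
      total : N {k = k} c T₀ i * 3 ≡ gauss 2 (v ∸ 2) (k ∸ 2)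
      total = begin
        N {k = k} c T₀ i * 3                            ≡⟨ thrice (N {k = k} c T₀ i) ⟩
        ∑ F3 (λ _ → N {k = k} c T₀ i)                   ≡⟨ ∑-cong F3 (λ j → bal T₀ i j) ⟩
        ∑ F3 (N {k = k} c T₀)                           ≡⟨ sym (S-∑ T₀ k F3 (λ j K → 𝟙 (c K ==ᶠ j))) ⟩
        S T₀ k (λ K → ∑ F3 (λ j → 𝟙 (c K ==ᶠ j)))       ≡⟨ S-cong T₀ k (λ K _ → one-colour (c K)) ⟩
        S T₀ k (λ _ → 1)                                ≡⟨ S-gauss T₀ k 2≤k ⟩
        gauss 2 (v ∸ 2) (k ∸ 2)                         ∎
        where
        open ≡-Reasoning
        thrice : ∀ a → a * 3 ≡ a + (a + (a + 0))
        thrice = solve-∀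
      len : length (List.map mem Ks) ≡ gauss 2 (v ∸ 2) (k ∸ 2) / 3
      len = trans (length-map mem Ks) (trans size (trans (sym (m*n/n≡m (N {k = k} c T₀ i) 3)) (cong (_/ 3) total)))
      distinct : AllPairs (λ W W′ → ¬ (W ≐ W′)) (List.map mem Ks)
      distinct = AllPairs.map⁺ (AllPairs.map (λ ne p → ne (mem-injective _ _ p)) (Unique.filter⁺ (λ K → test K ≟ᵇ true) (allGr-unique v k)))
      colour-mem : ∀ K → colourOf c (mem K) ≡ c K
      colour-mem K = cong (λ z → c (proj₂ z)) (canon-mem K)
      sound : All (λ W → IsSubspace v k W × B i W × (T ⊆S W)) (List.map mem Ks)
      sound = All.map⁺ (All.tabulate λ {K} K∈ → let p = proj₂ (∈-filter⁻ (λ K → test K ≟ᵇ true) {xs = allGr v k} K∈) in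
        mem-isSubspace K , (mem-isSubspace K , trans (colour-mem K) (==ᶠ⇒≡ (c K) i (∧-trueʳ {le T₀ K} p)))
        , λ x q → le⇒⊆ T₀ K (∧-trueˡ p) x (trans (T₀≐T x) q))
      complete : ∀ W → IsSubspace v k W → B i W → T ⊆S W → Any (W ≐_) (List.map mem Ks)
      complete W isW (_ , e) T⊆W with subspace⇒Gr isW
      ... | K , K≐W = Any.map⁺ (Any.map (λ { refl x → sym (K≐W x) }) (∈-filter⁺ (λ K → test K ≟ᵇ true) (∈-allGr K)
        (∧-true (⊆⇒le T₀ K (λ x p → trans (K≐W x) (T⊆W x (trans (sym (T₀≐T x)) p))))
                (trans (cong (_==ᶠ i) (trans (sym (colour-mem K)) (trans (cong (λ z → c (proj₂ z)) (canon-cong K≐W)) e))) (==ᶠ-refl i)))))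

-- Balance over tuples of points; derived and residual colourings.

NP : ∀ {v k n} → (Gr v k → Fin 3) → Vec (Pt v) n → Fin 3 → ℕ
NP {v} {k} c xs i = ∑ (allGr v k) (λ K → 𝟙 (allIn xs K) * 𝟙 (c K ==ᶠ i))

NP-cong : ∀ {v k m n} (c : Gr v k → Fin 3) (xs : Vec (Pt v) m) (ys : Vec (Pt v) n) →
  (∀ (K : Gr v k) → allIn xs K ≡ allIn ys K) → ∀ i → NP c xs i ≡ NP c ys i
NP-cong {v} {k} c xs ys p i = ∑-cong (allGr v k) (λ K → cong (λ z → 𝟙 z * 𝟙 (c K ==ᶠ i)) (p K))

N-NP : ∀ {v k t} (c : Gr v k → Fin 3) (T : Gr v t) i → N c T i ≡ NP c (basis T) i
N-NP {v} {k} c T i = ∑-cong (allGr v k) (λ K → cong (λ z → 𝟙 z * 𝟙 (c K ==ᶠ i)) (le-allIn T K))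

-- The n points may repeat or vanish, so this one condition contains all strengths up to n. Points
-- rather than subspaces are used because they can be averaged over and moved by automorphisms.
record PGood (v k n : ℕ) (c : Gr v k → Fin 3) : Set where
  constructor pgood
  field balanced : ∀ (xs : Vec (Pt v) n) → Bal (NP c xs)
open PGood

pad : ∀ {v t n} → t ≤ n → Vec (Pt v) t → Vec (Pt v) n
pad {n = n} z≤n []       = replicate n 0V
pad (s≤s p)     (x ∷ xs) = x ∷ pad p xs

allIn-pad : ∀ {v t n k} (p : t ≤ n) (xs : Vec (Pt v) t) (K : Gr v k) → allIn (pad p xs) K ≡ allIn xs K
allIn-pad {n = n} z≤n []       K = zeros n
  where
  zeros : ∀ n → allIn (replicate n 0V) K ≡ true
  zeros zero    = refl
  zeros (suc n) = ∧-true (mem-0 K) (zeros n)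
allIn-pad (s≤s p)     (x ∷ xs) K = cong (mem K x ∧_) (allIn-pad p xs K)

PGood⇒IsGood : ∀ {v k n} {c : Gr v k → Fin 3} → PGood v k n c → IsGood v k (suc n) c
PGood⇒IsGood {c = c} g = isGood λ { T (s≤s t≤n) _ → Bal-cong
  (λ i → trans (N-NP c T i) (NP-cong c (basis T) (pad t≤n (basis T)) (λ K → sym (allIn-pad t≤n (basis T) K)) i))
  (balanced g (pad t≤n (basis T))) }

-- The derived colouring at the first unit vector: spaces through it are the spaces of the quotient,
-- and T lifts to `ov T`, which costs one dimension of strength.
quotient-IsGood : ∀ {v k n} {c : Gr (suc v) (suc k) → Fin 3} → n ≤ 2 → IsGood (suc v) (suc k) (suc n) c → IsGood v k n (c ∘ ov)
quotient-IsGood {k = k} {c = c} n≤2 (isGood g) = isGood λ T t<n t≤2 → Bal-cong (λ i → sym (S-ov-suc T k (λ K → 𝟙 (c K ==ᶠ i))))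
  (g (ov T) (s≤s t<n) (≤-trans t<n n≤2))

∑-points : ∀ {v k} (K : Gr v k) c → ∑ (allVec v) (λ y → 𝟙 (mem K y) * c) ≡ 2 ^ k * c
∑-points {k = k} K c = trans (∑-mem K (λ _ → c)) (∑-const k c)

-- Double counting of the pairs (K , y) with y in K, of which every K has 2^k.
NP-∑ : ∀ {v k n} (c : Gr v k → Fin 3) (xs : Vec (Pt v) n) i → ∑ (allVec v) (λ y → NP c (y ∷ xs) i) ≡ 2 ^ k * NP c xs i
NP-∑ {v} {k} c xs i = trans (∑-swap (allVec v) (allGr v k) _) (trans (∑-cong (allGr v k) inner) (∑-* (2 ^ k) (allGr v k) _))
  where
  inner : ∀ K → ∑ (allVec v) (λ y → 𝟙 (mem K y ∧ allIn xs K) * 𝟙 (c K ==ᶠ i)) ≡ 2 ^ k * (𝟙 (allIn xs K) * 𝟙 (c K ==ᶠ i))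
  inner K = trans (∑-cong (allVec v) (λ y → trans (cong (_* 𝟙 (c K ==ᶠ i)) (𝟙-∧ (mem K y) (allIn xs K))) (*-assoc (𝟙 (mem K y)) _ _)))
    (∑-points K _)

cancel : ∀ {m n a b r} → n < m → m * a ≡ n * a + r → m * b ≡ n * b + r → a ≡ b
cancel {m} {n} {a} {b} {r} n<m p q = *-cancelˡ-≡ a b (suc (m ∸ suc n)) (+-cancelˡ-≡ (n * a + n * b) _ _ (begin
  (n * a + n * b) + d * a      ≡⟨ lhs n a b d ⟩
  (d + n) * a + n * b          ≡⟨ cong (λ z → z * a + n * b) d+n ⟩
  m * a + n * b                ≡⟨ cong (_+ n * b) p ⟩
  n * a + r + n * b            ≡⟨ mid n a b r ⟩
  n * b + r + n * a            ≡⟨ cong (_+ n * a) (sym q) ⟩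
  m * b + n * a                ≡⟨ cong (λ z → z * b + n * a) (sym d+n) ⟩
  (d + n) * b + n * a          ≡⟨ sym (rhs n a b d) ⟩
  (n * a + n * b) + d * b      ∎))
  where
  open ≡-Reasoning
  d = suc (m ∸ suc n)
  d+n : d + n ≡ m
  d+n = trans (sym (+-suc (m ∸ suc n) n)) (m∸n+n≡m n<m)
  lhs : ∀ n a b d → (n * a + n * b) + d * a ≡ (d + n) * a + n * b
  lhs = solve-∀
  rhs : ∀ n a b d → (n * a + n * b) + d * b ≡ (d + n) * b + n * a
  rhs = solve-∀
  mid : ∀ n a b r → n * a + r + n * b ≡ n * b + r + n * a
  mid = solve-∀

-- In the double count each special y, being already forced into K, contributes NP c xs again. The
-- number of special points is below 2^k, so a positive multiple of NP c xs equals a balanced sum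
-- and can be cancelled.
average : ∀ {v k n} (c : Gr v k → Fin 3) (xs : Vec (Pt v) n) (special : Pt v → Bool) →
  ∑ (allVec v) (𝟙 ∘ special) < 2 ^ k →
  (∀ y → special y ≡ true → ∀ i → NP c (y ∷ xs) i ≡ NP c xs i) →
  (∀ y → special y ≡ false → Bal (NP c (y ∷ xs))) → Bal (NP c xs)
average {v} {k} c xs special few same bal i j = cancel few (eq i) (trans (eq j) (cong (∑ (allVec v) (𝟙 ∘ special) * NP c xs j +_) (sym (rest-Bal i j))))
  where
  rest : Pt v → Fin 3 → ℕ
  rest y i = if special y then 0 else NP c (y ∷ xs) i
  rest-Bal : Bal (λ i → ∑ (allVec v) (λ y → rest y i))
  rest-Bal = Bal-∑ (allVec v) rest each
    where
    each : ∀ y → Bal (rest y)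
    each y i j with special y in e
    ... | true  = refl
    ... | false = bal y e i j
  split-term : ∀ i y → NP c (y ∷ xs) i ≡ NP c xs i * 𝟙 (special y) + rest y i
  split-term i y with special y in e
  ... | true  = trans (same y e i) (sym (trans (+-identityʳ _) (*-identityʳ _)))
  ... | false = cong (_+ NP c (y ∷ xs) i) (sym (*-zeroʳ (NP c xs i)))
  eq : ∀ i → 2 ^ k * NP c xs i ≡ ∑ (allVec v) (𝟙 ∘ special) * NP c xs i + ∑ (allVec v) (λ y → rest y i)
  eq i = begin
    2 ^ k * NP c xs i                                              ≡⟨ sym (NP-∑ c xs i) ⟩
    ∑ (allVec v) (λ y → NP c (y ∷ xs) i)                            ≡⟨ ∑-cong (allVec v) (split-term i) ⟩
    ∑ (allVec v) (λ y → NP c xs i * 𝟙 (special y) + rest y i)       ≡⟨ ∑-+ (allVec v) _ _ ⟩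
    ∑ (allVec v) (λ y → NP c xs i * 𝟙 (special y)) + R              ≡⟨ cong (_+ R) (∑-* (NP c xs i) (allVec v) _) ⟩
    NP c xs i * ∑ (allVec v) (𝟙 ∘ special) + R                      ≡⟨ cong (_+ R) (*-comm (NP c xs i) _) ⟩
    ∑ (allVec v) (𝟙 ∘ special) * NP c xs i + R                      ∎
    where
    open ≡-Reasoning
    R = ∑ (allVec v) (λ y → rest y i)

∑-unit : ∀ {n} (x : Vec Bool n) → ∑ (allVec n) (λ y → 𝟙 (y ==ᵛ x)) ≡ 1
∑-unit []          = refl
∑-unit {suc n} (false ∷ x) = trans (∑-allVec n _) (trans (cong₂ _+_ (∑-unit x) (∑-0 (allVec n))) refl)
∑-unit {suc n} (true ∷ x)  = trans (∑-allVec n _) (cong₂ _+_ (∑-0 (allVec n)) (∑-unit x))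

-- Smaller strengths come from averaging over the second point, then over the first. The special
-- points are 0 and x, respectively 0 alone, and 2^k ≥ 4 exceeds their number.
pairs⇒PGood : ∀ {v k} (c : Gr v k → Fin 3) → 2 ≤ k →
  (∀ x y → (x ==ᵛ 0V) ≡ false → (y ==ᵛ 0V) ≡ false → (y ==ᵛ x) ≡ false → Bal (NP c (y ∷ x ∷ []))) → PGood v k 2 c
pairs⇒PGood {v} {k} c 2≤k bal = pgood all
  where
  4≤2^k : 4 ≤ 2 ^ k
  4≤2^k = ^-monoʳ-≤ 2 2≤k
  allIn-0 : ∀ {n} (xs : Vec (Pt v) n) (K : Gr v k) → allIn (0V ∷ xs) K ≡ allIn xs K
  allIn-0 xs K = cong (_∧ allIn xs K) (mem-0 K)
  ∧-idem : ∀ a b → a ∧ (a ∧ b) ≡ a ∧ b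
  ∧-idem true  b = refl
  ∧-idem false b = refl
  single : ∀ x → (x ==ᵛ 0V) ≡ false → Bal (NP c (x ∷ []))
  single x x≠0 = average c (x ∷ []) special few same other
    where
    special : Pt v → Bool
    special y = (y ==ᵛ 0V) ∨ (y ==ᵛ x)
    𝟙-∨ : ∀ a b → 𝟙 (a ∨ b) ≤ 𝟙 a + 𝟙 b
    𝟙-∨ true  b = s≤s z≤n
    𝟙-∨ false b = ≤-refl
    ∑-mono : ∀ {A : Set} (ys : List A) {f g : A → ℕ} → (∀ y → f y ≤ g y) → ∑ ys f ≤ ∑ ys g
    ∑-mono []       p = z≤n
    ∑-mono (y ∷ ys) p = +-mono-≤ (p y) (∑-mono ys p)
    few : ∑ (allVec v) (𝟙 ∘ special) < 2 ^ k
    few = ≤-<-trans (∑-mono (allVec v) (λ y → 𝟙-∨ (y ==ᵛ 0V) (y ==ᵛ x)))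
      (≤-<-trans (≤-reflexive (trans (∑-+ (allVec v) _ _) (cong₂ _+_ (∑-unit (0V {v})) (∑-unit x)))) (≤-trans (n≤1+n 3) 4≤2^k))
    same : ∀ y → special y ≡ true → ∀ i → NP c (y ∷ x ∷ []) i ≡ NP c (x ∷ []) i
    same y p with y ==ᵛ 0V in e
    ... | true  = λ i → NP-cong c (y ∷ x ∷ []) (x ∷ []) (λ K → trans (cong (λ z → allIn (z ∷ x ∷ []) K) (==ᵛ⇒≡ y 0V e)) (allIn-0 (x ∷ []) K)) i
    ... | false = λ i → NP-cong c (y ∷ x ∷ []) (x ∷ []) (λ K → trans (cong (λ z → allIn (z ∷ x ∷ []) K) (==ᵛ⇒≡ y x p)) (∧-idem (mem K x) true)) i
    other : ∀ y → special y ≡ false → Bal (NP c (y ∷ x ∷ []))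
    other y p with y ==ᵛ 0V in e
    ... | false = bal x y x≠0 e p
  none : Bal (NP {n = 0} c [])
  none = average c [] (_==ᵛ 0V) (≤-<-trans (≤-reflexive (∑-unit (0V {v}))) (≤-trans (s≤s (s≤s z≤n)) 4≤2^k))
    (λ y p → NP-cong c (y ∷ []) [] (λ K → trans (cong (λ z → allIn (z ∷ []) K) (==ᵛ⇒≡ y 0V p)) (allIn-0 [] K)))
    (λ y p → single y p)
  one : ∀ x → Bal (NP c (x ∷ []))
  one x with x ==ᵛ 0V in e
  ... | false = single x e
  ... | true  = Bal-cong (NP-cong c (x ∷ []) [] (λ K → trans (cong (λ z → allIn (z ∷ []) K) (==ᵛ⇒≡ x 0V e)) (allIn-0 [] K))) none
  all : ∀ xs → Bal (NP c xs)
  all (y ∷ x ∷ []) with y ==ᵛ 0V in ey | x ==ᵛ 0V in ex | y ==ᵛ x in e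
  ... | true  | _     | _     = Bal-cong (NP-cong c (y ∷ x ∷ []) (x ∷ []) (λ K → trans (cong (λ z → allIn (z ∷ x ∷ []) K) (==ᵛ⇒≡ y 0V ey)) (allIn-0 (x ∷ []) K))) (one x)
  ... | false | true  | _     = Bal-cong (NP-cong c (y ∷ x ∷ []) (y ∷ []) (λ K → trans (cong (λ z → allIn (y ∷ z ∷ []) K) (==ᵛ⇒≡ x 0V ex)) (cong (mem K y ∧_) (allIn-0 [] K)))) (one y)
  ... | false | false | true  = Bal-cong (NP-cong c (y ∷ x ∷ []) (x ∷ []) (λ K → trans (cong (λ z → allIn (z ∷ x ∷ []) K) (==ᵛ⇒≡ y x e)) (∧-idem (mem K x) true))) (one x)
  ... | false | false | false = bal x y ex ey e

∑-dot : ∀ {n} (f : Vec Bool n) → ∑ (allVec n) (λ c → 𝟙 (false == dot f c)) ≡ ∑ (allVec n) (λ c → 𝟙 (true == dot f c)) + 2 ^ n * 𝟙 (f ==ᵛ 0V)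
∑-dot [] = refl
∑-dot {suc n} (false ∷ f) = begin
  ∑ (allVec (suc n)) (λ c → 𝟙 (false == dot (false ∷ f) c))  ≡⟨ ∑-allVec n _ ⟩
  F + F                                                     ≡⟨ cong₂ _+_ (∑-dot f) (∑-dot f) ⟩
  (G + 2 ^ n * e) + (G + 2 ^ n * e)                         ≡⟨ twice G (2 ^ n) e ⟩
  G + G + 2 ^ suc n * e                                     ≡⟨ cong (_+ 2 ^ suc n * e) (sym (∑-allVec n _)) ⟩
  ∑ (allVec (suc n)) (λ c → 𝟙 (true == dot (false ∷ f) c)) + 2 ^ suc n * e ∎
  where
  open ≡-Reasoning
  F = ∑ (allVec n) (λ c → 𝟙 (false == dot f c))
  G = ∑ (allVec n) (λ c → 𝟙 (true == dot f c))
  e = 𝟙 (f ==ᵛ 0V)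
  twice : ∀ g p e → (g + p * e) + (g + p * e) ≡ g + g + 2 * p * e
  twice = solve-∀
∑-dot {suc n} (true ∷ f) = begin
  ∑ (allVec (suc n)) (λ c → 𝟙 (false == dot (true ∷ f) c))  ≡⟨ ∑-allVec n _ ⟩
  F + ∑ (allVec n) (λ c → 𝟙 (false == not (dot f c)))      ≡⟨ cong (F +_) (∑-cong (allVec n) (λ c → cong 𝟙 (flip (dot f c)))) ⟩
  F + G                                                    ≡⟨ +-comm F G ⟩
  G + F                                                    ≡⟨ cong (G +_) (∑-cong (allVec n) (λ c → cong 𝟙 (flip′ (dot f c)))) ⟩
  G + ∑ (allVec n) (λ c → 𝟙 (true == not (dot f c)))       ≡⟨ sym (∑-allVec n _) ⟩
  ∑ (allVec (suc n)) (λ c → 𝟙 (true == dot (true ∷ f) c))   ≡⟨ sym (+-identityʳ _) ⟩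
  ∑ (allVec (suc n)) (λ c → 𝟙 (true == dot (true ∷ f) c)) + 0 ≡⟨ cong (∑ (allVec (suc n)) (λ c → 𝟙 (true == dot (true ∷ f) c)) +_) (sym (*-zeroʳ (2 ^ suc n))) ⟩
  ∑ (allVec (suc n)) (λ c → 𝟙 (true == dot (true ∷ f) c)) + 2 ^ suc n * 0 ∎
  where
  open ≡-Reasoning
  F = ∑ (allVec n) (λ c → 𝟙 (false == dot f c))
  G = ∑ (allVec n) (λ c → 𝟙 (true == dot f c))
  flip : ∀ b → (false == not b) ≡ (true == b)
  flip true  = refl
  flip false = refl
  flip′ : ∀ b → (false == b) ≡ (true == not b)
  flip′ b = refl

inHyperplane : ∀ {v k} → Gr (suc v) k → Bool
inHyperplane (ov K)   = false
inHyperplane (up K f) = f ==ᵛ 0V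

-- A space not inside the hyperplane of points with first coordinate 0 has half of its points there;
-- a space inside has all its 2^k points there and none outside.
∑-hyperplane : ∀ {v k} (K : Gr (suc v) k) →
  ∑ (allVec v) (λ y → 𝟙 (mem K (false ∷ y))) ≡ ∑ (allVec v) (λ y → 𝟙 (mem K (true ∷ y))) + 2 ^ k * 𝟙 (inHyperplane K)
∑-hyperplane {v} (ov {k = k} K) = sym (trans (cong (∑ (allVec v) (λ y → 𝟙 (mem K y)) +_) (*-zeroʳ (2 ^ suc k))) (+-identityʳ _))
∑-hyperplane {v} (up {k = k} K f) = trans (through false) (trans (∑-dot f) (cong (_+ 2 ^ k * 𝟙 (f ==ᵛ 0V)) (sym (through true))))
  where
  through : ∀ b → ∑ (allVec v) (λ y → 𝟙 (mem K y ∧ (b == dot f (coords K y)))) ≡ ∑ (allVec k) (λ c → 𝟙 (b == dot f c))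
  through b = trans (∑-cong (allVec v) (λ y → 𝟙-∧ (mem K y) _)) (trans (∑-mem K (λ y → 𝟙 (b == dot f (coords K y))))
    (∑-cong (allVec k) (λ c → cong (λ z → 𝟙 (b == dot f z)) (coords-emb K c))))

residual : ∀ {v k} → (Gr (suc v) k → Fin 3) → Gr v k → Fin 3
residual c K = c (up K 0V)

-- Restriction to a hyperplane. Sum over the spaces through `xs` the number of their points inside
-- minus the number outside: only spaces within the hyperplane survive, each with weight 2^k. Both
-- sums are balanced by the strength n + 1 of `c`.
residual-Bal : ∀ {v k n} (c : Gr (suc v) k → Fin 3) → (∀ (xs : Vec (Pt (suc v)) (suc n)) → Bal (NP c xs)) → ∀ (xs : Vec (Pt v) n) → Bal (NP (residual c) xs)
residual-Bal {v} {k} {n} c g xs i j = *-cancelˡ-≡ (NR i) (NR j) (2 ^ k) {{>-nonZero (m^n>0 2 k)}} (+-cancelˡ-≡ (side true i) _ _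
  (trans (sym (eq i)) (trans (sides false i j) (trans (eq j) (cong (_+ 2 ^ k * NR j) (sides true j i))))))
  where
  NR = NP (residual c) xs
  xs′ = map (false ∷_) xs
  side : Bool → Fin 3 → ℕ
  side b i = ∑ (allVec v) (λ y → NP c ((b ∷ y) ∷ xs′) i)
  sides : ∀ b → Bal (side b)
  sides b = Bal-∑ (allVec v) _ (λ y → g ((b ∷ y) ∷ xs′))
  weight : Fin 3 → Gr (suc v) k → ℕ
  weight i K = 𝟙 (allIn xs′ K) * 𝟙 (c K ==ᶠ i)
  side-∑ : ∀ b i → side b i ≡ ∑ (allGr (suc v) k) (λ K → weight i K * ∑ (allVec v) (λ y → 𝟙 (mem K (b ∷ y))))
  side-∑ b i = trans (∑-swap (allVec v) (allGr (suc v) k) _) (∑-cong (allGr (suc v) k) (λ K → trans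
    (∑-cong (allVec v) (λ y → trans (cong (_* 𝟙 (c K ==ᶠ i)) (𝟙-∧ (mem K (b ∷ y)) (allIn xs′ K))) (turn (𝟙 (mem K (b ∷ y))) (𝟙 (allIn xs′ K)) (𝟙 (c K ==ᶠ i)))))
    (∑-* (weight i K) (allVec v) _)))
    where
    turn : ∀ a b c → a * b * c ≡ b * c * a
    turn = solve-∀
  restrict : ∀ i → ∑ (allGr (suc v) k) (λ K → weight i K * 𝟙 (inHyperplane K)) ≡ NR i
  restrict i = trans (∑-allGr v k _) (cong₂ _+_ (ovs-none k (weight i)) (∑-cong (allGr v k) graphs))
    where
    ovs-none : ∀ k (w : Gr (suc v) k → ℕ) → ∑ (ovs v k) (λ K → w K * 𝟙 (inHyperplane K)) ≡ 0
    ovs-none zero    w = refl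
    ovs-none (suc k) w = trans (∑-ovs v k _) (trans (∑-cong (allGr v k) (λ K → *-zeroʳ (w (ov K)))) (∑-0 (allGr v k)))
    allIn-residual : ∀ {n} (xs : Vec (Pt v) n) (K : Gr v k) → allIn (map (false ∷_) xs) (up K 0V) ≡ allIn xs K
    allIn-residual []       K = refl
    allIn-residual (x ∷ xs) K = cong₂ _∧_ (trans (cong (mem K x ∧_) (cong (false ==_) (dot-0ˡ (coords K x)))) (and-true (mem K x))) (allIn-residual xs K)
      where
      dot-0ˡ : ∀ {n} (c : Vec Bool n) → dot 0V c ≡ false
      dot-0ˡ []      = refl
      dot-0ˡ (b ∷ c) = dot-0ˡ c
      and-true : ∀ b → b ∧ true ≡ b
      and-true true  = refl
      and-true false = refl
    graphs : ∀ K → ∑ (allVec k) (λ f → weight i (up K f) * 𝟙 (f ==ᵛ 0V)) ≡ 𝟙 (allIn xs K) * 𝟙 (residual c K ==ᶠ i)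
    graphs K = trans (∑-cong (allVec k) pin) (trans (∑-* (weight i (up K 0V)) (allVec k) _) (trans (cong (weight i (up K 0V) *_) (∑-unit (0V {k})))
      (trans (*-identityʳ _) (cong (λ z → 𝟙 z * 𝟙 (c (up K 0V) ==ᶠ i)) (allIn-residual xs K)))))
      where
      pin : ∀ f → weight i (up K f) * 𝟙 (f ==ᵛ 0V) ≡ weight i (up K 0V) * 𝟙 (f ==ᵛ 0V)
      pin f with f ==ᵛ 0V in e
      ... | true  = cong (λ z → weight i (up K z) * 1) (==ᵛ⇒≡ f 0V e)
      ... | false = trans (*-zeroʳ (weight i (up K f))) (sym (*-zeroʳ (weight i (up K 0V))))
  eq : ∀ i → side false i ≡ side true i + 2 ^ k * NR i
  eq i = begin
    side false i
      ≡⟨ side-∑ false i ⟩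
    ∑ (allGr (suc v) k) (λ K → weight i K * ∑ (allVec v) (λ y → 𝟙 (mem K (false ∷ y))))
      ≡⟨ ∑-cong (allGr (suc v) k) (λ K → trans (cong (weight i K *_) (∑-hyperplane K)) (dist (weight i K) (∑ (allVec v) (λ y → 𝟙 (mem K (true ∷ y)))) (2 ^ k) (𝟙 (inHyperplane K)))) ⟩
    ∑ (allGr (suc v) k) (λ K → weight i K * ∑ (allVec v) (λ y → 𝟙 (mem K (true ∷ y))) + 2 ^ k * (weight i K * 𝟙 (inHyperplane K)))
      ≡⟨ ∑-+ (allGr (suc v) k) _ _ ⟩
    ∑ (allGr (suc v) k) (λ K → weight i K * ∑ (allVec v) (λ y → 𝟙 (mem K (true ∷ y)))) + ∑ (allGr (suc v) k) (λ K → 2 ^ k * (weight i K * 𝟙 (inHyperplane K)))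
      ≡⟨ cong₂ _+_ (sym (side-∑ true i)) (trans (∑-* (2 ^ k) (allGr (suc v) k) _) (cong (2 ^ k *_) (restrict i))) ⟩
    side true i + 2 ^ k * NR i ∎
    where
    open ≡-Reasoning
    dist : ∀ w t p h → w * (t + p * h) ≡ w * t + p * (w * h)
    dist = solve-∀

residual-PGood : ∀ {v k n} {c : Gr (suc v) k → Fin 3} → PGood (suc v) k (suc n) c → PGood v k n (residual c)
residual-PGood {c = c} (pgood g) = pgood (residual-Bal c g)

-- Direct enumeration of the spaces containing T.

extL : ∀ {v t k} → Gr v t → Gr v k → Vec Bool t → List (Vec Bool k)
extL nil      nil      []      = [] ∷ []
extL (ov T)   (ov K)   (b ∷ g) = List.map (b ∷_) (extL T K g)
extL (ov T)   (up K f) g       = []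
extL (up T h) (ov K)   g       = List.map (false ∷_) (extL T K g) ++ List.map (true ∷_) (extL T K (h ⊞ᵛ g))
extL (up T h) (up K f) g       = extL T K g

-- Made for evaluation: over a line in dimension 8 it generates only the 63, 651 or 1395 spaces of
-- dimension 3, 4 or 5 that contain it, where `S` would test every space of `allGr`.
supers : ∀ {v t} → Gr v t → ∀ k → List (Gr v k)
supers nil      zero    = nil ∷ []
supers nil      (suc k) = []
supers (ov T)   zero    = []
supers (ov T)   (suc k) = List.map ov (supers T k)
supers (up T g) zero    = concatMap (λ K → List.map (up K) (extL T K g)) (supers T 0)
supers (up T g) (suc k) = List.map ov (supers T k) ++ concatMap (λ K → List.map (up K) (extL T K g)) (supers T (suc k))

∑-extL : ∀ {v t k} (T : Gr v t) (K : Gr v k) g (ψ : Vec Bool k → ℕ) → le T K ≡ true → ∑ (extL T K g) ψ ≡ ext T K g ψ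
∑-extL nil      nil      []      ψ p = cong (_+ 0) (sym (+-identityʳ (ψ [])))
∑-extL (ov T)   (ov K)   (b ∷ g) ψ p = trans (∑-map (b ∷_) (extL T K g) ψ) (trans (∑-extL T K g _ p) (sym (ext-ovov T K b g ψ)))
∑-extL (up T h) (ov K)   g       ψ p = trans (∑-++ (List.map (false ∷_) (extL T K g)) _ ψ) (trans
  (cong₂ _+_ (trans (∑-map (false ∷_) (extL T K g) ψ) (∑-extL T K g _ p)) (trans (∑-map (true ∷_) (extL T K (h ⊞ᵛ g)) ψ) (∑-extL T K (h ⊞ᵛ g) _ p)))
  (sym (ext-upov T h K g ψ)))
∑-extL (up T h) (up K f) g       ψ p = ∑-extL T K g ψ (∧-trueˡ p)

∑-concatMap : {A B : Set} (h : B → List A) (xs : List B) (f : A → ℕ) → ∑ (concatMap h xs) f ≡ ∑ xs (λ x → ∑ (h x) f)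
∑-concatMap h []       f = refl
∑-concatMap h (x ∷ xs) f = trans (∑-++ (h x) (concatMap h xs) f) (cong (∑ (h x) f +_) (∑-concatMap h xs f))

∑-supers : ∀ {v t} (T : Gr v t) k (φ : Gr v k → ℕ) → ∑ (supers T k) φ ≡ S T k φ
∑-supers nil zero    φ = cong (_+ 0) (sym (+-identityʳ (φ nil)))
∑-supers nil (suc k) φ = refl
∑-supers (ov T) zero    φ = sym (S-ov-zero T φ)
∑-supers (ov T) (suc k) φ = trans (∑-map ov (supers T k) φ) (trans (∑-supers T k _) (sym (S-ov-suc T k φ)))
∑-supers (up {v} {t} T g) k φ = go k φ
  where
  graphs : ∀ k (φ : Gr (suc v) k → ℕ) → ∑ (concatMap (λ K → List.map (up K) (extL T K g)) (supers T k)) φ ≡ Sup T g k φ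
  graphs k φ = trans (∑-concatMap _ (supers T k) φ) (trans (∑-cong (supers T k) (λ K → ∑-map (up K) (extL T K g) φ))
    (trans (∑-supers T k _) (S-cong T k (λ K p → ∑-extL T K g (φ ∘ up K) p))))
  go : ∀ k (φ : Gr (suc v) k → ℕ) → ∑ (supers (up T g) k) φ ≡ S (up T g) k φ
  go zero    φ = trans (graphs 0 φ) (sym (S-up-zero T g φ))
  go (suc k) φ = trans (∑-++ (List.map ov (supers T k)) _ φ) (trans
    (cong₂ _+_ (trans (∑-map ov (supers T k) φ) (∑-supers T k _)) (graphs (suc k) φ)) (sym (S-up-suc T g k φ)))

-- Automorphisms acting on colourings.

∑-↭ : {A : Set} {xs ys : List A} (f : A → ℕ) → xs Perm.↭ ys → ∑ xs f ≡ ∑ ys f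
∑-↭ f Perm.refl = refl
∑-↭ f (Perm.prep x p) = cong (f x +_) (∑-↭ f p)
∑-↭ {ys = _ ∷ _ ∷ ys} f (Perm.swap x y p) = trans (cong (λ z → f x + (f y + z)) (∑-↭ f p))
  (trans (sym (+-assoc (f x) (f y) _)) (trans (cong (_+ ∑ ys f) (+-comm (f x) (f y))) (+-assoc (f y) (f x) _)))
∑-↭ f (Perm.trans p q) = trans (∑-↭ f p) (∑-↭ f q)

∑-bijection : {A : Set} {xs : List A} → Unique xs → (∀ x → x ∈ xs) → (to from : A → A) →
  (∀ x → to (from x) ≡ x) → (∀ x → from (to x) ≡ x) → (f : A → ℕ) → ∑ xs (f ∘ to) ≡ ∑ xs f
∑-bijection {xs = xs} u all to from to-from from-to f = trans (sym (∑-map to xs f)) (∑-↭ f (∼bag⇒↭ (unique∧set⇒bag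
  (Unique.map⁺ (λ {x} {y} e → trans (sym (from-to x)) (trans (cong from e) (from-to y))) u) u
  (λ {x} → mk⇔ (λ _ → all x) (λ _ → subst (_∈ List.map to xs) (to-from x) (∈-map⁺ to (all (from x))))))))

-- A matrix and its inverse, listed by the images of the unit vectors; the two inverse laws can thus
-- be decided by evaluation at all points.
record Automorphism (v : ℕ) : Set where
  field
    images preimages : Vec (Pt v) v
    to-from : ∀ x → lincomb (lincomb x preimages) images ≡ x
    from-to : ∀ x → lincomb (lincomb x images) preimages ≡ x

  to from : Pt v → Pt v
  to   x = lincomb x images
  from x = lincomb x preimages

  from-lincomb : ∀ {n} (c : Vec Bool n) (bs : Vec (Pt v) n) → lincomb c (map from bs) ≡ from (lincomb c bs)
  from-lincomb []          []       = sym (lincomb-0 preimages)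
  from-lincomb (true ∷ c)  (b ∷ bs) = trans (cong (from b ⊕_) (from-lincomb c bs)) (sym (lincomb-⊕ b (lincomb c bs) preimages))
  from-lincomb (false ∷ c) (b ∷ bs) = from-lincomb c bs

  preimage-isSubspace : ∀ {k} (K : Gr v k) → IsSubspace v k (mem K ∘ to)
  preimage-isSubspace K = map from (basis K) , independent , λ x → mk⇔
    (λ p → coords K (to x) , trans (from-lincomb (coords K (to x)) (basis K))
      (trans (cong from (trans (lincomb-basis K _) (emb-coords K (to x) p))) (from-to x)))
    (λ { (c , refl) → trans (cong (mem K) (trans (cong to (from-lincomb c (basis K))) (trans (to-from _) (lincomb-basis K c)))) (mem-emb K c) })
    where
    independent : LinIndep (map from (basis K))
    independent c e = LinIndep-basis K c (trans (sym (to-from _)) (trans (cong to (trans (sym (from-lincomb c (basis K))) e)) (lincomb-0 images)))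

  -- The preimage of K is only ever used through its points, so its canonical form is sealed against
  -- unfolding.
  abstract
    pull : ∀ {k} → Gr v k → Gr v k
    pull K = proj₁ (subspace⇒Gr (preimage-isSubspace K))

    mem-pull : ∀ {k} (K : Gr v k) x → mem (pull K) x ≡ mem K (to x)
    mem-pull K = proj₂ (subspace⇒Gr (preimage-isSubspace K))

  allIn-pull : ∀ {k n} (xs : Vec (Pt v) n) (K : Gr v k) → allIn (map to xs) K ≡ allIn xs (pull K)
  allIn-pull []       K = refl
  allIn-pull (x ∷ xs) K = cong₂ _∧_ (sym (mem-pull K x)) (allIn-pull xs K)

  ∑-pull-points : ∀ {k} (K : Gr v k) (ψ : Pt v → ℕ) →
    ∑ (allVec v) (λ y → 𝟙 (mem K y) * ψ y) ≡ ∑ (allVec v) (λ y → 𝟙 (mem (pull K) y) * ψ (to y))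
  ∑-pull-points K ψ = trans (sym (∑-bijection (allVec-unique v) ∈-allVec to from to-from from-to (λ y → 𝟙 (mem K y) * ψ y)))
    (∑-cong (allVec v) (λ y → cong (λ z → 𝟙 z * ψ (to y)) (sym (mem-pull K y))))

inverse : ∀ {v} → Automorphism v → Automorphism v
inverse g = record { images = preimages ; preimages = images ; to-from = from-to ; from-to = to-from }
  where open Automorphism g

module _ {v k : ℕ} (g : Automorphism v) where
  open Automorphism g
  open Automorphism (inverse g) using () renaming (pull to push; mem-pull to mem-push)

  pull-push : (K : Gr v k) → pull (push K) ≡ K
  pull-push K = mem-injective _ K (λ x → trans (mem-pull (push K) x) (trans (mem-push K (to x)) (cong (mem K) (from-to x))))

  push-pull : (K : Gr v k) → push (pull K) ≡ K
  push-pull K = mem-injective _ K (λ x → trans (mem-push (pull K) x) (trans (mem-pull K (from x)) (cong (mem K) (to-from x))))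

  ∑-pull : (F : Gr v k → ℕ) → ∑ (allGr v k) (F ∘ pull) ≡ ∑ (allGr v k) F
  ∑-pull F = ∑-bijection (allGr-unique v k) ∈-allGr pull push pull-push push-pull F

-- An automorphism is allowed to permute the colours, by the inverse of π.
record Acts {v k} (c : Gr v k → Fin 3) (g : Automorphism v) : Set where
  field
    π : Fin 3 → Fin 3
    equivariant : ∀ K i → (c K ==ᶠ i) ≡ (c (Automorphism.pull g K) ==ᶠ π i)
    π-onto : ∀ i → ∃ λ j → π j ≡ i

module _ {v k : ℕ} {c : Gr v k → Fin 3} {g : Automorphism v} (act : Acts c g) where
  open Automorphism g
  open Acts act

  -- Reindexing the sum by `pull` trades moving the points for permuting the colours.
  NP-act : ∀ {n} (xs : Vec (Pt v) n) i → NP c (map to xs) i ≡ NP c xs (π i)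
  NP-act xs i = trans (∑-cong (allGr v k) (λ K → cong₂ (λ a b → 𝟙 a * 𝟙 b) (allIn-pull xs K) (equivariant K i)))
    (∑-pull g (λ K → 𝟙 (allIn xs K) * 𝟙 (c K ==ᶠ π i)))

  act-Bal : ∀ {n} (xs : Vec (Pt v) n) → Bal (NP c xs) → Bal (NP c (map to xs))
  act-Bal xs b i j = trans (NP-act xs i) (trans (b (π i) (π j)) (sym (NP-act xs j)))

  act-Bal⁻ : ∀ {n} (xs : Vec (Pt v) n) → Bal (NP c (map to xs)) → Bal (NP c xs)
  act-Bal⁻ xs b i j with π-onto i | π-onto j
  ... | i′ , refl | j′ , refl = trans (sym (NP-act xs i′)) (trans (b i′ j′) (NP-act xs j′))

-- Congruences and arithmetic modulo 3.

module Mod (n : ℕ) .{{_ : NonZero n}} where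

  infix 4 _~_
  _~_ : ℕ → ℕ → Set
  a ~ b = a % n ≡ b % n

  ≡0⇒~0 : ∀ {a} → a % n ≡ 0 → a ~ 0
  ≡0⇒~0 p = trans p (sym (m<n⇒m%n≡m (>-nonZero⁻¹ n)))

  +-~ : ∀ {a b c d} → a ~ b → c ~ d → a + c ~ b + d
  +-~ {a} {b} {c} {d} p q = trans (%-distribˡ-+ a c n) (trans (cong₂ (λ y z → (y + z) % n) p q) (sym (%-distribˡ-+ b d n)))

  *-~ : ∀ {a b c d} → a ~ b → c ~ d → a * c ~ b * d
  *-~ {a} {b} {c} {d} p q = trans (%-distribˡ-* a c n) (trans (cong₂ (λ y z → (y * z) % n) p q) (sym (%-distribˡ-* b d n)))

  %-~ : ∀ a → a % n ~ a
  %-~ a = m%n%n≡m%n a n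

  ∑-~ : {A : Set} (xs : List A) {f g : A → ℕ} → (∀ x → f x ~ g x) → ∑ xs f ~ ∑ xs g
  ∑-~ []       p = refl
  ∑-~ (x ∷ xs) {f} {g} p = +-~ {f x} {g x} (p x) (∑-~ xs p)

≡ᵇ⇒≡′ : ∀ a b → (a ≡ᵇ b) ≡ true → a ≡ b
≡ᵇ⇒≡′ a b p = ≡ᵇ⇒≡ a b (subst T (sym p) _)

cls : ℕ → Fin 3
cls 0 = 0F
cls 1 = 1F
cls _ = 2F

mod3 : ℕ → Fin 3
mod3 n = cls (n % 3)

private
  r<3 : ∀ n → n % 3 ≡ 0 ⊎ n % 3 ≡ 1 ⊎ n % 3 ≡ 2
  r<3 n = go (n % 3) (m%n<n n 3)
    where
    go : ∀ r → r < 3 → r ≡ 0 ⊎ r ≡ 1 ⊎ r ≡ 2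
    go 0 p = inj₁ refl
    go 1 p = inj₂ (inj₁ refl)
    go 2 p = inj₂ (inj₂ refl)
    go (suc (suc (suc _))) (s≤s (s≤s (s≤s ())))

mod3-+ : ∀ a b → mod3 (a + b) ≡ mod3 a ⊞ mod3 b
mod3-+ a b = trans (cong cls (%-distribˡ-+ a b 3)) (cases (a % 3) (b % 3) (m%n<n a 3) (m%n<n b 3))
  where
  cases : ∀ r q → r < 3 → q < 3 → cls ((r + q) % 3) ≡ cls r ⊞ cls q
  cases 0 0 _ _ = refl
  cases 0 1 _ _ = refl
  cases 0 2 _ _ = refl
  cases 1 0 _ _ = refl
  cases 1 1 _ _ = refl
  cases 1 2 _ _ = refl
  cases 2 0 _ _ = refl
  cases 2 1 _ _ = refl
  cases 2 2 _ _ = refl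
  cases (suc (suc (suc _))) _ (s≤s (s≤s (s≤s ()))) _
  cases _ (suc (suc (suc _))) _ (s≤s (s≤s (s≤s ())))

%-%3 : ∀ {N} .{{_ : NonZero N}} → 3 ∣ N → ∀ a b → a % N ≡ b % N → a % 3 ≡ b % 3
%-%3 {N} d a b p = trans (sym (m∣n⇒o%n%m≡o%m 3 N a d)) (trans (cong (_% 3) p) (m∣n⇒o%n%m≡o%m 3 N b d))

neg-neg : ∀ a → neg (neg a) ≡ a
neg-neg 0F = refl
neg-neg 1F = refl
neg-neg 2F = refl

neg-⊞ : ∀ a b → neg (a ⊞ b) ≡ neg a ⊞ neg b
neg-⊞ 0F b  = refl
neg-⊞ 1F 0F = refl
neg-⊞ 1F 1F = refl
neg-⊞ 1F 2F = refl
neg-⊞ 2F 0F = refl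
neg-⊞ 2F 1F = refl
neg-⊞ 2F 2F = refl

==ᶠ-neg : ∀ a i → (neg a ==ᶠ i) ≡ (a ==ᶠ neg i)
==ᶠ-neg 0F 0F = refl
==ᶠ-neg 0F 1F = refl
==ᶠ-neg 0F 2F = refl
==ᶠ-neg 1F 0F = refl
==ᶠ-neg 1F 1F = refl
==ᶠ-neg 1F 2F = refl
==ᶠ-neg 2F 0F = refl
==ᶠ-neg 2F 1F = refl
==ᶠ-neg 2F 2F = refl

⊞-rotate : ∀ a r b → (a ⊞ r) ⊞ b ≡ r ⊞ (a ⊞ b)
⊞-rotate 0F r  b  = refl
⊞-rotate 1F 0F b  = refl
⊞-rotate 2F 0F b  = refl
⊞-rotate 1F 1F 0F = refl
⊞-rotate 1F 1F 1F = refl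
⊞-rotate 1F 1F 2F = refl
⊞-rotate 1F 2F 0F = refl
⊞-rotate 1F 2F 1F = refl
⊞-rotate 1F 2F 2F = refl
⊞-rotate 2F 1F 0F = refl
⊞-rotate 2F 1F 1F = refl
⊞-rotate 2F 1F 2F = refl
⊞-rotate 2F 2F 0F = refl
⊞-rotate 2F 2F 1F = refl
⊞-rotate 2F 2F 2F = refl

==ᶠ-shift : ∀ r a i → ((r ⊞ a) ==ᶠ i) ≡ (a ==ᶠ (neg r ⊞ i))
==ᶠ-shift 0F a  i  = refl
==ᶠ-shift 1F 0F 0F = refl
==ᶠ-shift 1F 0F 1F = refl
==ᶠ-shift 1F 0F 2F = refl
==ᶠ-shift 1F 1F 0F = refl
==ᶠ-shift 1F 1F 1F = refl
==ᶠ-shift 1F 1F 2F = refl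
==ᶠ-shift 1F 2F 0F = refl
==ᶠ-shift 1F 2F 1F = refl
==ᶠ-shift 1F 2F 2F = refl
==ᶠ-shift 2F 0F 0F = refl
==ᶠ-shift 2F 0F 1F = refl
==ᶠ-shift 2F 0F 2F = refl
==ᶠ-shift 2F 1F 0F = refl
==ᶠ-shift 2F 1F 1F = refl
==ᶠ-shift 2F 1F 2F = refl
==ᶠ-shift 2F 2F 0F = refl
==ᶠ-shift 2F 2F 1F = refl
==ᶠ-shift 2F 2F 2F = refl

shift-onto : ∀ r i → neg r ⊞ (r ⊞ i) ≡ i
shift-onto 0F i  = refl
shift-onto 1F 0F = refl
shift-onto 1F 1F = refl
shift-onto 1F 2F = refl
shift-onto 2F 0F = refl
shift-onto 2F 1F = refl
shift-onto 2F 2F = refl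

-- Invariants of subspaces from discrete logarithms.

cube : ℕ → ℕ
cube x = x * (x * x)

cubes-cong : ∀ {x y z x′ y′ z′} → x ≡ x′ → y ≡ y′ → z ≡ z′ → cube x + cube y + cube z ≡ cube x′ + cube y′ + cube z′
cubes-cong refl refl refl = refl

class-shift : ∀ {δ r} j j′ → δ % 3 ≡ r → ((0 + r) % 3 ≡ᵇ j) ≡ (0 ≡ᵇ j′) → ((1 + r) % 3 ≡ᵇ j) ≡ (1 ≡ᵇ j′) → ((2 + r) % 3 ≡ᵇ j) ≡ (2 ≡ᵇ j′) →
  ∀ l → ((l + δ) % 3 ≡ᵇ j) ≡ (l % 3 ≡ᵇ j′)
class-shift {δ} {r} j j′ e p₀ p₁ p₂ l = trans (cong (_≡ᵇ j) (trans (%-distribˡ-+ l δ 3) (cong (λ z → (l % 3 + z) % 3) e))) (cases (r<3 l))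
  where
  at : ∀ x → l % 3 ≡ x → ((x + r) % 3 ≡ᵇ j) ≡ (x ≡ᵇ j′) → ((l % 3 + r) % 3 ≡ᵇ j) ≡ (l % 3 ≡ᵇ j′)
  at x q p = trans (cong (λ z → (z + r) % 3 ≡ᵇ j) q) (trans p (cong (_≡ᵇ j′) (sym q)))
  cases : l % 3 ≡ 0 ⊎ l % 3 ≡ 1 ⊎ l % 3 ≡ 2 → ((l % 3 + r) % 3 ≡ᵇ j) ≡ (l % 3 ≡ᵇ j′)
  cases (inj₁ q)        = at 0 q p₀
  cases (inj₂ (inj₁ q)) = at 1 q p₁
  cases (inj₂ (inj₂ q)) = at 2 q p₂

pick : ℕ → ℕ → ℕ → ℕ
pick j l x = if l % 3 ≡ᵇ j then x else 0

shifts : (N : ℕ) .{{_ : NonZero N}} → ℕ → ℕ → ℕ → Bool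
shifts N δ zero    zero    = true
shifts N δ (suc p) (suc q) = suc q % N ≡ᵇ (suc p + δ) % N
shifts N δ _       _       = false

doubles : (N : ℕ) .{{_ : NonZero N}} → ℕ → ℕ → Bool
doubles N zero    zero    = true
doubles N (suc p) (suc q) = suc q % N ≡ᵇ (2 * suc p) % N
doubles N _       _       = false

-- lg is a discrete logarithm on the nonzero points of GF(2)^8 = GF(256) with values in 1, …, N = 255, and lg 0 = 0;
-- ν = N - 1 plays the role of -1 modulo N.
module Colouring {v : ℕ} (N ν : ℕ) .{{_ : NonZero N}} (3∣N : 3 ∣ N) (lg : Pt v → ℕ) (lg-0 : ∀ y → (lg y ≡ᵇ 0) ≡ (y ==ᵛ 0V))
  (m half : ℕ) .{{_ : NonZero m}} (m-odd : m ≡ suc (half + half))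
  (h : ℕ → ℕ) (h-odd : ∀ e → (h ((2 * (e % N)) % N) + h (e % N)) % m ≡ 0) where

  open Mod N using () renaming (_~_ to _≈_; +-~ to +-≈; *-~ to *-≈; %-~ to %-≈; ∑-~ to ∑-≈; ≡0⇒~0 to ≡0⇒≈0)
  open Mod m

  U : ∀ {k} → Gr v k → (Pt v → ℕ) → ℕ
  U K ψ = ∑ (allVec v) (λ y → 𝟙 (mem K y) * ψ y)

  logSum : ∀ {k} → Gr v k → ℕ
  logSum K = U K lg

  -- The argument of `h` is a l - s modulo N, with s the sum of the logarithms. Adding δ to every
  -- logarithm adds δ (2^k - 1) to s, so the argument is unchanged when δ (a - (2^k - 1)) vanishes
  -- modulo N; doubling all logarithms doubles it.
  term : ℕ → ℕ → ℕ → ℕ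
  term a s zero    = 0
  term a s (suc l) = h ((a * suc l + ν * s) % N)

  part : ∀ {k} → ℕ → Gr v k → ℕ → ℕ
  part a K j = U K (λ y → pick j (lg y) (term a (logSum K) (lg y)))

  -- Multiplication by a field element permutes the three parts cyclically, and the Frobenius map exchanges two of
  -- them and changes all signs modulo m; hence the sum of the cubes is invariant up to sign.
  cubes : (ℕ → ℕ) → ℕ
  cubes u = cube (u 0) + cube (u 1) + cube (u 2)

  key : ∀ {k} → ℕ → Gr v k → ℕ
  key a K = cubes (part a K) % m

  -- Extends a table on 0, ..., `half` to an odd function from residues modulo m to colours, because
  -- the Frobenius map changes the sign of the key and is to negate the colour.
  oddly : (ℕ → ℕ) → ℕ → Fin 3
  oddly t d = if d ≤ᵇ half then cls (t d) else neg (cls (t (m ∸ d)))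

  U-cong : ∀ {k} (K : Gr v k) {ψ χ : Pt v → ℕ} → (∀ y → ψ y ≡ χ y) → U K ψ ≡ U K χ
  U-cong K p = ∑-cong (allVec v) (λ y → cong (𝟙 (mem K y) *_) (p y))

  U-+ : ∀ {k} (K : Gr v k) (ψ χ : Pt v → ℕ) → U K (λ y → ψ y + χ y) ≡ U K ψ + U K χ
  U-+ K ψ χ = trans (∑-cong (allVec v) (λ y → *-distribˡ-+ (𝟙 (mem K y)) (ψ y) (χ y))) (∑-+ (allVec v) _ _)

  U-* : ∀ {k} (K : Gr v k) c (ψ : Pt v → ℕ) → U K (λ y → c * ψ y) ≡ c * U K ψ
  U-* K c ψ = trans (∑-cong (allVec v) (λ y → mid (𝟙 (mem K y)) c (ψ y))) (∑-* c (allVec v) _)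
    where
    mid : ∀ a b c → a * (b * c) ≡ b * (a * c)
    mid = solve-∀

  nonzero : ℕ → ℕ
  nonzero zero    = 0
  nonzero (suc _) = 1

  U-nonzero : ∀ {k} (K : Gr v k) → U K (nonzero ∘ lg) + 1 ≡ 2 ^ k
  U-nonzero {k} K = begin
    U K (nonzero ∘ lg) + 1                                ≡⟨ cong (U K (nonzero ∘ lg) +_) (sym (trans (∑-cong (allVec v) at-0) (∑-unit (0V {v})))) ⟩
    U K (nonzero ∘ lg) + U K (λ y → 𝟙 (y ==ᵛ 0V))         ≡⟨ sym (U-+ K _ _) ⟩
    U K (λ y → nonzero (lg y) + 𝟙 (y ==ᵛ 0V))             ≡⟨ U-cong K one ⟩
    U K (λ _ → 1)                                         ≡⟨ ∑-points K 1 ⟩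
    2 ^ k * 1                                             ≡⟨ *-identityʳ (2 ^ k) ⟩
    2 ^ k                                                 ∎
    where
    open ≡-Reasoning
    at-0 : ∀ y → 𝟙 (mem K y) * 𝟙 (y ==ᵛ 0V) ≡ 𝟙 (y ==ᵛ 0V)
    at-0 y with y ==ᵛ 0V in e
    ... | false = *-zeroʳ (𝟙 (mem K y))
    ... | true  = cong (λ z → 𝟙 z * 1) (trans (cong (mem K) (==ᵛ⇒≡ y 0V e)) (mem-0 K))
    one : ∀ y → nonzero (lg y) + 𝟙 (y ==ᵛ 0V) ≡ 1
    one y = trans (cong (λ z → nonzero (lg y) + 𝟙 z) (sym (lg-0 y))) (go (lg y))
      where
      go : ∀ l → nonzero l + 𝟙 (l ≡ᵇ 0) ≡ 1
      go zero    = refl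
      go (suc l) = refl

  private
    pred-2^ : ∀ {a b} → a + 1 ≡ b → a ≡ b ∸ 1
    pred-2^ {a} p = trans (sym (m+n∸n≡m a 1)) (cong (_∸ 1) p)

  points : ℕ → ℕ
  points k = 2 ^ k ∸ 1

  module Shift (g : Automorphism v) (δ : ℕ) (shift : ∀ y → shifts N δ (lg y) (lg (Automorphism.to g y)) ≡ true)
    {k : ℕ} (a : ℕ) (scale : (δ * (a + ν * points k)) % N ≡ 0) where
    open Automorphism g

    logSum-shift : (K : Gr v k) → logSum K ≈ logSum (pull K) + δ * points k
    logSum-shift K = trans (cong (_% N) (∑-pull-points K lg)) (trans (∑-≈ (allVec v) (λ y → *-≈ {𝟙 (mem (pull K) y)} refl (point y)))
      (cong (_% N) (trans (U-+ (pull K) lg _) (cong (logSum (pull K) +_) (trans (U-* (pull K) δ (nonzero ∘ lg)) (cong (δ *_) (pred-2^ (U-nonzero (pull K)))))))))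
      where
      point : ∀ y → lg (to y) ≈ lg y + δ * nonzero (lg y)
      point y with lg y | lg (to y) | shift y
      ... | zero  | zero  | _ = cong (_% N) (sym (*-zeroʳ δ))
      ... | suc p | suc q | e = trans (≡ᵇ⇒≡′ _ _ e) (cong (λ z → (suc p + z) % N) (sym (*-identityʳ δ)))

    term-shift : (K : Gr v k) → ∀ j y → pick j (lg (to y)) (term a (logSum K) (lg (to y))) ≡ pick j (lg y + δ) (term a (logSum (pull K)) (lg y))
    term-shift K j y with lg y | lg (to y) | shift y
    ... | zero  | zero  | _ with δ % 3 ≡ᵇ j
    ...   | true  = if-same (0 ≡ᵇ j)
      where
      if-same : ∀ b → (if b then 0 else 0) ≡ 0
      if-same true  = refl
      if-same false = refl
    ...   | false = if-same (0 ≡ᵇ j)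
      where
      if-same : ∀ b → (if b then 0 else 0) ≡ 0
      if-same true  = refl
      if-same false = refl
    term-shift K j y | suc p | suc q | e = cong₂ (λ b x → if b then x else 0)
      (cong (_≡ᵇ j) (%-%3 3∣N (suc q) (suc p + δ) (≡ᵇ⇒≡′ _ _ e))) (cong h aligned)
      where
      s′ = logSum (pull K)
      rearrange : ∀ ν a p δ s c → a * (p + δ) + ν * (s + δ * c) ≡ (a * p + ν * s) + δ * (a + ν * c)
      rearrange = solve-∀
      aligned : (a * suc q + ν * logSum K) % N ≡ (a * suc p + ν * s′) % N
      aligned = trans (+-≈ {a * suc q} {a * (suc p + δ)} (*-≈ {a} refl (≡ᵇ⇒≡′ _ _ e)) (*-≈ {ν} refl (logSum-shift K)))
        (trans (cong (_% N) (rearrange ν a (suc p) δ s′ (points k)))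
        (trans (+-≈ {a * suc p + ν * s′} {a * suc p + ν * s′} {δ * (a + ν * points k)} {0} refl (≡0⇒≈0 {δ * (a + ν * points k)} scale)) (cong (_% N) (+-identityʳ (a * suc p + ν * s′)))))

    part′ : Gr v k → ℕ → ℕ
    part′ K j = U (pull K) (λ y → pick j (lg y + δ) (term a (logSum (pull K)) (lg y)))

    part-shift : (K : Gr v k) → ∀ j → part a K j ≡ part′ K j
    part-shift K j = trans (∑-pull-points K _) (U-cong (pull K) (term-shift K j))

    private
      re-class : (K : Gr v k) → ∀ j j′ → (∀ l → ((l + δ) % 3 ≡ᵇ j) ≡ (l % 3 ≡ᵇ j′)) → part′ K j ≡ part a (pull K) j′
      re-class K j j′ p = U-cong (pull K) (λ y → cong (λ b → if b then term a (logSum (pull K)) (lg y) else 0) (p (lg y)))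

    cubes-shift : (K : Gr v k) → cubes (part a K) ≡ cubes (part a (pull K))
    cubes-shift K = trans (cubes-cong (part-shift K 0) (part-shift K 1) (part-shift K 2)) (cases (r<3 δ))
      where
      u = part a (pull K)
      class : ∀ j j′ r → δ % 3 ≡ r → ((0 + r) % 3 ≡ᵇ j) ≡ (0 ≡ᵇ j′) → ((1 + r) % 3 ≡ᵇ j) ≡ (1 ≡ᵇ j′) → ((2 + r) % 3 ≡ᵇ j) ≡ (2 ≡ᵇ j′) →
        part′ K j ≡ u j′
      class j j′ r e p q s = re-class K j j′ (class-shift j j′ e p q s)
      cases : δ % 3 ≡ 0 ⊎ δ % 3 ≡ 1 ⊎ δ % 3 ≡ 2 → cubes (part′ K) ≡ cubes u
      cases (inj₁ e)        = cubes-cong (class 0 0 0 e refl refl refl) (class 1 1 0 e refl refl refl) (class 2 2 0 e refl refl refl)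
      cases (inj₂ (inj₁ e)) = trans (cubes-cong (class 0 2 1 e refl refl refl) (class 1 0 1 e refl refl refl) (class 2 1 1 e refl refl refl))
        (cyc (cube (u 0)) (cube (u 1)) (cube (u 2)))
        where
        cyc : ∀ x y z → z + x + y ≡ x + y + z
        cyc = solve-∀
      cases (inj₂ (inj₂ e)) = trans (cubes-cong (class 0 1 2 e refl refl refl) (class 1 2 2 e refl refl refl) (class 2 0 2 e refl refl refl))
        (cyc (cube (u 0)) (cube (u 1)) (cube (u 2)))
        where
        cyc : ∀ x y z → y + z + x ≡ x + y + z
        cyc = solve-∀

    key-shift : (K : Gr v k) → key a K ≡ key a (pull K)
    key-shift K = cong (_% m) (cubes-shift K)

  module Double (g : Automorphism v) (double : ∀ y → doubles N (lg y) (lg (Automorphism.to g y)) ≡ true) {k : ℕ} (a : ℕ) where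
    open Automorphism g

    logSum-double : (K : Gr v k) → logSum K ≈ 2 * logSum (pull K)
    logSum-double K = trans (cong (_% N) (∑-pull-points K lg)) (trans (∑-≈ (allVec v) (λ y → *-≈ {𝟙 (mem (pull K) y)} refl (point y)))
      (cong (_% N) (U-* (pull K) 2 lg)))
      where
      point : ∀ y → lg (to y) ≈ 2 * lg y
      point y with lg y | lg (to y) | double y
      ... | zero  | zero  | _ = refl
      ... | suc p | suc q | e = ≡ᵇ⇒≡′ _ _ e

    dbl : ℕ → ℕ
    dbl 1 = 2
    dbl 2 = 1
    dbl j = j

    term-double : (K : Gr v k) → ∀ j → j < 3 → ∀ y →
      pick j (lg (to y)) (term a (logSum K) (lg (to y))) + pick (dbl j) (lg y) (term a (logSum (pull K)) (lg y)) ~ 0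
    term-double K j j<3 y with lg y | lg (to y) | double y
    ... | zero  | zero  | _ = cong (_% m) (none (0 ≡ᵇ j) (0 ≡ᵇ dbl j))
      where
      none : ∀ b c → (if b then 0 else 0) + (if c then 0 else 0) ≡ 0
      none true  true  = refl
      none true  false = refl
      none false true  = refl
      none false false = refl
    ... | suc p | suc q | e = trans (cong (λ b → ((if b then h ((a * suc q + ν * logSum K) % N) else 0) + pick (dbl j) (suc p) (h (d % N))) % m) same-class)
      (both (suc p % 3 ≡ᵇ dbl j))
      where
      d = a * suc p + ν * logSum (pull K)
      rearrange : ∀ ν a p s → a * (2 * p) + ν * (2 * s) ≡ 2 * (a * p + ν * s)
      rearrange = solve-∀
      aligned : (a * suc q + ν * logSum K) % N ≡ (2 * (d % N)) % N
      aligned = trans (+-≈ {a * suc q} {a * (2 * suc p)} (*-≈ {a} refl (≡ᵇ⇒≡′ _ _ e)) (*-≈ {ν} refl (logSum-double K)))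
        (trans (cong (_% N) (rearrange ν a (suc p) (logSum (pull K)))) (*-≈ {2} {2} {d} {d % N} refl (sym (%-≈ d))))
      both : ∀ b → (if b then h ((a * suc q + ν * logSum K) % N) else 0) + (if b then h (d % N) else 0) ~ 0
      both false = refl
      both true  = trans (cong (λ z → (h z + h (d % N)) % m) aligned) (≡0⇒~0 (h-odd d))
      same-class : (suc q % 3 ≡ᵇ j) ≡ (suc p % 3 ≡ᵇ dbl j)
      same-class = trans (cong (_≡ᵇ j) (trans (%-%3 3∣N (suc q) (2 * suc p) (≡ᵇ⇒≡′ _ _ e)) (%-distribˡ-* 2 (suc p) 3))) (cases j j<3 (suc p % 3) (m%n<n (suc p) 3))
        where
        cases : ∀ j → j < 3 → ∀ r → r < 3 → ((2 * r) % 3 ≡ᵇ j) ≡ (r ≡ᵇ dbl j)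
        cases 0 _ 0 _ = refl
        cases 0 _ 1 _ = refl
        cases 0 _ 2 _ = refl
        cases 1 _ 0 _ = refl
        cases 1 _ 1 _ = refl
        cases 1 _ 2 _ = refl
        cases 2 _ 0 _ = refl
        cases 2 _ 1 _ = refl
        cases 2 _ 2 _ = refl
        cases (suc (suc (suc _))) (s≤s (s≤s (s≤s ()))) _ _
        cases _ _ (suc (suc (suc _))) (s≤s (s≤s (s≤s ())))

    part-double : (K : Gr v k) → ∀ j → j < 3 → part a K j + part a (pull K) (dbl j) ~ 0
    part-double K j j<3 = trans (cong (λ z → (z + part a (pull K) (dbl j)) % m) (∑-pull-points K _))
      (trans (cong (_% m) (sym (U-+ (pull K) _ _)))
      (trans (∑-~ (allVec v) (λ y → *-~ {𝟙 (mem (pull K) y)} refl (term-double K j j<3 y)))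
             (cong (_% m) (trans (∑-cong (allVec v) (λ y → *-zeroʳ (𝟙 (mem (pull K) y)))) (∑-0 (allVec v))))))

    -- The factorisation of u³ + v³ by u + v; the multiple (u + v) u v is added on both sides so
    -- that no subtraction occurs.
    cube-odd : ∀ u v → u + v ~ 0 → cube u + cube v ~ 0
    cube-odd u v p = trans (cong (_% m) (sym (+-identityʳ (cube u + cube v))))
      (trans (+-~ {cube u + cube v} {cube u + cube v} {0} {(u + v) * (u * v)} refl (sym (*-~ {u + v} {0} {u * v} p refl)))
      (trans (cong (_% m) (factor u v)) (*-~ {u + v} {0} {u * u + v * v} p refl)))
      where
      factor : ∀ u v → u * (u * u) + v * (v * v) + (u + v) * (u * v) ≡ (u + v) * (u * u + v * v)
      factor = solve-∀

    key-double : (K : Gr v k) → key a K + key a (pull K) ~ 0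
    key-double K = trans (+-~ {key a K} {cubes (part a K)} (%-~ (cubes (part a K))) (%-~ (cubes (part a (pull K)))))
      (trans (cong (_% m) (regroup (cube (u 0)) (cube (u 1)) (cube (u 2)) (cube (u′ 0)) (cube (u′ 1)) (cube (u′ 2))))
      (+-~ {(cube (u 0) + cube (u′ 0)) + (cube (u 1) + cube (u′ 2))} {0}
        (+-~ {cube (u 0) + cube (u′ 0)} {0} (cube-odd (u 0) (u′ 0) (part-double K 0 (s≤s z≤n))) (cube-odd (u 1) (u′ 2) (part-double K 1 (s≤s (s≤s z≤n)))))
        (cube-odd (u 2) (u′ 1) (part-double K 2 (s≤s (s≤s (s≤s z≤n)))))))
      where
      u  = part a K
      u′ = part a (pull K)
      regroup : ∀ a b c x y z → a + b + c + (x + y + z) ≡ (a + x) + (b + z) + (c + y)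
      regroup = solve-∀

  -- Two residues with sum divisible by m add up to 0 or to m. If to m, exactly one of them is at
  -- most `half`, as m is odd; if to 0, both are 0 and the colour must be its own negative, hence t
  -- 0 = 0.
  oddly-odd : ∀ t d d′ → t 0 ≡ 0 → d < m → d′ < m → (d + d′) % m ≡ 0 → oddly t d ≡ neg (oddly t d′)
  oddly-odd t d d′ t0 d<m d′<m p = cases (m%n≡0⇒n∣m (d + d′) m p)
    where
    opposite : d + d′ ≡ m → oddly t d ≡ neg (oddly t d′)
    opposite e with d ≤ᵇ half in p | d′ ≤ᵇ half in q
    ... | true  | true  = contradiction (trans e m-odd) (<⇒≢ (s≤s (+-mono-≤ (≤ᵇ⇒≤ d half (subst T (sym p) _)) (≤ᵇ⇒≤ d′ half (subst T (sym q) _)))))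
    ... | true  | false = sym (trans (neg-neg (cls (t (m ∸ d′)))) (cong (λ z → cls (t z)) (trans (cong (_∸ d′) (sym e)) (m+n∸n≡m d d′))))
    ... | false | true  = cong (λ z → neg (cls (t z))) (trans (cong (_∸ d) (sym e)) (m+n∸m≡n d d′))
    ... | false | false = contradiction (trans (sym m-odd) (sym e)) (<⇒≢ (≤-trans (s≤s (s≤s (+-monoʳ-≤ half ≤-refl)))
      (≤-trans (≤-reflexive (cong suc (sym (+-suc half half)))) (+-mono-≤ (large d p) (large d′ q)))))
      where
      large : ∀ d → (d ≤ᵇ half) ≡ false → half < d
      large d p = ≰⇒> (λ q → subst T p (≤⇒≤ᵇ q))
    cases : m ∣ d + d′ → oddly t d ≡ neg (oddly t d′)
    cases (divides zero e) = trans (cong (oddly t) (m+n≡0⇒m≡0 d e)) (trans at-0 (cong (neg ∘ oddly t) (sym (m+n≡0⇒n≡0 d e))))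
      where
      at-0 : oddly t 0 ≡ neg (oddly t 0)
      at-0 rewrite t0 = refl
    cases (divides 1 e) = opposite (trans e (+-identityʳ m))
    cases (divides (suc (suc q)) e) = contradiction (+-mono-< d<m d′<m) (≤⇒≯ (≤-trans (+-monoʳ-≤ m (m≤m+n m (q * m))) (≤-reflexive (sym e))))

-- Colours that evaluate quickly.

allᵇ : {A : Set} → (A → Bool) → List A → Bool
allᵇ p []       = true
allᵇ p (x ∷ xs) = p x ∧ allᵇ p xs

allᵇ-∈ : {A : Set} (p : A → Bool) {xs : List A} → allᵇ p xs ≡ true → ∀ {x} → x ∈ xs → p x ≡ true
allᵇ-∈ p h (here refl) = ∧-trueˡ h
allᵇ-∈ p {y ∷ ys} h (there q) = allᵇ-∈ p (∧-trueʳ {p y} h) q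

∀-points : ∀ {n} (p : Pt n → Bool) → allᵇ p (allVec n) ≡ true → ∀ x → p x ≡ true
∀-points p h x = allᵇ-∈ p h (∈-allVec x)

spanL : ∀ {v n} → Vec (Pt v) n → List (Pt v)
spanL []       = 0V ∷ []
spanL (b ∷ bs) = spanL bs ++ List.map (b ⊕_) (spanL bs)

∑-spanL : ∀ {v n} (bs : Vec (Pt v) n) (ψ : Pt v → ℕ) → ∑ (spanL bs) ψ ≡ ∑ (allVec n) (λ c → ψ (lincomb c bs))
∑-spanL []       ψ = refl
∑-spanL {n = suc n} (b ∷ bs) ψ = trans (∑-++ (spanL bs) _ ψ) (trans
  (cong₂ _+_ (∑-spanL bs ψ) (trans (∑-map (b ⊕_) (spanL bs) ψ) (∑-spanL bs (ψ ∘ (b ⊕_))))) (sym (∑-allVec n _)))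

∑-span-basis : ∀ {v k} (K : Gr v k) (ψ : Pt v → ℕ) → ∑ (spanL (basis K)) ψ ≡ ∑ (allVec v) (λ y → 𝟙 (mem K y) * ψ y)
∑-span-basis {k = k} K ψ = trans (∑-spanL (basis K) ψ) (trans (∑-cong (allVec k) (λ c → cong ψ (lincomb-basis K c))) (sym (∑-mem K ψ)))

module BaseColour {v : ℕ} (N ν : ℕ) .{{_ : NonZero N}} (3∣N : 3 ∣ N) (lg : Pt v → ℕ) (lg-0 : ∀ y → (lg y ≡ᵇ 0) ≡ (y ==ᵛ 0V))
  (m half : ℕ) .{{_ : NonZero m}} (m-odd : m ≡ suc (half + half))
  (h : ℕ → ℕ) (h-odd : ∀ e → (h ((2 * (e % N)) % N) + h (e % N)) % m ≡ 0) where

  open Colouring N ν 3∣N lg lg-0 m half m-odd h h-odd public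

  partL : ℕ → List (ℕ × ℕ) → ℕ
  partL j ts = ∑ ts (λ { (r , x) → if r ≡ᵇ j then x else 0 })

  terms : ℕ → ℕ → List ℕ → List (ℕ × ℕ)
  terms a s = List.map (λ l → l % 3 , term a s l)

  keyL : List (ℕ × ℕ) → ℕ
  keyL ts = (cube (partL 0 ts) + cube (partL 1 ts) + cube (partL 2 ts)) % m

  fromLogs : Bool → ℕ → (ℕ → ℕ) → List ℕ → ℕ → Fin 3
  fromLogs σ a t ls s = (if σ then mod3 s else 0F) ⊞ oddly t (keyL (terms a s ls))

  colourFromLogs : Bool → ℕ → (ℕ → ℕ) → List ℕ → Fin 3
  colourFromLogs σ a t ls = fromLogs σ a t ls (∑ ls id)

  -- Lists the 2^k points from a basis, for evaluation, whereas `logSum` and `key` sum over all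
  -- points with a membership test, which suits the symmetry arguments; `baseColour-eq` joins the
  -- two. The flag σ adds the sum of the logarithms modulo 3.
  baseColour : Bool → ℕ → (ℕ → ℕ) → ∀ {k} → Gr v k → Fin 3
  baseColour σ a t K = colourFromLogs σ a t (List.map lg (spanL (basis K)))

  baseColour-eq : ∀ σ a t {k} (K : Gr v k) → baseColour σ a t K ≡ (if σ then mod3 (logSum K) else 0F) ⊞ oddly t (key a K)
  baseColour-eq σ a t K = trans (cong (fromLogs σ a t ls) sum-eq)
    (cong (λ z → (if σ then mod3 (logSum K) else 0F) ⊞ oddly t (z % m)) (cubes-cong (part-eq 0) (part-eq 1) (part-eq 2)))
    where
    ls = List.map lg (spanL (basis K))
    sum-eq : ∑ ls id ≡ logSum K
    sum-eq = trans (∑-map lg (spanL (basis K)) id) (∑-span-basis K lg)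
    part-eq : ∀ j → partL j (terms a (logSum K) ls) ≡ part a K j
    part-eq j = trans (∑-map _ ls _) (trans (∑-map lg (spanL (basis K)) _) (∑-span-basis K _))

  -- The key is fixed, and the leading term grows by δ (2^k - 1) modulo 3, so all colours are
  -- rotated by one constant.
  shift-Acts : ∀ σ a t {k} (g : Automorphism v) δ → (∀ y → shifts N δ (lg y) (lg (Automorphism.to g y)) ≡ true) →
    (δ * (a + ν * points k)) % N ≡ 0 → Acts (baseColour σ a t {k}) g
  shift-Acts σ a t {k} g δ sh sc = record
    { π = neg r ⊞_
    ; equivariant = λ K i → trans (cong (_==ᶠ i) (rotated K)) (==ᶠ-shift r _ i)
    ; π-onto = λ i → r ⊞ i , shift-onto r i }
    where
    open Automorphism g
    open Shift g δ sh {k} a sc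
    r = if σ then mod3 (δ * points k) else 0F
    leading : ∀ σ (K : Gr v k) → (if σ then mod3 (logSum K) else 0F)
      ≡ (if σ then mod3 (logSum (pull K)) else 0F) ⊞ (if σ then mod3 (δ * points k) else 0F)
    leading false K = refl
    leading true  K = trans (cong cls (%-%3 3∣N (logSum K) _ (logSum-shift K))) (mod3-+ (logSum (pull K)) (δ * points k))
    rotated : ∀ K → baseColour σ a t K ≡ r ⊞ baseColour σ a t (pull K)
    rotated K = trans (baseColour-eq σ a t K) (trans (cong₂ _⊞_ (leading σ K) (cong (oddly t) (key-shift K)))
      (trans (⊞-rotate (if σ then mod3 (logSum (pull K)) else 0F) r (oddly t (key a (pull K)))) (cong (r ⊞_) (sym (baseColour-eq σ a t (pull K))))))

  -- Doubling is negation modulo 3, and the key changes sign, so both summands of the colour are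
  -- negated.
  double-Acts : ∀ σ a t {k} (g : Automorphism v) → t 0 ≡ 0 → (∀ y → doubles N (lg y) (lg (Automorphism.to g y)) ≡ true) →
    Acts (baseColour σ a t {k}) g
  double-Acts σ a t {k} g t0 db = record
    { π = neg
    ; equivariant = λ K i → trans (cong (_==ᶠ i) (negated K)) (==ᶠ-neg _ i)
    ; π-onto = λ i → neg i , neg-neg i }
    where
    open Automorphism g
    open Double g db {k} a
    double-neg : ∀ a → a ⊞ a ≡ neg a
    double-neg 0F = refl
    double-neg 1F = refl
    double-neg 2F = refl
    leading : ∀ σ (K : Gr v k) → (if σ then mod3 (logSum K) else 0F) ≡ neg (if σ then mod3 (logSum (pull K)) else 0F)
    leading false K = refl
    leading true  K = trans (cong cls (%-%3 3∣N (logSum K) _ (logSum-double K)))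
      (trans (cong mod3 (cong (logSum (pull K) +_) (+-identityʳ (logSum (pull K))))) (trans (mod3-+ (logSum (pull K)) (logSum (pull K))) (double-neg _)))
    negated : ∀ K → baseColour σ a t K ≡ neg (baseColour σ a t (pull K))
    negated K = trans (baseColour-eq σ a t K) (trans
      (cong₂ _⊞_ (leading σ K) (oddly-odd t (key a K) (key a (pull K)) t0 (m%n<n _ m) (m%n<n _ m) (trans (key-double K) (m<n⇒m%n≡m (m≢0⇒0<m)))))
      (trans (sym (neg-⊞ (if σ then mod3 (logSum (pull K)) else 0F) _)) (cong neg (sym (baseColour-eq σ a t (pull K))))))
      where
      m≢0⇒0<m : 0 < m
      m≢0⇒0<m = subst (0 <_) (sym m-odd) (s≤s z≤n)

-- Certificates for balance over all lines.

count : Fin 3 → List (Fin 3) → ℕ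
count i cs = ∑ cs (λ c → 𝟙 (c ==ᶠ i))

balancedᵇ : List (Fin 3) → Bool
balancedᵇ cs = (count 1F cs ≡ᵇ count 0F cs) ∧ (count 2F cs ≡ᵇ count 0F cs)

balancedᵇ⇒Bal : ∀ cs → balancedᵇ cs ≡ true → Bal (λ i → count i cs)
balancedᵇ⇒Bal cs p i j = trans (to-0 i) (sym (to-0 j))
  where
  to-0 : ∀ i → count i cs ≡ count 0F cs
  to-0 0F = refl
  to-0 1F = ≡ᵇ⇒≡′ _ _ (∧-trueˡ p)
  to-0 2F = ≡ᵇ⇒≡′ _ _ (∧-trueʳ {count 1F cs ≡ᵇ count 0F cs} p)

checkᵇ : ∀ {v k t} → (Gr v k → Fin 3) → Gr v t → Bool
checkᵇ {k = k} c T = balancedᵇ (List.map c (supers T k))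

checkᵇ⇒Bal : ∀ {v k t} (c : Gr v k → Fin 3) (T : Gr v t) → checkᵇ c T ≡ true → Bal (NP c (basis T))
checkᵇ⇒Bal {k = k} c T p = Bal-cong (λ i → trans (sym (N-NP c T i)) (trans (sym (∑-supers T k _)) (sym (∑-map c (supers T k) _))))
  (balancedᵇ⇒Bal (List.map c (supers T k)) p)

module Reduce {v k : ℕ}  (c : Gr v k → Fin 3) (shift₁ shift₁₆ frobenius : Automorphism v)
  (act₁ : Acts c shift₁) (act₁₆ : Acts c shift₁₆) (actφ : Acts c frobenius) where

  Pair : Set
  Pair = Pt v × Pt v

  Q : Pair → Set
  Q (x , y) = Bal (NP c (y ∷ x ∷ []))

  Q-swap : ∀ {x y} → Q (y , x) → Q (x , y)
  Q-swap {x} {y} = Bal-cong (NP-cong c (y ∷ x ∷ []) (x ∷ y ∷ []) (λ K → comm (mem K y) (mem K x)))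
    where
    comm : ∀ a b → a ∧ (b ∧ true) ≡ b ∧ (a ∧ true)
    comm true  true  = refl
    comm true  false = refl
    comm false true  = refl
    comm false false = refl

  Q-add : ∀ {x y} → Q (x , x ⊕ y) → Q (x , y)
  Q-add {x} {y} = Bal-cong (NP-cong c (y ∷ x ∷ []) ((x ⊕ y) ∷ x ∷ []) same)
    where
    back : x ⊕ (x ⊕ y) ≡ y
    back = trans (sym (⊕-assoc x x y)) (trans (cong (_⊕ y) (⊕-self x)) (⊕-identityˡ y))
    same : ∀ (K : Gr v k) → mem K y ∧ (mem K x ∧ true) ≡ mem K (x ⊕ y) ∧ (mem K x ∧ true)
    same K with mem K x in ex | mem K y in ey | mem K (x ⊕ y) in es
    ... | true  | true  | true  = refl
    ... | true  | false | false = refl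
    ... | false | true  | true  = refl
    ... | false | true  | false = refl
    ... | false | false | true  = refl
    ... | false | false | false = refl
    ... | true  | true  | false with () ← trans (sym es) (mem-⊕ K x y ex ey)
    ... | true  | false | true  with () ← trans (sym ey) (trans (cong (mem K) (sym back)) (mem-⊕ K x (x ⊕ y) ex es))

  -- The six ordered bases of the line {x, y, x + y}; all of them impose the same condition `Q`.
  arrange : ℕ → Pair → Pair
  arrange 0 (x , y) = x , y
  arrange 1 (x , y) = y , x
  arrange 2 (x , y) = x ⊕ y , x
  arrange 3 (x , y) = x , x ⊕ y
  arrange 4 (x , y) = y , y ⊕ x
  arrange _ (x , y) = y ⊕ x , y

  Q-arrange : ∀ r p → Q (arrange r p) → Q p
  Q-arrange 0 p q = q
  Q-arrange 1 p q = Q-swap q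
  Q-arrange 2 p q = Q-add (Q-swap q)
  Q-arrange 3 p q = Q-add q
  Q-arrange 4 p q = Q-swap (Q-add q)
  Q-arrange (suc (suc (suc (suc (suc _))))) p q = Q-swap (Q-add (Q-swap q))

  iterate : Automorphism v → ℕ → Pair → Pair
  iterate g zero    p       = p
  iterate g (suc n) (x , y) = iterate g n (Automorphism.to g x , Automorphism.to g y)

  Q-iterate : ∀ {g} → Acts c g → ∀ n p → Q (iterate g n p) → Q p
  Q-iterate act zero    p       q = q
  Q-iterate act (suc n) (x , y) q = act-Bal⁻ act (y ∷ x ∷ []) (Q-iterate act n _ q)

  -- A code packs the index of an orbit representative with the word that carries a pair to it.
  record Word : Set where
    constructor word
    field representative arrangement frobenii small large : ℕ

  -- Mixed radix 64, 8, 8, 16. In the applications `shift₁₆` is the sixteenth power of `shift₁`, so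
  -- an exponent below 256 needs at most 15 + 15 applications.
  decode : ℕ → Word
  decode n = word (n % 64) (n / 64 % 8) (n / 512 % 8) (n / 4096 % 16) (n / 65536)

  reduce : Word → Pair → Pair
  reduce (word _ r j n₁ n₁₆) p = iterate shift₁₆ n₁₆ (iterate shift₁ n₁ (iterate frobenius j (arrange r p)))

  Q-reduce : ∀ w p → Q (reduce w p) → Q p
  Q-reduce (word _ r j n₁ n₁₆) p q = Q-arrange r p (Q-iterate actφ j _ (Q-iterate act₁ n₁ _ (Q-iterate act₁₆ n₁₆ _ q)))

  isBasis : Pair → List (Gr v 2) → ℕ → Bool
  isBasis p       []       n       = false
  isBasis p       (T ∷ Ts) (suc n) = isBasis p Ts n
  isBasis (x , y) (T ∷ Ts) zero    = matches (basis T)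
    where
    matches : Vec (Pt v) 2 → Bool
    matches (b₀ ∷ b₁ ∷ []) = (x ==ᵛ b₀) ∧ (y ==ᵛ b₁)

  covered : List (Gr v 2) → Pair → Word → Bool
  covered Ts p w = isBasis (reduce w p) Ts (Word.representative w)

  trivial : Pair → Bool
  trivial (x , y) = (y ==ᵛ 0V) ∨ (y ==ᵛ x)

  -- The codes run parallel to the list of second points; where the second point is 0 or x the code
  -- is a mere placeholder.
  certified : List (Gr v 2) → Pt v → List ℕ → List (Pt v) → Bool
  certified Ts x ns       []       = true
  certified Ts x []       (y ∷ ys) = false
  certified Ts x (n ∷ ns) (y ∷ ys) = (trivial (x , y) ∨ covered Ts (x , y) (decode n)) ∧ certified Ts x ns ys

  module _ (Ts : List (Gr v 2)) (Ts-ok : allᵇ (checkᵇ c) Ts ≡ true) where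

    Q-isBasis : ∀ p Us n → allᵇ (checkᵇ c) Us ≡ true → isBasis p Us n ≡ true → Q p
    Q-isBasis p       (T ∷ Us) (suc n) ok e = Q-isBasis p Us n (∧-trueʳ {checkᵇ c T} ok) e
    Q-isBasis (x , y) (T ∷ Us) zero    ok e with basis T | checkᵇ⇒Bal c T (∧-trueˡ ok)
    ... | b₀ ∷ b₁ ∷ [] | bal with ==ᵛ⇒≡ x b₀ (∧-trueˡ e) | ==ᵛ⇒≡ y b₁ (∧-trueʳ {x ==ᵛ b₀} e)
    ...   | refl | refl = Q-swap bal

    Q-certified : ∀ x ns ys → certified Ts x ns ys ≡ true → ∀ {y} → y ∈ ys → trivial (x , y) ≡ false → Q (x , y)
    Q-certified x (n ∷ ns) (y ∷ ys) h (there q) nt = Q-certified x ns ys (∧-trueʳ {trivial (x , y) ∨ covered Ts (x , y) (decode n)} h) q nt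
    Q-certified x (n ∷ ns) (y ∷ ys) h (here refl) nt = Q-reduce (decode n) (x , y) (Q-isBasis _ Ts (Word.representative (decode n)) Ts-ok
      (subst (λ b → b ∨ covered Ts (x , y) (decode n) ≡ true) nt (∧-trueˡ h)))

    Base : Set
    Base = Pt v × List ℕ

    isBase : Pt v → List Base → Bool
    isBase x []             = false
    isBase x ((b , _) ∷ bs) = (x ==ᵛ b) ∨ isBase x bs

    certifiedBase : Base → Bool
    certifiedBase (b , ns) = certified Ts b ns (allVec v)

    module _ (lg : Pt v → ℕ) (bases : List Base)
      (bases-ok : allᵇ certifiedBase bases ≡ true) where

      descends : Pt v → Bool
      descends x = (x ==ᵛ 0V) ∨ (isBase x bases ∨ (suc (lg (Automorphism.from shift₁ x)) ≤ᵇ lg x))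

      Q-base : ∀ x (bs : List Base) → allᵇ certifiedBase bs ≡ true → isBase x bs ≡ true → ∀ y → trivial (x , y) ≡ false → Q (x , y)
      Q-base x ((b , ns) ∷ bs) ok e y nt with x ==ᵛ b in eq
      ... | true with refl ← ==ᵛ⇒≡ x b eq = Q-certified x ns (allVec v) (∧-trueˡ ok) (∈-allVec y) nt
      ... | false = Q-base x bs (∧-trueʳ {certifiedBase (b , ns)} ok) e y nt

      module _ (descends-ok : allᵇ descends (allVec v) ≡ true) where

        open Automorphism shift₁ using (to; from; to-from)

        from-injective : ∀ x y → from x ≡ from y → x ≡ y
        from-injective x y e = trans (sym (to-from x)) (trans (cong to e) (to-from y))

        ==ᵛ-from : ∀ x y → (x ==ᵛ y) ≡ false → (from x ==ᵛ from y) ≡ false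
        ==ᵛ-from x y e with from x ==ᵛ from y in p
        ... | false = refl
        ... | true with refl ← from-injective x y (==ᵛ⇒≡ (from x) (from y) p) with () ← trans (sym e) (==ᵛ-refl x)

        ==ᵛ-from-0 : ∀ x → (x ==ᵛ 0V) ≡ false → (from x ==ᵛ 0V) ≡ false
        ==ᵛ-from-0 x e = subst (λ z → (from x ==ᵛ z) ≡ false) (lincomb-0 (Automorphism.preimages shift₁)) (==ᵛ-from x 0V e)

        ∨-falseˡ : ∀ a b → a ∨ b ≡ false → a ≡ false
        ∨-falseˡ false b p = refl
        ∨-falseʳ : ∀ a b → a ∨ b ≡ false → b ≡ false
        ∨-falseʳ false b p = p
        false-∨ : ∀ {a b} → a ≡ false → b ≡ false → a ∨ b ≡ false
        false-∨ refl refl = refl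

        trivial-from : ∀ x y → trivial (x , y) ≡ false → trivial (from x , from y) ≡ false
        trivial-from x y nt = false-∨ (==ᵛ-from-0 y (∨-falseˡ (y ==ᵛ 0V) (y ==ᵛ x) nt)) (==ᵛ-from y x (∨-falseʳ (y ==ᵛ 0V) (y ==ᵛ x) nt))

        -- Dividing by the generator lowers the logarithm of x until x is one of the base points.
        Q-all : ∀ n x y → lg x < n → (x ==ᵛ 0V) ≡ false → trivial (x , y) ≡ false → Q (x , y)
        Q-all (suc n) x y (s≤s lt) x≠0 nt with isBase x bases in eb | ∀-points descends descends-ok x
        ... | true  | _ = Q-base x bases bases-ok eb y nt
        ... | false | d = subst₂ (λ a b → Q (a , b)) (to-from x) (to-from y) (act-Bal act₁ (from y ∷ from x ∷ [])
          (Q-all n (from x) (from y) (≤-trans (≤ᵇ⇒≤ (suc (lg (from x))) (lg x) (subst T (sym (drop x≠0 d)) _)) lt)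
            (==ᵛ-from-0 x x≠0) (trivial-from x y nt)))
          where
          drop : ∀ {a b} → a ≡ false → a ∨ b ≡ true → b ≡ true
          drop refl p = p

        certificate⇒PGood : 2 ≤ k → PGood v k 2 c
        certificate⇒PGood 2≤k = pairs⇒PGood c 2≤k (λ x y x≠0 y≠0 y≠x → Q-all (suc (lg x)) x y ≤-refl x≠0 (false-∨ y≠0 y≠x))

-- Assembly of the base cases and the recursion.

-- Since p < q, the sum q + r cannot equal its residue p, so it is at least p + 6 ≥ 8. Applied to
-- the residues of k and v - k, this is what makes `τ` at least 3.
wrap-around : ∀ p q r → 2 ≤ p → p < q → (q + r) % 6 ≡ p → 8 ≤ q + r
wrap-around p q r 2≤p p<q e with 6 ≤? q + r
... | no  lt = contradiction (subst (q ≤_) (trans (sym (m<n⇒m%n≡m (≰⇒> lt))) e) (m≤m+n q r)) (<⇒≱ p<q)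
... | yes ge = ≤-trans (+-mono-≤ (≤-trans 2≤p (≤-reflexive (sym e))) (*-monoˡ-≤ 6 (m≥n⇒m/n>0 ge))) (≤-reflexive (sym (m≡m%n+[m/n]*n (q + r) 6)))

module Assembly (c₃ : Gr 8 3 → Fin 3) (c₄ : Gr 8 4 → Fin 3) (c₅ : Gr 8 5 → Fin 3)
  (g₃ : PGood 8 3 2 c₃) (g₄ : PGood 8 4 2 c₄) (g₅ : PGood 8 5 2 c₅) where

  -- From v = 8 downwards, a quotient by a point lowers the dimension and restriction to a
  -- hyperplane lowers the codimension, each at the cost of one unit of strength, which is how `τ`
  -- decreases as well. For k = 5 only restriction stays within the table. The default colour serves
  -- where `τ` is 0.
  box : Col
  box {8} {3} K = c₃ K
  box {8} {4} K = c₄ K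
  box {8} {5} K = c₅ K
  box {7} {2} K = c₃ (ov K)
  box {7} {3} K = c₄ (ov K)
  box {7} {4} K = c₅ (ov K)
  box {7} {5} K = residual c₅ K
  box {6} {1} K = c₃ (ov (ov K))
  box {6} {2} K = c₄ (ov (ov K))
  box {6} {3} K = c₅ (ov (ov K))
  box {6} {4} K = residual c₅ (ov K)
  box {6} {5} K = residual (residual c₅) K
  box         K = 0F

  private
    none : ∀ {v k} {c : Gr v k → Fin 3} → IsGood v k 0 c
    none = isGood (λ T ())

    1≤2 : 1 ≤ 2
    1≤2 = s≤s z≤n

    r₅ : PGood 7 5 1 (residual c₅)
    r₅ = residual-PGood g₅

    H₃ : IsGood 7 2 2 (c₃ ∘ ov)
    H₃ = quotient-IsGood ≤-refl (PGood⇒IsGood g₃)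
    H₄ : IsGood 7 3 2 (c₄ ∘ ov)
    H₄ = quotient-IsGood ≤-refl (PGood⇒IsGood g₄)
    H₅ : IsGood 7 4 2 (c₅ ∘ ov)
    H₅ = quotient-IsGood ≤-refl (PGood⇒IsGood g₅)
    R₅ : IsGood 7 5 2 (residual c₅)
    R₅ = PGood⇒IsGood r₅

    cases : ∀ k l → k < 6 → l < 6 → k + l < 9 → IsGood (k + l) k ((k + l) ∸ 5) box
    cases 0 0 _ _ _ = none
    cases 0 1 _ _ _ = none
    cases 0 2 _ _ _ = none
    cases 0 3 _ _ _ = none
    cases 0 4 _ _ _ = none
    cases 0 5 _ _ _ = none
    cases 1 0 _ _ _ = none
    cases 1 1 _ _ _ = none
    cases 1 2 _ _ _ = none
    cases 1 3 _ _ _ = none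
    cases 1 4 _ _ _ = none
    cases 1 5 _ _ _ = quotient-IsGood 1≤2 H₃
    cases 2 0 _ _ _ = none
    cases 2 1 _ _ _ = none
    cases 2 2 _ _ _ = none
    cases 2 3 _ _ _ = none
    cases 2 4 _ _ _ = quotient-IsGood 1≤2 H₄
    cases 2 5 _ _ _ = H₃
    cases 3 0 _ _ _ = none
    cases 3 1 _ _ _ = none
    cases 3 2 _ _ _ = none
    cases 3 3 _ _ _ = quotient-IsGood 1≤2 H₅
    cases 3 4 _ _ _ = H₄
    cases 3 5 _ _ _ = PGood⇒IsGood g₃
    cases 4 0 _ _ _ = none
    cases 4 1 _ _ _ = none
    cases 4 2 _ _ _ = quotient-IsGood 1≤2 R₅
    cases 4 3 _ _ _ = H₅
    cases 4 4 _ _ _ = PGood⇒IsGood g₄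
    cases 5 0 _ _ _ = none
    cases 5 1 _ _ _ = PGood⇒IsGood (residual-PGood r₅)
    cases 5 2 _ _ _ = R₅
    cases 5 3 _ _ _ = PGood⇒IsGood g₅
    cases 4 5 _ _ p = contradiction p (<⇒≱ ≤-refl)
    cases 5 4 _ _ p = contradiction p (<⇒≱ ≤-refl)
    cases 5 5 _ _ p = contradiction p (<⇒≱ (m≤n+m 10 1))
    cases (suc (suc (suc (suc (suc (suc k)))))) l p _ _ = contradiction p (<⇒≱ (s≤s (m≤m+n 6 k)))
    cases k (suc (suc (suc (suc (suc (suc l)))))) _ p _ = contradiction p (<⇒≱ (s≤s (m≤m+n 6 l)))

  box-Good : ∀ v k l → k + l ≡ v → k < 6 → l < 6 → v < 9 → IsGood v k ((k + l) ∸ 5) box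
  box-Good _ k l refl = cases k l

  open Recursion box box-Good

  large-set : ∀ v k → k ≤ v → 2 ≤ v % 6 → v % 6 < k % 6 → LargeSet₂ 3 2 k v
  large-set v k k≤v 2≤v̄ v̄<k̄ = subst (λ v → LargeSet₂ 3 2 k v) k+l≡v
    (Good⇒LargeSet (colour (suc (k + l))) (k + l) k (≤-trans (≤-trans 2≤v̄ (<⇒≤ v̄<k̄)) (m%n≤m k 6)) evenly)
    where
    l = v ∸ k
    k+l≡v : k + l ≡ v
    k+l≡v = m+[n∸m]≡n k≤v
    8≤ : 8 ≤ k % 6 + l % 6
    8≤ = wrap-around (v % 6) (k % 6) (l % 6) 2≤v̄ v̄<k̄ (trans (sym (%-distribˡ-+ k l 6)) (cong (_% 6) k+l≡v))
    evenly : (T : Gr (k + l) 2) → Bal (N {k = k} (colour (suc (k + l))) T)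
    evenly T = colour-Good (suc (k + l)) k l ≤-refl T (∸-monoˡ-≤ 5 8≤) ≤-refl

-- The list of congruences in the theorem amounts to 2 ≤ v mod 6 < k mod 6, the form used by the
-- recursion.
residues : ∀ v k →
  ((v % 6 ≡ 2 × (k % 6 ≡ 3 ⊎ k % 6 ≡ 4 ⊎ k % 6 ≡ 5))
   ⊎ (v % 6 ≡ 3 × (k % 6 ≡ 4 ⊎ k % 6 ≡ 5))
   ⊎ (v % 6 ≡ 4 × k % 6 ≡ 5)) → 2 ≤ v % 6 × v % 6 < k % 6
residues v k (inj₁ (p , inj₁ q))               rewrite p | q = ≤-refl , ≤-refl
residues v k (inj₁ (p , inj₂ (inj₁ q)))        rewrite p | q = ≤-refl , m≤n+m 3 1
residues v k (inj₁ (p , inj₂ (inj₂ q)))        rewrite p | q = ≤-refl , m≤n+m 3 2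
residues v k (inj₂ (inj₁ (p , inj₁ q)))        rewrite p | q = m≤n+m 2 1 , ≤-refl
residues v k (inj₂ (inj₁ (p , inj₂ q)))        rewrite p | q = m≤n+m 2 1 , m≤n+m 4 1
residues v k (inj₂ (inj₂ (p , q)))             rewrite p | q = m≤n+m 2 2 , ≤-refl

-- Data of the base colourings.

pattern O = false
pattern I = true

data Tree : Set where
  leaf : ℕ → Tree
  node : Tree → Tree → Tree

lookupᵛ : ∀ {n} → Tree → Vec Bool n → ℕ
lookupᵛ (leaf x)   _       = x
lookupᵛ (node l r) []      = 0
lookupᵛ (node l r) (O ∷ b) = lookupᵛ l b
lookupᵛ (node l r) (I ∷ b) = lookupᵛ r b

-- Reads binary digits from the lowest and stops at the first leaf, so a tree branches only where
-- keys have to be told apart.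
lookupⁿ : Tree → ℕ → ℕ
branch  : Tree → Tree → ℕ → ℕ → ℕ
lookupⁿ (leaf x)   n = x
lookupⁿ (node l r) n = branch l r (n % 2) (n / 2)
branch l r zero    n = lookupⁿ l n
branch l r (suc _) n = lookupⁿ r n

-- GF(256) = GF(2)[α] / (α⁸ + α⁴ + α³ + α² + 1), with coordinates relative to α, α², …, α⁸.
lg-tree : Tree
lg-tree =
  (node (node (node (node (node (node (node (node (leaf 0) (leaf 8)) (node (leaf 7) (leaf 32))) (node (node (leaf 6) (leaf 56)) (node (leaf 31) (leaf
  204)))) (node (node (node (leaf 5) (leaf 228)) (node (leaf 55) (leaf 109))) (node (node (leaf 30) (leaf 243)) (node (leaf 203) (leaf 80))))) (node
  (node (node (node (leaf 4) (leaf 104)) (node (leaf 227) (leaf 197))) (node (node (leaf 54) (leaf 145)) (node (leaf 108) (leaf 12)))) (node (node (node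
  (leaf 29) (leaf 18)) (node (leaf 242) (leaf 252))) (node (node (leaf 202) (leaf 133)) (node (leaf 79) (leaf 117)))))) (node (node (node (node (node
  (leaf 3) (leaf 141)) (node (leaf 103) (leaf 184))) (node (node (leaf 226) (leaf 150)) (node (leaf 196) (leaf 157)))) (node (node (node (leaf 53) (leaf
  39)) (node (leaf 144) (leaf 42))) (node (node (leaf 107) (leaf 21)) (node (leaf 11) (leaf 231))))) (node (node (node (node (leaf 28) (leaf 50)) (node
  (leaf 17) (leaf 128))) (node (node (leaf 241) (leaf 221)) (node (leaf 251) (leaf 123)))) (node (node (node (leaf 201) (leaf 36)) (node (leaf 132)
  (leaf 188))) (node (node (leaf 78) (leaf 72)) (node (leaf 116) (leaf 169))))))) (node (node (node (node (node (node (leaf 2) (leaf 193)) (node (leaf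
  140) (leaf 68))) (node (node (leaf 102) (leaf 210)) (node (leaf 183) (leaf 96)))) (node (node (node (leaf 225) (leaf 154)) (node (leaf 149) (leaf
  60))) (node (node (leaf 195) (leaf 212)) (node (leaf 156) (leaf 214))))) (node (node (node (node (leaf 52) (leaf 223)) (node (leaf 38) (leaf 74)))
  (node (node (leaf 143) (leaf 152)) (node (leaf 41) (leaf 23)))) (node (node (node (leaf 106) (leaf 147)) (node (leaf 20) (leaf 135))) (node (node
  (leaf 10) (leaf 58)) (node (leaf 230) (leaf 245)))))) (node (node (node (node (node (leaf 27) (leaf 100)) (node (leaf 49) (leaf 165))) (node (node
  (leaf 16) (leaf 208)) (node (leaf 127) (leaf 161)))) (node (node (node (leaf 240) (leaf 181)) (node (leaf 220) (leaf 86))) (node (node (leaf 250)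
  (leaf 94)) (node (leaf 122) (leaf 174))))) (node (node (node (node (leaf 200) (leaf 255)) (node (leaf 35) (leaf 112))) (node (node (leaf 131) (leaf
  191)) (node (leaf 187) (leaf 45)))) (node (node (node (leaf 77) (leaf 138)) (node (leaf 71) (leaf 63))) (node (node (leaf 115) (leaf 66)) (node (leaf
  168) (leaf 89)))))))) (node (node (node (node (node (node (node (leaf 1) (leaf 113)) (node (leaf 192) (leaf 46))) (node (node (leaf 139) (leaf 64))
  (node (leaf 67) (leaf 90)))) (node (node (node (leaf 101) (leaf 166)) (node (leaf 209) (leaf 162))) (node (node (leaf 182) (leaf 87)) (node (leaf 95)
  (leaf 175))))) (node (node (node (node (leaf 224) (leaf 75)) (node (leaf 153) (leaf 24))) (node (node (leaf 148) (leaf 136)) (node (leaf 59) (leaf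
  246)))) (node (node (node (leaf 194) (leaf 69)) (node (leaf 211) (leaf 97))) (node (node (leaf 155) (leaf 61)) (node (leaf 213) (leaf 215)))))) (node
  (node (node (node (node (leaf 51) (leaf 129)) (node (leaf 222) (leaf 124))) (node (node (leaf 37) (leaf 189)) (node (leaf 73) (leaf 170)))) (node
  (node (node (leaf 142) (leaf 185)) (node (leaf 151) (leaf 158))) (node (node (leaf 40) (leaf 43)) (node (leaf 22) (leaf 232))))) (node (node (node
  (node (leaf 105) (leaf 198)) (node (leaf 146) (leaf 13))) (node (node (leaf 19) (leaf 253)) (node (leaf 134) (leaf 118)))) (node (node (node (leaf 9)
  (leaf 33)) (node (leaf 57) (leaf 205))) (node (node (leaf 229) (leaf 110)) (node (leaf 244) (leaf 81))))))) (node (node (node (node (node (node (leaf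
  26) (leaf 248)) (node (leaf 99) (leaf 217))) (node (node (leaf 48) (leaf 92)) (node (leaf 164) (leaf 177)))) (node (node (node (leaf 15) (leaf 120))
  (node (leaf 207) (leaf 83))) (node (node (leaf 126) (leaf 172)) (node (leaf 160) (leaf 234))))) (node (node (node (node (leaf 239) (leaf 238)) (node
  (leaf 180) (leaf 237))) (node (node (leaf 219) (leaf 179)) (node (leaf 85) (leaf 236)))) (node (node (node (leaf 249) (leaf 218)) (node (leaf 93)
  (leaf 178))) (node (node (leaf 121) (leaf 84)) (node (leaf 173) (leaf 235)))))) (node (node (node (node (node (leaf 199) (leaf 14)) (node (leaf 254)
  (leaf 119))) (node (node (leaf 34) (leaf 206)) (node (leaf 111) (leaf 82)))) (node (node (node (leaf 130) (leaf 125)) (node (leaf 190) (leaf 171)))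
  (node (node (leaf 186) (leaf 159)) (node (leaf 44) (leaf 233))))) (node (node (node (node (leaf 76) (leaf 25)) (node (leaf 137) (leaf 247))) (node
  (node (leaf 70) (leaf 98)) (node (leaf 62) (leaf 216)))) (node (node (node (leaf 114) (leaf 47)) (node (leaf 65) (leaf 91))) (node (node (leaf 167)
  (leaf 163)) (node (leaf 88) (leaf 176)))))))))

lg : Pt 8 → ℕ
lg = lookupᵛ lg-tree

lg-0 : ∀ y → (lg y ≡ᵇ 0) ≡ (y ==ᵛ 0V)
lg-0 y = ==⇒≡ _ _ (∀-points (λ y → (lg y ≡ᵇ 0) == (y ==ᵛ 0V)) refl y)

-- A random function with h (2 d) = - h d modulo 65521, chosen such that key separates the orbits of k-subspaces up to sign.
h-tree : Tree
h-tree =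
  (node (node (node (node (node (node (node (node (leaf 0) (leaf 44299)) (node (leaf 21222) (leaf 62119))) (node (node (leaf 44299) (leaf 55635)) (node
  (leaf 3402) (leaf 39646)))) (node (node (node (leaf 21222) (leaf 42659)) (node (leaf 9886) (leaf 4747))) (node (node (leaf 62119) (leaf 3164)) (node
  (leaf 25875) (leaf 53823))))) (node (node (node (node (leaf 44299) (leaf 30402)) (node (leaf 22862) (leaf 61720))) (node (node (leaf 55635) (leaf
  41556)) (node (leaf 60774) (leaf 32266)))) (node (node (node (leaf 3402) (leaf 59353)) (node (leaf 62357) (leaf 5903))) (node (node (leaf 39646) (leaf
  27328)) (node (leaf 11698) (leaf 51451)))))) (node (node (node (node (node (leaf 21222) (leaf 22862)) (node (leaf 35119) (leaf 6168))) (node (node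
  (leaf 42659) (leaf 63064)) (node (leaf 3801) (leaf 59889)))) (node (node (node (leaf 9886) (leaf 2457)) (node (leaf 23965) (leaf 5944))) (node (node
  (leaf 4747) (leaf 27405)) (node (leaf 33255) (leaf 3873))))) (node (node (node (node (leaf 62119) (leaf 61720)) (node (leaf 6168) (leaf 15772))) (node
  (node (leaf 3164) (leaf 28419)) (node (leaf 59618) (leaf 27821)))) (node (node (node (leaf 25875) (leaf 5632)) (node (leaf 38193) (leaf 36113))) (node
  (node (leaf 53823) (leaf 4578)) (node (leaf 14070) (leaf 54188))))))) (node (node (node (node (node (node (leaf 44299) (leaf 55635)) (node (leaf
  42659) (leaf 3164))) (node (node (leaf 30402) (leaf 41556)) (node (leaf 59353) (leaf 27328)))) (node (node (node (leaf 22862) (leaf 63064)) (node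
  (leaf 2457) (leaf 27405))) (node (node (leaf 61720) (leaf 28419)) (node (leaf 5632) (leaf 4578))))) (node (node (node (node (leaf 55635) (leaf 41556))
  (node (leaf 63064) (leaf 28419))) (node (node (leaf 41556) (leaf 28464)) (node (leaf 59577) (leaf 57408)))) (node (node (node (leaf 60774) (leaf
  59577)) (node (leaf 38116) (leaf 3429))) (node (node (leaf 32266) (leaf 57408)) (node (leaf 61648) (leaf 50891)))))) (node (node (node (node (node
  (leaf 3402) (leaf 60774)) (node (leaf 3801) (leaf 59618))) (node (node (leaf 59353) (leaf 59577)) (node (leaf 49749) (leaf 29408)))) (node (node (node
  (leaf 62357) (leaf 38116)) (node (leaf 37102) (leaf 62092))) (node (node (leaf 5903) (leaf 3429)) (node (leaf 37700) (leaf 41328))))) (node (node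
  (node (node (leaf 39646) (leaf 32266)) (node (leaf 59889) (leaf 27821))) (node (node (leaf 27328) (leaf 57408)) (node (leaf 29408) (leaf 24402))))
  (node (node (node (leaf 11698) (leaf 61648)) (node (leaf 60943) (leaf 24193))) (node (node (leaf 51451) (leaf 50891)) (node (leaf 11333) (leaf
  27314)))))))) (node (node (node (node (node (node (node (leaf 21222) (leaf 3402)) (node (leaf 9886) (leaf 25875))) (node (node (leaf 22862) (leaf
  60774)) (node (leaf 62357) (leaf 11698)))) (node (node (node (leaf 35119) (leaf 3801)) (node (leaf 23965) (leaf 33255))) (node (node (leaf 6168) (leaf
  59618)) (node (leaf 38193) (leaf 14070))))) (node (node (node (node (leaf 42659) (leaf 59353)) (node (leaf 2457) (leaf 5632))) (node (node (leaf
  63064) (leaf 59577)) (node (leaf 38116) (leaf 61648)))) (node (node (node (leaf 3801) (leaf 49749)) (node (leaf 37102) (leaf 37700))) (node (node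
  (leaf 59889) (leaf 29408)) (node (leaf 60943) (leaf 11333)))))) (node (node (node (node (node (leaf 9886) (leaf 62357)) (node (leaf 23965) (leaf
  38193))) (node (node (leaf 2457) (leaf 38116)) (node (leaf 37102) (leaf 60943)))) (node (node (node (leaf 23965) (leaf 37102)) (node (leaf 37057)
  (leaf 8113))) (node (node (leaf 5944) (leaf 62092)) (node (leaf 8113) (leaf 14630))))) (node (node (node (node (leaf 4747) (leaf 5903)) (node (leaf
  5944) (leaf 36113))) (node (node (leaf 27405) (leaf 3429)) (node (leaf 62092) (leaf 24193)))) (node (node (node (leaf 33255) (leaf 37700)) (node (leaf
  8113) (leaf 41119))) (node (node (leaf 3873) (leaf 41328)) (node (leaf 14630) (leaf 38207))))))) (node (node (node (node (node (node (leaf 62119)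
  (leaf 39646)) (node (leaf 4747) (leaf 53823))) (node (node (leaf 61720) (leaf 32266)) (node (leaf 5903) (leaf 51451)))) (node (node (node (leaf 6168)
  (leaf 59889)) (node (leaf 5944) (leaf 3873))) (node (node (leaf 15772) (leaf 27821)) (node (leaf 36113) (leaf 54188))))) (node (node (node (node (leaf
  3164) (leaf 27328)) (node (leaf 27405) (leaf 4578))) (node (node (leaf 28419) (leaf 57408)) (node (leaf 3429) (leaf 50891)))) (node (node (node (leaf
  59618) (leaf 29408)) (node (leaf 62092) (leaf 41328))) (node (node (leaf 27821) (leaf 24402)) (node (leaf 24193) (leaf 27314)))))) (node (node (node
  (node (node (leaf 25875) (leaf 11698)) (node (leaf 33255) (leaf 14070))) (node (node (leaf 5632) (leaf 61648)) (node (leaf 37700) (leaf 11333))))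
  (node (node (node (leaf 38193) (leaf 60943)) (node (leaf 8113) (leaf 14630))) (node (node (leaf 36113) (leaf 24193)) (node (leaf 41119) (leaf
  38207))))) (node (node (node (node (leaf 53823) (leaf 51451)) (node (leaf 3873) (leaf 54188))) (node (node (leaf 4578) (leaf 50891)) (node (leaf
  41328) (leaf 27314)))) (node (node (node (leaf 14070) (leaf 11333)) (node (leaf 14630) (leaf 38207))) (node (node (leaf 54188) (leaf 27314)) (leaf
  38207))))))))

h : ℕ → ℕ
h = lookupⁿ h-tree

h-odd : ∀ e → (h ((2 * (e % 255)) % 255) + h (e % 255)) % 65521 ≡ 0
h-odd e = ≡ᵇ⇒≡′ _ 0 (allᵇ-∈ (λ e → (h ((2 * e) % 255) + h e) % 65521 ≡ᵇ 0) {upTo 255} refl (∈-upTo⁺ (m%n<n e 255)))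

-- 255 = 3 · 85 is the order of the multiplicative group, 254 stands for -1, and 65521 = 2 · 32760 +
-- 1 is the largest prime below 2^16.
open BaseColour 255 254 (divides 85 refl) lg lg-0 65521 32760 refl h h-odd

×α-images ×α-preimages : Vec (Pt 8) 8
×α-images =
  (O ∷ I ∷ O ∷ O ∷ O ∷ O ∷ O ∷ O ∷ []) ∷
  (O ∷ O ∷ I ∷ O ∷ O ∷ O ∷ O ∷ O ∷ []) ∷
  (O ∷ O ∷ O ∷ I ∷ O ∷ O ∷ O ∷ O ∷ []) ∷
  (O ∷ O ∷ O ∷ O ∷ I ∷ O ∷ O ∷ O ∷ []) ∷
  (O ∷ O ∷ O ∷ O ∷ O ∷ I ∷ O ∷ O ∷ []) ∷
  (O ∷ O ∷ O ∷ O ∷ O ∷ O ∷ I ∷ O ∷ []) ∷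
  (O ∷ O ∷ O ∷ O ∷ O ∷ O ∷ O ∷ I ∷ []) ∷
  (I ∷ O ∷ I ∷ I ∷ I ∷ O ∷ O ∷ O ∷ []) ∷ []
×α-preimages =
  (O ∷ I ∷ I ∷ I ∷ O ∷ O ∷ O ∷ I ∷ []) ∷
  (I ∷ O ∷ O ∷ O ∷ O ∷ O ∷ O ∷ O ∷ []) ∷
  (O ∷ I ∷ O ∷ O ∷ O ∷ O ∷ O ∷ O ∷ []) ∷
  (O ∷ O ∷ I ∷ O ∷ O ∷ O ∷ O ∷ O ∷ []) ∷
  (O ∷ O ∷ O ∷ I ∷ O ∷ O ∷ O ∷ O ∷ []) ∷
  (O ∷ O ∷ O ∷ O ∷ I ∷ O ∷ O ∷ O ∷ []) ∷
  (O ∷ O ∷ O ∷ O ∷ O ∷ I ∷ O ∷ O ∷ []) ∷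
  (O ∷ O ∷ O ∷ O ∷ O ∷ O ∷ I ∷ O ∷ []) ∷ []

×α : Automorphism 8
×α = record { images = ×α-images ; preimages = ×α-preimages
  ; to-from = λ x → ==ᵛ⇒≡ _ x (∀-points (λ x → lincomb (lincomb x ×α-preimages) ×α-images ==ᵛ x) refl x)
  ; from-to = λ x → ==ᵛ⇒≡ _ x (∀-points (λ x → lincomb (lincomb x ×α-images) ×α-preimages ==ᵛ x) refl x) }

×α¹⁶-images ×α¹⁶-preimages : Vec (Pt 8) 8
×α¹⁶-images =
  (O ∷ O ∷ I ∷ I ∷ O ∷ O ∷ I ∷ O ∷ []) ∷
  (O ∷ O ∷ O ∷ I ∷ I ∷ O ∷ O ∷ I ∷ []) ∷
  (I ∷ O ∷ I ∷ I ∷ O ∷ I ∷ O ∷ O ∷ []) ∷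
  (O ∷ I ∷ O ∷ I ∷ I ∷ O ∷ I ∷ O ∷ []) ∷
  (O ∷ O ∷ I ∷ O ∷ I ∷ I ∷ O ∷ I ∷ []) ∷
  (I ∷ O ∷ I ∷ O ∷ I ∷ I ∷ I ∷ O ∷ []) ∷
  (O ∷ I ∷ O ∷ I ∷ O ∷ I ∷ I ∷ I ∷ []) ∷
  (I ∷ O ∷ O ∷ I ∷ O ∷ O ∷ I ∷ I ∷ []) ∷ []
×α¹⁶-preimages =
  (O ∷ I ∷ I ∷ O ∷ I ∷ O ∷ O ∷ O ∷ []) ∷
  (O ∷ O ∷ I ∷ I ∷ O ∷ I ∷ O ∷ O ∷ []) ∷
  (O ∷ O ∷ O ∷ I ∷ I ∷ O ∷ I ∷ O ∷ []) ∷
  (O ∷ O ∷ O ∷ O ∷ I ∷ I ∷ O ∷ I ∷ []) ∷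
  (I ∷ O ∷ I ∷ I ∷ I ∷ I ∷ I ∷ O ∷ []) ∷
  (O ∷ I ∷ O ∷ I ∷ I ∷ I ∷ I ∷ I ∷ []) ∷
  (I ∷ O ∷ O ∷ I ∷ O ∷ I ∷ I ∷ I ∷ []) ∷
  (I ∷ I ∷ I ∷ I ∷ O ∷ O ∷ I ∷ I ∷ []) ∷ []

×α¹⁶ : Automorphism 8
×α¹⁶ = record { images = ×α¹⁶-images ; preimages = ×α¹⁶-preimages
  ; to-from = λ x → ==ᵛ⇒≡ _ x (∀-points (λ x → lincomb (lincomb x ×α¹⁶-preimages) ×α¹⁶-images ==ᵛ x) refl x)
  ; from-to = λ x → ==ᵛ⇒≡ _ x (∀-points (λ x → lincomb (lincomb x ×α¹⁶-images) ×α¹⁶-preimages ==ᵛ x) refl x) }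

-- A generator of the subgroup of order 51, for the colouring with k = 4.
×α⁵-images ×α⁵-preimages : Vec (Pt 8) 8
×α⁵-images =
  (O ∷ O ∷ O ∷ O ∷ O ∷ I ∷ O ∷ O ∷ []) ∷
  (O ∷ O ∷ O ∷ O ∷ O ∷ O ∷ I ∷ O ∷ []) ∷
  (O ∷ O ∷ O ∷ O ∷ O ∷ O ∷ O ∷ I ∷ []) ∷
  (I ∷ O ∷ I ∷ I ∷ I ∷ O ∷ O ∷ O ∷ []) ∷
  (O ∷ I ∷ O ∷ I ∷ I ∷ I ∷ O ∷ O ∷ []) ∷
  (O ∷ O ∷ I ∷ O ∷ I ∷ I ∷ I ∷ O ∷ []) ∷
  (O ∷ O ∷ O ∷ I ∷ O ∷ I ∷ I ∷ I ∷ []) ∷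
  (I ∷ O ∷ I ∷ I ∷ O ∷ O ∷ I ∷ I ∷ []) ∷ []
×α⁵-preimages =
  (O ∷ O ∷ I ∷ I ∷ O ∷ I ∷ I ∷ O ∷ []) ∷
  (O ∷ O ∷ O ∷ I ∷ I ∷ O ∷ I ∷ I ∷ []) ∷
  (I ∷ O ∷ I ∷ I ∷ O ∷ I ∷ O ∷ I ∷ []) ∷
  (I ∷ I ∷ I ∷ O ∷ O ∷ O ∷ I ∷ O ∷ []) ∷
  (O ∷ I ∷ I ∷ I ∷ O ∷ O ∷ O ∷ I ∷ []) ∷
  (I ∷ O ∷ O ∷ O ∷ O ∷ O ∷ O ∷ O ∷ []) ∷
  (O ∷ I ∷ O ∷ O ∷ O ∷ O ∷ O ∷ O ∷ []) ∷
  (O ∷ O ∷ I ∷ O ∷ O ∷ O ∷ O ∷ O ∷ []) ∷ []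

×α⁵ : Automorphism 8
×α⁵ = record { images = ×α⁵-images ; preimages = ×α⁵-preimages
  ; to-from = λ x → ==ᵛ⇒≡ _ x (∀-points (λ x → lincomb (lincomb x ×α⁵-preimages) ×α⁵-images ==ᵛ x) refl x)
  ; from-to = λ x → ==ᵛ⇒≡ _ x (∀-points (λ x → lincomb (lincomb x ×α⁵-images) ×α⁵-preimages ==ᵛ x) refl x) }

×α⁸⁰-images ×α⁸⁰-preimages : Vec (Pt 8) 8
×α⁸⁰-images =
  (I ∷ O ∷ I ∷ I ∷ I ∷ I ∷ I ∷ I ∷ []) ∷
  (I ∷ I ∷ I ∷ O ∷ O ∷ I ∷ I ∷ I ∷ []) ∷
  (I ∷ I ∷ O ∷ O ∷ I ∷ O ∷ I ∷ I ∷ []) ∷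
  (I ∷ I ∷ O ∷ I ∷ I ∷ I ∷ O ∷ I ∷ []) ∷
  (I ∷ I ∷ O ∷ I ∷ O ∷ I ∷ I ∷ O ∷ []) ∷
  (O ∷ I ∷ I ∷ O ∷ I ∷ O ∷ I ∷ I ∷ []) ∷
  (I ∷ O ∷ O ∷ O ∷ I ∷ I ∷ O ∷ I ∷ []) ∷
  (I ∷ I ∷ I ∷ I ∷ I ∷ I ∷ I ∷ O ∷ []) ∷ []
×α⁸⁰-preimages =
  (I ∷ I ∷ I ∷ I ∷ I ∷ I ∷ I ∷ I ∷ []) ∷
  (I ∷ I ∷ O ∷ O ∷ O ∷ I ∷ I ∷ I ∷ []) ∷
  (I ∷ I ∷ O ∷ I ∷ I ∷ O ∷ I ∷ I ∷ []) ∷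
  (I ∷ I ∷ O ∷ I ∷ O ∷ I ∷ O ∷ I ∷ []) ∷
  (I ∷ I ∷ O ∷ I ∷ O ∷ O ∷ I ∷ O ∷ []) ∷
  (O ∷ I ∷ I ∷ O ∷ I ∷ O ∷ O ∷ I ∷ []) ∷
  (I ∷ O ∷ O ∷ O ∷ I ∷ I ∷ O ∷ O ∷ []) ∷
  (O ∷ I ∷ O ∷ O ∷ O ∷ I ∷ I ∷ O ∷ []) ∷ []

×α⁸⁰ : Automorphism 8
×α⁸⁰ = record { images = ×α⁸⁰-images ; preimages = ×α⁸⁰-preimages
  ; to-from = λ x → ==ᵛ⇒≡ _ x (∀-points (λ x → lincomb (lincomb x ×α⁸⁰-preimages) ×α⁸⁰-images ==ᵛ x) refl x)
  ; from-to = λ x → ==ᵛ⇒≡ _ x (∀-points (λ x → lincomb (lincomb x ×α⁸⁰-images) ×α⁸⁰-preimages ==ᵛ x) refl x) }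

frobenius-images frobenius-preimages : Vec (Pt 8) 8
frobenius-images =
  (O ∷ I ∷ O ∷ O ∷ O ∷ O ∷ O ∷ O ∷ []) ∷
  (O ∷ O ∷ O ∷ I ∷ O ∷ O ∷ O ∷ O ∷ []) ∷
  (O ∷ O ∷ O ∷ O ∷ O ∷ I ∷ O ∷ O ∷ []) ∷
  (O ∷ O ∷ O ∷ O ∷ O ∷ O ∷ O ∷ I ∷ []) ∷
  (O ∷ I ∷ O ∷ I ∷ I ∷ I ∷ O ∷ O ∷ []) ∷
  (O ∷ O ∷ O ∷ I ∷ O ∷ I ∷ I ∷ I ∷ []) ∷
  (I ∷ I ∷ I ∷ O ∷ O ∷ O ∷ O ∷ I ∷ []) ∷
  (O ∷ I ∷ I ∷ O ∷ O ∷ I ∷ O ∷ O ∷ []) ∷ []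
frobenius-preimages =
  (O ∷ O ∷ I ∷ I ∷ O ∷ O ∷ I ∷ I ∷ []) ∷
  (I ∷ O ∷ O ∷ O ∷ O ∷ O ∷ O ∷ O ∷ []) ∷
  (I ∷ O ∷ I ∷ O ∷ O ∷ O ∷ O ∷ I ∷ []) ∷
  (O ∷ I ∷ O ∷ O ∷ O ∷ O ∷ O ∷ O ∷ []) ∷
  (I ∷ I ∷ I ∷ O ∷ I ∷ O ∷ O ∷ O ∷ []) ∷
  (O ∷ O ∷ I ∷ O ∷ O ∷ O ∷ O ∷ O ∷ []) ∷
  (O ∷ I ∷ I ∷ I ∷ O ∷ I ∷ O ∷ O ∷ []) ∷
  (O ∷ O ∷ O ∷ I ∷ O ∷ O ∷ O ∷ O ∷ []) ∷ []

frobenius : Automorphism 8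
frobenius = record { images = frobenius-images ; preimages = frobenius-preimages
  ; to-from = λ x → ==ᵛ⇒≡ _ x (∀-points (λ x → lincomb (lincomb x frobenius-preimages) frobenius-images ==ᵛ x) refl x)
  ; from-to = λ x → ==ᵛ⇒≡ _ x (∀-points (λ x → lincomb (lincomb x frobenius-images) frobenius-preimages ==ᵛ x) refl x) }

is-shift : ℕ → Automorphism 8 → Pt 8 → Bool
is-shift δ g y = shifts 255 δ (lg y) (lg (Automorphism.to g y))

frobenius-doubles : ∀ y → doubles 255 (lg y) (lg (Automorphism.to frobenius y)) ≡ true
frobenius-doubles = ∀-points (λ y → doubles 255 (lg y) (lg (Automorphism.to frobenius y))) refl

-- Representatives of the 10795 lines modulo multiplication by α and the Frobenius map, a group of
-- order 255 · 8.
lines : List (Gr 8 2)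
lines =
  (ov (up (up (up (up (up (up (ov nil) (O ∷ [])) (O ∷ [])) (O ∷ [])) (I ∷ [])) (I ∷ [])) (I ∷ []))) ∷
  (up (ov (up (up (up (up (up (ov nil) (O ∷ [])) (O ∷ [])) (O ∷ [])) (I ∷ [])) (I ∷ []))) (I ∷ I ∷ [])) ∷
  (up (up (ov (up (up (up (up (ov nil) (O ∷ [])) (O ∷ [])) (O ∷ [])) (I ∷ []))) (O ∷ I ∷ [])) (I ∷ I ∷ [])) ∷
  (up (up (ov (up (up (up (up (ov nil) (O ∷ [])) (O ∷ [])) (O ∷ [])) (I ∷ []))) (I ∷ O ∷ [])) (I ∷ I ∷ [])) ∷
  (up (up (up (ov (up (up (up (ov nil) (O ∷ [])) (O ∷ [])) (O ∷ []))) (I ∷ O ∷ [])) (I ∷ O ∷ [])) (I ∷ I ∷ [])) ∷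
  (up (up (up (up (ov (up (up (ov nil) (O ∷ [])) (O ∷ []))) (O ∷ I ∷ [])) (O ∷ I ∷ [])) (O ∷ I ∷ [])) (O ∷ O ∷ [])) ∷
  (up (up (up (up (ov (up (up (ov nil) (O ∷ [])) (O ∷ []))) (O ∷ I ∷ [])) (O ∷ I ∷ [])) (I ∷ I ∷ [])) (O ∷ O ∷ [])) ∷
  (up (up (up (up (up (up (ov (ov nil)) (I ∷ O ∷ [])) (O ∷ O ∷ [])) (I ∷ I ∷ [])) (O ∷ I ∷ [])) (I ∷ I ∷ [])) (I ∷ O ∷ [])) ∷ []

-- One base point, α itself, since every nonzero point is a power of α. Its codes follow the order
-- of `allVec 8`.
bases : List (Pt 8 × List ℕ)
bases =
  ((I ∷ O ∷ O ∷ O ∷ O ∷ O ∷ O ∷ O ∷ []) ,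
  0 ∷ 294403 ∷ 1033408 ∷ 291907 ∷ 1040453 ∷ 1018688 ∷ 917510 ∷ 630465 ∷ 785472 ∷ 178755 ∷ 916289 ∷ 981313 ∷ 986756 ∷ 99009 ∷ 43009 ∷ 534277 ∷ 1017536 ∷ 835268 ∷ 524100 ∷ 981252 ∷
  747585 ∷ 906438 ∷ 203844 ∷ 544453 ∷ 807619 ∷ 959554 ∷ 48195 ∷ 789504 ∷ 682625 ∷ 401094 ∷ 795777 ∷ 334468 ∷ 523840 ∷ 1036928 ∷ 201410 ∷ 116486 ∷ 858118 ∷ 75265 ∷ 890374 ∷ 803457 ∷
  524033 ∷ 1037060 ∷ 276035 ∷ 182788 ∷ 779841 ∷ 785477 ∷ 523845 ∷ 98624 ∷ 785729 ∷ 785668 ∷ 981056 ∷ 1040896 ∷ 793094 ∷ 71488 ∷ 16389 ∷ 561413 ∷ 916096 ∷ 1013376 ∷ 811011 ∷ 204802 ∷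
  552001 ∷ 455300 ∷ 95040 ∷ 981125 ∷ 1040448 ∷ 920256 ∷ 916292 ∷ 1013505 ∷ 1022465 ∷ 431748 ∷ 447556 ∷ 1033733 ∷ 799747 ∷ 177858 ∷ 52228 ∷ 248004 ∷ 12997 ∷ 436997 ∷ 888128 ∷ 306501 ∷
  193730 ∷ 140038 ∷ 307204 ∷ 295940 ∷ 458884 ∷ 892097 ∷ 916037 ∷ 806085 ∷ 1013571 ∷ 303620 ∷ 1029380 ∷ 1029377 ∷ 662726 ∷ 807041 ∷ 102593 ∷ 44805 ∷ 1040641 ∷ 1037121 ∷ 528064 ∷ 280068 ∷
  913926 ∷ 626432 ∷ 39168 ∷ 1013317 ∷ 985088 ∷ 303235 ∷ 143686 ∷ 332999 ∷ 87296 ∷ 550213 ∷ 91329 ∷ 399428 ∷ 243779 ∷ 0 ∷ 943746 ∷ 132358 ∷ 1036869 ∷ 5125 ∷ 557893 ∷ 936645 ∷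
  1040644 ∷ 1013508 ∷ 1029248 ∷ 299587 ∷ 290433 ∷ 1029189 ∷ 502021 ∷ 1001669 ∷ 0 ∷ 294595 ∷ 1033216 ∷ 291971 ∷ 1040517 ∷ 1018624 ∷ 917702 ∷ 630273 ∷ 785536 ∷ 178819 ∷ 916225 ∷ 981249 ∷
  986692 ∷ 98817 ∷ 43201 ∷ 534341 ∷ 1017344 ∷ 835076 ∷ 524036 ∷ 981316 ∷ 747649 ∷ 906246 ∷ 203908 ∷ 544261 ∷ 807427 ∷ 959618 ∷ 48259 ∷ 789696 ∷ 682561 ∷ 400902 ∷ 795713 ∷ 334404 ∷
  523904 ∷ 1036864 ∷ 201218 ∷ 116550 ∷ 858310 ∷ 75457 ∷ 890566 ∷ 803393 ∷ 524097 ∷ 1037124 ∷ 276099 ∷ 182980 ∷ 779905 ∷ 785541 ∷ 523909 ∷ 98560 ∷ 785665 ∷ 785732 ∷ 981120 ∷ 1041088 ∷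
  793286 ∷ 71424 ∷ 16581 ∷ 561477 ∷ 916032 ∷ 1013312 ∷ 811203 ∷ 204994 ∷ 552065 ∷ 455236 ∷ 94976 ∷ 981061 ∷ 1040512 ∷ 920064 ∷ 916228 ∷ 1013569 ∷ 1022657 ∷ 431684 ∷ 447620 ∷ 1033925 ∷
  799939 ∷ 177666 ∷ 52420 ∷ 247812 ∷ 12805 ∷ 437061 ∷ 888064 ∷ 306437 ∷ 193538 ∷ 140102 ∷ 307396 ∷ 296132 ∷ 458820 ∷ 891905 ∷ 916101 ∷ 805893 ∷ 1013507 ∷ 303812 ∷ 1029444 ∷ 1029441 ∷
  662534 ∷ 806977 ∷ 102401 ∷ 44869 ∷ 1040705 ∷ 1037057 ∷ 527872 ∷ 280260 ∷ 914118 ∷ 626496 ∷ 39232 ∷ 1013381 ∷ 985280 ∷ 303171 ∷ 143622 ∷ 332807 ∷ 87360 ∷ 550149 ∷ 91137 ∷ 399492 ∷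
  243843 ∷ 192 ∷ 943682 ∷ 132422 ∷ 1036933 ∷ 5317 ∷ 557829 ∷ 936453 ∷ 1040708 ∷ 1013572 ∷ 1029184 ∷ 299651 ∷ 290369 ∷ 1029253 ∷ 502085 ∷ 1001477 ∷ []) ∷ []

colour₃-tree : Tree
colour₃-tree =
  (node (node (node (node (node (node (node (leaf 0) (node (node (node (leaf 0) (leaf 2)) (leaf 2)) (leaf 0))) (leaf 0)) (leaf 0)) (node (leaf 0) (leaf
  1))) (node (node (node (leaf 0) (node (node (node (leaf 0) (node (leaf 0) (leaf 1))) (leaf 0)) (leaf 2))) (leaf 1)) (node (node (leaf 0) (leaf 2))
  (leaf 0)))) (node (node (node (node (leaf 1) (node (leaf 0) (node (leaf 2) (leaf 0)))) (leaf 0)) (node (leaf 1) (leaf 2))) (node (node (node (leaf 0)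
  (node (leaf 0) (node (node (leaf 2) (leaf 0)) (leaf 0)))) (leaf 2)) (leaf 1)))) (node (node (node (leaf 0) (node (node (leaf 1) (leaf 0)) (leaf 0)))
  (node (node (node (node (node (leaf 0) (leaf 1)) (leaf 0)) (leaf 0)) (node (node (node (leaf 2) (leaf 0)) (leaf 1)) (leaf 0))) (node (leaf 0) (node
  (node (leaf 0) (leaf 1)) (leaf 0))))) (node (node (node (leaf 0) (node (leaf 2) (leaf 0))) (node (node (leaf 2) (leaf 0)) (leaf 0))) (node (node (node
  (leaf 0) (node (leaf 0) (node (leaf 0) (leaf 2)))) (leaf 0)) (node (leaf 0) (leaf 2))))))

-- With a = 7 = 2³ - 1 the key is fixed by all multiplications. As 7 is 1 modulo 3, the leading term
-- makes multiplication by α rotate the three colours.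
colour₃ : Gr 8 3 → Fin 3
colour₃ = baseColour true 7 (lookupⁿ colour₃-tree)

colour₃-×α : Acts colour₃ ×α
colour₃-×α = shift-Acts true 7 (lookupⁿ colour₃-tree) ×α 1 (∀-points (is-shift 1 ×α) refl) refl

colour₃-×α¹⁶ : Acts colour₃ ×α¹⁶
colour₃-×α¹⁶ = shift-Acts true 7 (lookupⁿ colour₃-tree) ×α¹⁶ 16 (∀-points (is-shift 16 ×α¹⁶) refl) refl

colour₃-frobenius : Acts colour₃ frobenius
colour₃-frobenius = double-Acts true 7 (lookupⁿ colour₃-tree) frobenius refl frobenius-doubles

-- Evaluation over the representatives: each lies in 63 spaces of dimension 3, of which 21 have each
-- colour.
colour₃-balanced : allᵇ (checkᵇ colour₃) lines ≡ true
colour₃-balanced = refl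

colour₃-PGood : PGood 8 3 2 colour₃
colour₃-PGood = certificate⇒PGood lines colour₃-balanced lg bases refl refl (s≤s (s≤s z≤n))
  where open Reduce colour₃ ×α ×α¹⁶ frobenius colour₃-×α colour₃-×α¹⁶ colour₃-frobenius

colour₅-tree : Tree
colour₅-tree =
  (node (node (node (node (node (node (node (node (leaf 0) (leaf 2)) (leaf 0)) (leaf 1)) (leaf 0)) (node (node (leaf 0) (node (leaf 2) (leaf 0))) (node
  (leaf 0) (node (leaf 2) (leaf 1))))) (node (node (leaf 1) (node (leaf 2) (node (leaf 1) (node (leaf 1) (node (node (node (leaf 0) (leaf 1)) (leaf 0))
  (leaf 0)))))) (node (leaf 1) (node (leaf 0) (node (leaf 1) (leaf 2)))))) (node (node (node (node (leaf 0) (node (leaf 0) (node (leaf 2) (leaf 0))))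
  (leaf 0)) (node (leaf 1) (leaf 0))) (node (node (node (node (leaf 0) (node (node (node (leaf 2) (leaf 0)) (leaf 0)) (leaf 0))) (leaf 0)) (leaf 1))
  (leaf 1)))) (node (node (node (leaf 1) (node (node (leaf 2) (leaf 1)) (leaf 0))) (node (leaf 1) (node (node (leaf 0) (leaf 1)) (leaf 0)))) (node (node
  (node (leaf 0) (node (leaf 2) (node (leaf 2) (leaf 1)))) (leaf 0)) (node (node (node (node (node (node (leaf 0) (node (node (leaf 2) (leaf 0)) (leaf
  0))) (leaf 0)) (leaf 0)) (leaf 0)) (leaf 0)) (leaf 1)))))

-- Here a = 31 = 2⁵ - 1, again 1 modulo 3, so multiplication by α fixes the key and rotates the
-- colours.
colour₅ : Gr 8 5 → Fin 3
colour₅ = baseColour true 31 (lookupⁿ colour₅-tree)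

colour₅-×α : Acts colour₅ ×α
colour₅-×α = shift-Acts true 31 (lookupⁿ colour₅-tree) ×α 1 (∀-points (is-shift 1 ×α) refl) refl

colour₅-×α¹⁶ : Acts colour₅ ×α¹⁶
colour₅-×α¹⁶ = shift-Acts true 31 (lookupⁿ colour₅-tree) ×α¹⁶ 16 (∀-points (is-shift 16 ×α¹⁶) refl) refl

colour₅-frobenius : Acts colour₅ frobenius
colour₅-frobenius = double-Acts true 31 (lookupⁿ colour₅-tree) frobenius refl frobenius-doubles

colour₅-balanced : allᵇ (checkᵇ colour₅) lines ≡ true
colour₅-balanced = refl

colour₅-PGood : PGood 8 5 2 colour₅
colour₅-PGood = certificate⇒PGood lines colour₅-balanced lg bases refl refl (s≤s (s≤s z≤n))
  where open Reduce colour₅ ×α ×α¹⁶ frobenius colour₅-×α colour₅-×α¹⁶ colour₅-frobenius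

-- Representatives modulo the smaller group generated by multiplication by α⁵ and the Frobenius map,
-- of order 51 · 8.
lines₄ : List (Gr 8 2)
lines₄ =
  (up (up (up (up (up (ov (ov (up nil []))) (O ∷ O ∷ [])) (O ∷ O ∷ [])) (O ∷ O ∷ [])) (O ∷ O ∷ [])) (O ∷ O ∷ [])) ∷
  (up (up (up (up (up (up (ov (ov nil)) (O ∷ I ∷ [])) (O ∷ O ∷ [])) (O ∷ I ∷ [])) (O ∷ I ∷ [])) (O ∷ I ∷ [])) (O ∷ O ∷ [])) ∷
  (up (up (up (up (up (ov (ov (up nil []))) (O ∷ O ∷ [])) (O ∷ O ∷ [])) (O ∷ O ∷ [])) (O ∷ O ∷ [])) (I ∷ O ∷ [])) ∷
  (up (up (up (up (up (up (ov (ov nil)) (O ∷ I ∷ [])) (O ∷ O ∷ [])) (O ∷ I ∷ [])) (O ∷ I ∷ [])) (O ∷ I ∷ [])) (O ∷ I ∷ [])) ∷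
  (up (up (up (up (up (ov (ov (up nil []))) (O ∷ O ∷ [])) (O ∷ O ∷ [])) (O ∷ O ∷ [])) (I ∷ O ∷ [])) (O ∷ O ∷ [])) ∷
  (up (up (up (up (up (up (ov (ov nil)) (O ∷ I ∷ [])) (O ∷ O ∷ [])) (O ∷ I ∷ [])) (O ∷ I ∷ [])) (O ∷ O ∷ [])) (O ∷ O ∷ [])) ∷
  (up (up (up (up (up (up (ov (ov nil)) (O ∷ I ∷ [])) (O ∷ O ∷ [])) (O ∷ I ∷ [])) (O ∷ I ∷ [])) (O ∷ O ∷ [])) (O ∷ I ∷ [])) ∷
  (up (up (up (up (up (up (ov (ov nil)) (O ∷ I ∷ [])) (O ∷ O ∷ [])) (O ∷ I ∷ [])) (O ∷ O ∷ [])) (O ∷ I ∷ [])) (O ∷ O ∷ [])) ∷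
  (up (up (up (up (up (up (ov (ov nil)) (O ∷ I ∷ [])) (O ∷ O ∷ [])) (O ∷ I ∷ [])) (O ∷ O ∷ [])) (O ∷ I ∷ [])) (O ∷ I ∷ [])) ∷
  (up (up (up (up (up (ov (ov (up nil []))) (O ∷ O ∷ [])) (O ∷ O ∷ [])) (I ∷ O ∷ [])) (I ∷ O ∷ [])) (O ∷ O ∷ [])) ∷
  (up (up (up (up (up (up (ov (ov nil)) (O ∷ I ∷ [])) (O ∷ O ∷ [])) (O ∷ I ∷ [])) (O ∷ O ∷ [])) (O ∷ O ∷ [])) (O ∷ O ∷ [])) ∷
  (up (up (up (up (up (ov (ov (up nil []))) (O ∷ O ∷ [])) (O ∷ O ∷ [])) (I ∷ O ∷ [])) (I ∷ O ∷ [])) (I ∷ O ∷ [])) ∷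
  (up (up (up (up (up (up (ov (ov nil)) (O ∷ I ∷ [])) (O ∷ O ∷ [])) (O ∷ O ∷ [])) (O ∷ I ∷ [])) (O ∷ I ∷ [])) (O ∷ I ∷ [])) ∷
  (up (up (up (up (up (ov (ov (up nil []))) (O ∷ O ∷ [])) (I ∷ O ∷ [])) (O ∷ O ∷ [])) (I ∷ O ∷ [])) (O ∷ O ∷ [])) ∷
  (up (up (up (up (up (up (ov (ov nil)) (O ∷ I ∷ [])) (O ∷ O ∷ [])) (O ∷ O ∷ [])) (O ∷ I ∷ [])) (O ∷ O ∷ [])) (O ∷ O ∷ [])) ∷
  (up (up (up (up (up (ov (ov (up nil []))) (O ∷ O ∷ [])) (I ∷ O ∷ [])) (O ∷ O ∷ [])) (I ∷ O ∷ [])) (I ∷ O ∷ [])) ∷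
  (up (up (up (up (up (up (ov (ov nil)) (O ∷ I ∷ [])) (O ∷ O ∷ [])) (O ∷ O ∷ [])) (O ∷ I ∷ [])) (O ∷ O ∷ [])) (O ∷ I ∷ [])) ∷
  (up (up (up (up (up (ov (ov (up nil []))) (O ∷ O ∷ [])) (I ∷ O ∷ [])) (I ∷ O ∷ [])) (O ∷ O ∷ [])) (O ∷ O ∷ [])) ∷
  (up (up (up (up (up (ov (ov (up nil []))) (O ∷ O ∷ [])) (I ∷ O ∷ [])) (I ∷ O ∷ [])) (O ∷ O ∷ [])) (I ∷ O ∷ [])) ∷
  (up (up (up (up (up (up (ov (ov nil)) (O ∷ I ∷ [])) (O ∷ O ∷ [])) (O ∷ O ∷ [])) (O ∷ O ∷ [])) (O ∷ I ∷ [])) (O ∷ I ∷ [])) ∷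
  (up (up (up (up (up (ov (ov (up nil []))) (O ∷ O ∷ [])) (I ∷ O ∷ [])) (I ∷ O ∷ [])) (I ∷ O ∷ [])) (I ∷ O ∷ [])) ∷
  (up (up (up (up (up (up (ov (ov nil)) (O ∷ I ∷ [])) (O ∷ O ∷ [])) (O ∷ O ∷ [])) (O ∷ O ∷ [])) (O ∷ O ∷ [])) (O ∷ I ∷ [])) ∷
  (up (up (up (up (up (ov (ov (up nil []))) (I ∷ O ∷ [])) (O ∷ O ∷ [])) (O ∷ O ∷ [])) (O ∷ O ∷ [])) (O ∷ O ∷ [])) ∷
  (up (up (up (up (up (ov (ov (up nil []))) (I ∷ O ∷ [])) (O ∷ O ∷ [])) (O ∷ O ∷ [])) (I ∷ O ∷ [])) (I ∷ O ∷ [])) ∷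
  (up (up (up (up (up (up (ov (ov nil)) (O ∷ I ∷ [])) (O ∷ I ∷ [])) (O ∷ I ∷ [])) (O ∷ O ∷ [])) (O ∷ I ∷ [])) (O ∷ O ∷ [])) ∷
  (up (up (up (up (up (ov (ov (up nil []))) (I ∷ O ∷ [])) (O ∷ O ∷ [])) (I ∷ O ∷ [])) (O ∷ O ∷ [])) (I ∷ O ∷ [])) ∷
  (up (up (up (up (up (up (ov (ov nil)) (O ∷ I ∷ [])) (O ∷ I ∷ [])) (O ∷ O ∷ [])) (O ∷ I ∷ [])) (O ∷ I ∷ [])) (O ∷ O ∷ [])) ∷
  (up (up (up (up (up (ov (ov (up nil []))) (I ∷ O ∷ [])) (I ∷ O ∷ [])) (O ∷ O ∷ [])) (I ∷ O ∷ [])) (O ∷ O ∷ [])) ∷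
  (up (up (up (up (up (up (ov (ov nil)) (O ∷ I ∷ [])) (O ∷ I ∷ [])) (O ∷ O ∷ [])) (O ∷ I ∷ [])) (O ∷ O ∷ [])) (O ∷ O ∷ [])) ∷
  (up (up (up (up (up (ov (ov (up nil []))) (I ∷ O ∷ [])) (I ∷ O ∷ [])) (I ∷ O ∷ [])) (I ∷ O ∷ [])) (O ∷ O ∷ [])) ∷
  (up (up (up (up (up (up (ov (ov nil)) (I ∷ I ∷ [])) (O ∷ O ∷ [])) (O ∷ I ∷ [])) (O ∷ I ∷ [])) (O ∷ I ∷ [])) (I ∷ I ∷ [])) ∷
  (up (up (up (up (up (ov (up (ov nil) (I ∷ []))) (O ∷ O ∷ [])) (I ∷ I ∷ [])) (I ∷ I ∷ [])) (I ∷ I ∷ [])) (I ∷ O ∷ [])) ∷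
  (up (up (up (up (up (ov (up (ov nil) (I ∷ []))) (I ∷ O ∷ [])) (O ∷ I ∷ [])) (I ∷ I ∷ [])) (O ∷ I ∷ [])) (I ∷ O ∷ [])) ∷
  (up (up (up (up (up (ov (ov (up nil []))) (I ∷ O ∷ [])) (O ∷ O ∷ [])) (O ∷ O ∷ [])) (I ∷ I ∷ [])) (I ∷ O ∷ [])) ∷
  (up (up (up (up (up (ov (up (ov nil) (I ∷ []))) (I ∷ O ∷ [])) (O ∷ O ∷ [])) (I ∷ I ∷ [])) (I ∷ I ∷ [])) (O ∷ O ∷ [])) ∷ []

-- The points α, ..., α⁵ represent the five cosets of the group generated by α⁵; division by α⁵
-- brings any other logarithm down to one of theirs.
bases₄ : List (Pt 8 × List ℕ)
bases₄ =
  ((I ∷ O ∷ O ∷ O ∷ O ∷ O ∷ O ∷ O ∷ []) ,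
  0 ∷ 4636 ∷ 4690 ∷ 6236 ∷ 59908 ∷ 123463 ∷ 4738 ∷ 132957 ∷ 49940 ∷ 4620 ∷ 4701 ∷ 182600 ∷ 191184 ∷ 4808 ∷ 177167 ∷ 68255 ∷ 126791 ∷ 161622 ∷ 166147 ∷ 208709 ∷
  187595 ∷ 4697 ∷ 4613 ∷ 205137 ∷ 75358 ∷ 4749 ∷ 16476 ∷ 191122 ∷ 190997 ∷ 4681 ∷ 144520 ∷ 145473 ∷ 60754 ∷ 190983 ∷ 33037 ∷ 4806 ∷ 54082 ∷ 36637 ∷ 103241 ∷ 4629 ∷
  4747 ∷ 191126 ∷ 68446 ∷ 180293 ∷ 4687 ∷ 74906 ∷ 196817 ∷ 24832 ∷ 3157 ∷ 191169 ∷ 202752 ∷ 4672 ∷ 91974 ∷ 13522 ∷ 191044 ∷ 4753 ∷ 4615 ∷ 107794 ∷ 168076 ∷ 4695 ∷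
  97352 ∷ 155713 ∷ 100935 ∷ 82628 ∷ 4096 ∷ 191104 ∷ 4694 ∷ 191115 ∷ 190984 ∷ 4816 ∷ 190981 ∷ 194833 ∷ 102625 ∷ 4632 ∷ 75331 ∷ 152720 ∷ 9034 ∷ 4826 ∷ 4756 ∷ 145156 ∷
  16077 ∷ 111618 ∷ 105552 ∷ 187971 ∷ 191171 ∷ 90443 ∷ 191178 ∷ 140570 ∷ 90910 ∷ 170053 ∷ 4801 ∷ 50325 ∷ 17177 ∷ 25611 ∷ 130255 ∷ 90783 ∷ 192776 ∷ 191069 ∷ 14151 ∷ 65302 ∷
  202374 ∷ 175122 ∷ 14656 ∷ 186577 ∷ 4763 ∷ 127758 ∷ 68256 ∷ 4819 ∷ 191060 ∷ 48900 ∷ 80203 ∷ 4611 ∷ 4622 ∷ 191131 ∷ 102615 ∷ 12489 ∷ 4810 ∷ 93530 ∷ 191002 ∷ 195402 ∷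
  96069 ∷ 176451 ∷ 27476 ∷ 66380 ∷ 191119 ∷ 27802 ∷ 191121 ∷ 4740 ∷ 0 ∷ 4828 ∷ 4754 ∷ 6300 ∷ 60100 ∷ 123527 ∷ 4674 ∷ 132893 ∷ 50004 ∷ 4812 ∷ 4765 ∷ 182536 ∷
  190992 ∷ 4616 ∷ 177359 ∷ 68191 ∷ 126727 ∷ 161558 ∷ 166211 ∷ 208645 ∷ 187403 ∷ 4761 ∷ 4805 ∷ 205073 ∷ 75422 ∷ 4685 ∷ 16540 ∷ 191058 ∷ 191189 ∷ 4745 ∷ 144456 ∷ 145537 ∷
  60690 ∷ 191175 ∷ 33101 ∷ 4614 ∷ 54018 ∷ 36701 ∷ 103177 ∷ 4821 ∷ 4683 ∷ 191062 ∷ 68382 ∷ 180357 ∷ 4751 ∷ 74842 ∷ 196625 ∷ 24896 ∷ 3221 ∷ 190977 ∷ 202944 ∷ 4736 ∷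
  91910 ∷ 13330 ∷ 191108 ∷ 4689 ∷ 4807 ∷ 107858 ∷ 168012 ∷ 4759 ∷ 97416 ∷ 155777 ∷ 100999 ∷ 82436 ∷ 4288 ∷ 191040 ∷ 4758 ∷ 191051 ∷ 191176 ∷ 4624 ∷ 191173 ∷ 194897 ∷
  102433 ∷ 4824 ∷ 75395 ∷ 152656 ∷ 8970 ∷ 4634 ∷ 4692 ∷ 145220 ∷ 15885 ∷ 111810 ∷ 105616 ∷ 188035 ∷ 190979 ∷ 90379 ∷ 190986 ∷ 140634 ∷ 90974 ∷ 170117 ∷ 4609 ∷ 50261 ∷
  17241 ∷ 25803 ∷ 130063 ∷ 90719 ∷ 192840 ∷ 191133 ∷ 14087 ∷ 65366 ∷ 202310 ∷ 175314 ∷ 14592 ∷ 186385 ∷ 4699 ∷ 127822 ∷ 68192 ∷ 4627 ∷ 191124 ∷ 48964 ∷ 80139 ∷ 4803 ∷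
  4814 ∷ 191067 ∷ 102423 ∷ 12297 ∷ 4618 ∷ 93466 ∷ 191194 ∷ 195338 ∷ 96005 ∷ 176387 ∷ 27412 ∷ 66316 ∷ 191055 ∷ 27738 ∷ 191057 ∷ 4676 ∷ []) ∷
  ((O ∷ I ∷ O ∷ O ∷ O ∷ O ∷ O ∷ O ∷ []) ,
  0 ∷ 126279 ∷ 4298 ∷ 201862 ∷ 60242 ∷ 2645 ∷ 190659 ∷ 190472 ∷ 4187 ∷ 95493 ∷ 190677 ∷ 190480 ∷ 91873 ∷ 90462 ∷ 96904 ∷ 4239 ∷ 7680 ∷ 15565 ∷ 91462 ∷ 53570 ∷
  196360 ∷ 4110 ∷ 187083 ∷ 59396 ∷ 4171 ∷ 4295 ∷ 16729 ∷ 8458 ∷ 49492 ∷ 74910 ∷ 190543 ∷ 190612 ∷ 190663 ∷ 190465 ∷ 93963 ∷ 4112 ∷ 4316 ∷ 161046 ∷ 92954 ∷ 174802 ∷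
  4120 ∷ 169541 ∷ 159297 ∷ 74394 ∷ 127246 ∷ 180035 ∷ 4169 ∷ 4296 ∷ 190621 ∷ 190555 ∷ 4249 ∷ 123015 ∷ 190528 ∷ 111298 ∷ 12818 ∷ 36189 ∷ 4108 ∷ 4237 ∷ 27290 ∷ 48388 ∷
  190614 ∷ 107282 ∷ 25099 ∷ 4314 ∷ 0 ∷ 126215 ∷ 4106 ∷ 201798 ∷ 60178 ∷ 2709 ∷ 190467 ∷ 190664 ∷ 4251 ∷ 95557 ∷ 190485 ∷ 190672 ∷ 91681 ∷ 90398 ∷ 96840 ∷ 4175 ∷
  7872 ∷ 15373 ∷ 91398 ∷ 53506 ∷ 196424 ∷ 4302 ∷ 186891 ∷ 59588 ∷ 4235 ∷ 4103 ∷ 16665 ∷ 8522 ∷ 49428 ∷ 74846 ∷ 190607 ∷ 190548 ∷ 190471 ∷ 190657 ∷ 94027 ∷ 4304 ∷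
  4124 ∷ 161110 ∷ 93018 ∷ 174610 ∷ 4312 ∷ 169605 ∷ 159361 ∷ 74330 ∷ 127310 ∷ 179971 ∷ 4233 ∷ 4104 ∷ 190557 ∷ 190619 ∷ 4185 ∷ 122951 ∷ 190592 ∷ 111106 ∷ 13010 ∷ 36125 ∷
  4300 ∷ 4173 ∷ 27226 ∷ 48452 ∷ 190550 ∷ 107346 ∷ 25291 ∷ 4122 ∷ 4160 ∷ 4294 ∷ 194321 ∷ 140058 ∷ 208197 ∷ 5724 ∷ 186065 ∷ 194890 ∷ 49749 ∷ 152144 ∷ 28480 ∷ 81924 ∷
  65804 ∷ 4115 ∷ 67679 ∷ 145025 ∷ 1545 ∷ 64790 ∷ 132445 ∷ 208721 ∷ 187459 ∷ 190603 ∷ 4117 ∷ 4241 ∷ 190546 ∷ 182024 ∷ 4291 ∷ 4164 ∷ 4247 ∷ 183941 ∷ 144708 ∷ 90207 ∷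
  165699 ∷ 4242 ∷ 14080 ∷ 190682 ∷ 202432 ∷ 22349 ∷ 190661 ∷ 190474 ∷ 26964 ∷ 67744 ∷ 176655 ∷ 144008 ∷ 4289 ∷ 74819 ∷ 200401 ∷ 100423 ∷ 105104 ∷ 4246 ∷ 102665 ∷ 190596 ∷
  91671 ∷ 13575 ∷ 4162 ∷ 4293 ∷ 157260 ∷ 67934 ∷ 4244 ∷ 129743 ∷ 20060 ∷ 4189 ∷ 79691 ∷ 190609 ∷ 4224 ∷ 4102 ∷ 194385 ∷ 140122 ∷ 208133 ∷ 5788 ∷ 185873 ∷ 194826 ∷
  49813 ∷ 152208 ∷ 28416 ∷ 82116 ∷ 65868 ∷ 4307 ∷ 67743 ∷ 144961 ∷ 1737 ∷ 64854 ∷ 132381 ∷ 208657 ∷ 187523 ∷ 190539 ∷ 4309 ∷ 4177 ∷ 190610 ∷ 182088 ∷ 4099 ∷ 4228 ∷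
  4183 ∷ 183877 ∷ 144644 ∷ 90271 ∷ 165635 ∷ 4178 ∷ 14144 ∷ 190490 ∷ 202240 ∷ 22285 ∷ 190469 ∷ 190666 ∷ 26900 ∷ 67680 ∷ 176847 ∷ 143944 ∷ 4097 ∷ 74883 ∷ 200209 ∷ 100487 ∷
  105040 ∷ 4182 ∷ 102729 ∷ 190532 ∷ 91863 ∷ 13639 ∷ 4226 ∷ 4101 ∷ 157324 ∷ 67870 ∷ 4180 ∷ 129551 ∷ 20124 ∷ 4253 ∷ 79627 ∷ 190545 ∷ []) ∷
  ((O ∷ O ∷ I ∷ O ∷ O ∷ O ∷ O ∷ O ∷ []) ,
  0 ∷ 193233 ∷ 206023 ∷ 206021 ∷ 205906 ∷ 205903 ∷ 164428 ∷ 134667 ∷ 42260 ∷ 95561 ∷ 159381 ∷ 128584 ∷ 205917 ∷ 46402 ∷ 137920 ∷ 60629 ∷ 8018 ∷ 161295 ∷ 77918 ∷ 60548 ∷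
  29453 ∷ 60624 ∷ 12956 ∷ 204870 ∷ 205963 ∷ 205954 ∷ 16647 ∷ 179335 ∷ 146782 ∷ 138244 ∷ 101187 ∷ 44680 ∷ 0 ∷ 193041 ∷ 205831 ∷ 205829 ∷ 205970 ∷ 205967 ∷ 164492 ∷ 134859 ∷
  42324 ∷ 95497 ∷ 159317 ∷ 128648 ∷ 205981 ∷ 46338 ∷ 137728 ∷ 60437 ∷ 7954 ∷ 161487 ∷ 77982 ∷ 60484 ∷ 29517 ∷ 60432 ∷ 12892 ∷ 204934 ∷ 205899 ∷ 205890 ∷ 16711 ∷ 179271 ∷
  146718 ∷ 138436 ∷ 101123 ∷ 44616 ∷ 190727 ∷ 1290 ∷ 206017 ∷ 206026 ∷ 189256 ∷ 205908 ∷ 83230 ∷ 60442 ∷ 83104 ∷ 60616 ∷ 52816 ∷ 60559 ∷ 205915 ∷ 60613 ∷ 80077 ∷ 60561 ∷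
  205974 ∷ 60564 ∷ 105812 ∷ 60611 ∷ 704 ∷ 15115 ∷ 63813 ∷ 60618 ∷ 43139 ∷ 94470 ∷ 99031 ∷ 9497 ∷ 98849 ∷ 158464 ∷ 205838 ∷ 77519 ∷ 190791 ∷ 1354 ∷ 205825 ∷ 205834 ∷
  189192 ∷ 205972 ∷ 83294 ∷ 60634 ∷ 83040 ∷ 60424 ∷ 52880 ∷ 60495 ∷ 205979 ∷ 60421 ∷ 79885 ∷ 60497 ∷ 205910 ∷ 60500 ∷ 105748 ∷ 60419 ∷ 512 ∷ 15179 ∷ 63749 ∷ 60426 ∷
  43075 ∷ 94534 ∷ 98839 ∷ 9561 ∷ 99041 ∷ 158528 ∷ 206030 ∷ 77327 ∷ 60562 ∷ 206546 ∷ 205830 ∷ 205832 ∷ 205965 ∷ 205969 ∷ 60615 ∷ 146527 ∷ 98629 ∷ 152129 ∷ 176773 ∷ 115847 ∷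
  129366 ∷ 74948 ∷ 60502 ∷ 100637 ∷ 205911 ∷ 205913 ∷ 150172 ∷ 58970 ∷ 91922 ∷ 201553 ∷ 206044 ∷ 21312 ∷ 205888 ∷ 205897 ∷ 117512 ∷ 135517 ∷ 60609 ∷ 80449 ∷ 206028 ∷ 206037 ∷
  60498 ∷ 206354 ∷ 206022 ∷ 206024 ∷ 205901 ∷ 205905 ∷ 60423 ∷ 146591 ∷ 98565 ∷ 152193 ∷ 176709 ∷ 115783 ∷ 129302 ∷ 74756 ∷ 60566 ∷ 100701 ∷ 205975 ∷ 205977 ∷ 150108 ∷ 59034 ∷
  91986 ∷ 201489 ∷ 205852 ∷ 21248 ∷ 205952 ∷ 205961 ∷ 117576 ∷ 135453 ∷ 60417 ∷ 80513 ∷ 205836 ∷ 205845 ∷ 172803 ∷ 124762 ∷ 60544 ∷ 205827 ∷ 58636 ∷ 86795 ∷ 60555 ∷ 147716 ∷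
  60507 ∷ 83039 ∷ 10328 ∷ 121553 ∷ 8713 ∷ 9931 ∷ 136848 ∷ 122386 ∷ 105093 ∷ 64778 ∷ 60509 ∷ 112900 ∷ 34389 ∷ 40730 ∷ 164118 ∷ 206042 ∷ 11778 ∷ 205892 ∷ 120078 ∷ 129809 ∷
  77955 ∷ 183898 ∷ 66643 ∷ 206032 ∷ 172867 ∷ 124698 ∷ 60480 ∷ 206019 ∷ 58700 ∷ 86859 ∷ 60491 ∷ 147780 ∷ 60571 ∷ 83103 ∷ 10392 ∷ 121361 ∷ 8905 ∷ 9739 ∷ 136784 ∷ 122578 ∷
  105029 ∷ 64842 ∷ 60573 ∷ 112964 ∷ 34453 ∷ 40794 ∷ 164182 ∷ 205850 ∷ 11970 ∷ 205956 ∷ 120142 ∷ 129873 ∷ 77891 ∷ 183962 ∷ 66707 ∷ 205840 ∷ []) ∷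
  ((O ∷ O ∷ O ∷ I ∷ O ∷ O ∷ O ∷ O ∷ []) ,
  0 ∷ 7168 ∷ 190080 ∷ 7708 ∷ 190151 ∷ 190109 ∷ 195912 ∷ 59666 ∷ 26388 ∷ 156812 ∷ 7831 ∷ 69388 ∷ 49301 ∷ 190098 ∷ 19548 ∷ 7873 ∷ 0 ∷ 7360 ∷ 190016 ∷ 7900 ∷
  189959 ∷ 190045 ∷ 195848 ∷ 59730 ∷ 26452 ∷ 156748 ∷ 7767 ∷ 69452 ∷ 49237 ∷ 190034 ∷ 19612 ∷ 7681 ∷ 7826 ∷ 7830 ∷ 190027 ∷ 5276 ∷ 7878 ∷ 64278 ∷ 13127 ∷ 21773 ∷
  95045 ∷ 7687 ∷ 106770 ∷ 179523 ∷ 169093 ∷ 7757 ∷ 74398 ∷ 30238 ∷ 7762 ∷ 7766 ∷ 190091 ∷ 5212 ∷ 7686 ∷ 64342 ∷ 13063 ∷ 21837 ∷ 94981 ∷ 7879 ∷ 106834 ∷ 179459 ∷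
  169029 ∷ 7821 ∷ 74334 ∷ 30430 ∷ 7744 ∷ 1033 ∷ 91351 ∷ 201728 ∷ 165187 ∷ 104592 ∷ 187011 ∷ 207621 ∷ 7896 ∷ 7884 ∷ 53076 ∷ 91361 ∷ 7835 ∷ 7819 ∷ 190102 ∷ 190158 ∷
  7808 ∷ 1225 ∷ 91159 ∷ 201920 ∷ 165123 ∷ 104528 ∷ 186947 ∷ 207685 ∷ 7704 ∷ 7692 ∷ 53012 ∷ 91169 ∷ 7771 ∷ 7755 ∷ 190038 ∷ 189966 ∷ 189953 ∷ 190043 ∷ 7886 ∷ 2197 ∷
  125767 ∷ 15053 ∷ 110594 ∷ 160598 ∷ 151696 ∷ 181576 ∷ 7773 ∷ 74307 ∷ 67168 ∷ 67358 ∷ 183429 ∷ 7699 ∷ 190145 ∷ 190107 ∷ 7694 ∷ 2133 ∷ 125703 ∷ 14861 ∷ 110786 ∷ 160534 ∷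
  151632 ∷ 181512 ∷ 7837 ∷ 74371 ∷ 67232 ∷ 67422 ∷ 183365 ∷ 7891 ∷ 126599 ∷ 7696 ∷ 190152 ∷ 59076 ∷ 190082 ∷ 201350 ∷ 174098 ∷ 35613 ∷ 7812 ∷ 85700 ∷ 99911 ∷ 190097 ∷
  129039 ∷ 143432 ∷ 144513 ∷ 93791 ∷ 126535 ∷ 7888 ∷ 189960 ∷ 58884 ∷ 190018 ∷ 201286 ∷ 174290 ∷ 35677 ∷ 7748 ∷ 85508 ∷ 99975 ∷ 190033 ∷ 129231 ∷ 143496 ∷ 144449 ∷ 93855 ∷
  131933 ∷ 193809 ∷ 189957 ∷ 7810 ∷ 106249 ∷ 13568 ∷ 185361 ∷ 7893 ∷ 26714 ∷ 158849 ∷ 96392 ∷ 190031 ∷ 20249 ∷ 189973 ∷ 79625 ∷ 24587 ∷ 131869 ∷ 193873 ∷ 190149 ∷ 7746 ∷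
  106313 ∷ 13632 ∷ 185553 ∷ 7701 ∷ 26778 ∷ 158785 ∷ 96328 ∷ 190095 ∷ 20313 ∷ 190165 ∷ 79689 ∷ 24779 ∷ 190084 ∷ 190170 ∷ 194314 ∷ 7761 ∷ 208209 ∷ 139546 ∷ 190154 ∷ 7685 ∷
  12106 ∷ 190160 ∷ 7880 ∷ 7898 ∷ 47940 ∷ 73818 ∷ 7823 ∷ 190100 ∷ 190020 ∷ 189978 ∷ 194378 ∷ 7825 ∷ 208145 ∷ 139610 ∷ 189962 ∷ 7877 ∷ 12042 ∷ 189968 ∷ 7688 ∷ 7706 ∷
  47876 ∷ 73882 ∷ 7759 ∷ 190036 ∷ 90950 ∷ 7882 ∷ 92506 ∷ 12498 ∷ 202585 ∷ 93451 ∷ 189955 ∷ 186379 ∷ 7764 ∷ 176335 ∷ 67167 ∷ 144196 ∷ 7683 ∷ 27904 ∷ 199889 ∷ 79179 ∷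
  90886 ∷ 7690 ∷ 92442 ∷ 12306 ∷ 202521 ∷ 93515 ∷ 190147 ∷ 186571 ∷ 7828 ∷ 176143 ∷ 67231 ∷ 144132 ∷ 7875 ∷ 27968 ∷ 199697 ∷ 79115 ∷ []) ∷
  ((O ∷ O ∷ O ∷ O ∷ I ∷ O ∷ O ∷ O ∷ []) ,
  0 ∷ 7188 ∷ 125275 ∷ 6479 ∷ 60251 ∷ 2903 ∷ 19727 ∷ 62753 ∷ 0 ∷ 7380 ∷ 125211 ∷ 6415 ∷ 60187 ∷ 2839 ∷ 19791 ∷ 62817 ∷ 26324 ∷ 175951 ∷ 28697 ∷ 53268 ∷
  76112 ∷ 138523 ∷ 195841 ∷ 118926 ∷ 26132 ∷ 175887 ∷ 28889 ∷ 53460 ∷ 76048 ∷ 138587 ∷ 195905 ∷ 118862 ∷ 42196 ∷ 72472 ∷ 108368 ∷ 143105 ∷ 67863 ∷ 181019 ∷ 137940 ∷ 11088 ∷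
  42004 ∷ 72536 ∷ 108304 ∷ 143169 ∷ 67927 ∷ 181083 ∷ 137748 ∷ 11024 ∷ 124176 ∷ 74081 ∷ 202772 ∷ 17625 ∷ 29441 ∷ 62287 ∷ 25305 ∷ 21761 ∷ 124240 ∷ 74017 ∷ 202964 ∷ 17433 ∷
  29505 ∷ 62223 ∷ 25113 ∷ 21825 ∷ 4123 ∷ 42837 ∷ 138976 ∷ 201755 ∷ 10591 ∷ 153819 ∷ 23829 ∷ 130774 ∷ 4315 ∷ 42773 ∷ 138784 ∷ 201947 ∷ 10527 ∷ 153627 ∷ 23893 ∷ 130582 ∷
  154453 ∷ 170198 ∷ 177504 ∷ 26143 ∷ 42015 ∷ 90141 ∷ 25120 ∷ 17440 ∷ 154389 ∷ 170006 ∷ 177440 ∷ 26335 ∷ 42207 ∷ 90333 ∷ 25312 ∷ 17632 ∷ 69983 ∷ 154399 ∷ 180063 ∷ 137951 ∷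
  66399 ∷ 180053 ∷ 114826 ∷ 174621 ∷ 69919 ∷ 154463 ∷ 179999 ∷ 137759 ∷ 66335 ∷ 179989 ∷ 114762 ∷ 174813 ∷ 28896 ∷ 58655 ∷ 185120 ∷ 9430 ∷ 539 ∷ 111178 ∷ 183510 ∷ 163551 ∷
  28704 ∷ 58719 ∷ 185184 ∷ 9238 ∷ 731 ∷ 111242 ∷ 183318 ∷ 163359 ∷ 49876 ∷ 54607 ∷ 100119 ∷ 182593 ∷ 65807 ∷ 5889 ∷ 83553 ∷ 131170 ∷ 49684 ∷ 54543 ∷ 100183 ∷ 182529 ∷
  65871 ∷ 5953 ∷ 83617 ∷ 131234 ∷ 1561 ∷ 85787 ∷ 117569 ∷ 135504 ∷ 70433 ∷ 203342 ∷ 38735 ∷ 14625 ∷ 1753 ∷ 85851 ∷ 117505 ∷ 135440 ∷ 70497 ∷ 203406 ∷ 38671 ∷ 14689 ∷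
  131856 ∷ 99425 ∷ 33025 ∷ 81175 ∷ 184667 ∷ 36624 ∷ 196952 ∷ 11937 ∷ 131920 ∷ 99489 ∷ 33089 ∷ 81239 ∷ 184603 ∷ 36688 ∷ 196888 ∷ 11873 ∷ 157467 ∷ 72782 ∷ 150351 ∷ 173403 ∷
  91726 ∷ 107105 ∷ 163348 ∷ 89360 ∷ 157531 ∷ 72846 ∷ 150287 ∷ 173339 ∷ 91790 ∷ 107169 ∷ 163540 ∷ 89424 ∷ 49695 ∷ 166939 ∷ 10581 ∷ 44253 ∷ 58645 ∷ 55370 ∷ 185883 ∷ 69909 ∷
  49887 ∷ 167131 ∷ 10517 ∷ 44061 ∷ 58709 ∷ 55434 ∷ 186075 ∷ 69973 ∷ 15946 ∷ 68746 ∷ 23839 ∷ 20502 ∷ 17110 ∷ 87626 ∷ 7391 ∷ 88603 ∷ 16010 ∷ 68682 ∷ 23903 ∷ 20694 ∷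
  16918 ∷ 87690 ∷ 7199 ∷ 88795 ∷ 42847 ∷ 1568 ∷ 114203 ∷ 63005 ∷ 202262 ∷ 86557 ∷ 200413 ∷ 79069 ∷ 42783 ∷ 1760 ∷ 114395 ∷ 63197 ∷ 202454 ∷ 86749 ∷ 200221 ∷ 78877 ∷
  104982 ∷ 53471 ∷ 188768 ∷ 66389 ∷ 202975 ∷ 103498 ∷ 30749 ∷ 199306 ∷ 105174 ∷ 53279 ∷ 188704 ∷ 66325 ∷ 202783 ∷ 103562 ∷ 30941 ∷ 199242 ∷ []) ∷ []

colour₄-tree : Tree
colour₄-tree =
  (node (node (node (node (node (node (node (node (node (leaf 0) (leaf 2)) (node (leaf 0) (leaf 1))) (node (node (node (leaf 2) (leaf 0)) (leaf 0))
  (node (leaf 2) (leaf 0)))) (node (node (leaf 2) (leaf 0)) (node (node (leaf 0) (node (leaf 1) (node (leaf 0) (leaf 2)))) (leaf 0)))) (node (node (node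
  (node (leaf 2) (leaf 1)) (leaf 0)) (node (leaf 2) (node (leaf 0) (leaf 2)))) (node (node (node (leaf 2) (node (leaf 1) (leaf 2))) (leaf 0)) (node
  (node (leaf 2) (leaf 1)) (node (node (node (node (node (leaf 1) (leaf 2)) (leaf 0)) (leaf 0)) (leaf 0)) (node (leaf 1) (node (leaf 1) (leaf 0))))))))
  (node (node (node (node (node (node (leaf 2) (leaf 1)) (node (node (node (node (leaf 1) (leaf 2)) (leaf 0)) (leaf 2)) (leaf 1))) (leaf 0)) (node (leaf
  2) (leaf 0))) (node (node (node (leaf 0) (node (leaf 1) (leaf 0))) (node (node (leaf 0) (node (leaf 0) (node (leaf 0) (node (leaf 1) (leaf 0)))))
  (node (leaf 0) (node (leaf 2) (leaf 0))))) (node (node (leaf 1) (leaf 0)) (node (leaf 0) (node (leaf 0) (leaf 2)))))) (node (node (node (node (leaf 2)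
  (node (leaf 1) (leaf 0))) (node (node (node (leaf 0) (node (leaf 2) (leaf 1))) (leaf 0)) (leaf 1))) (node (node (node (leaf 0) (leaf 1)) (leaf 0))
  (leaf 2))) (leaf 2)))) (node (node (node (node (node (leaf 0) (node (leaf 2) (leaf 0))) (node (node (leaf 1) (leaf 2)) (leaf 0))) (node (node (node
  (leaf 1) (node (leaf 0) (node (leaf 0) (leaf 2)))) (node (node (node (node (node (leaf 0) (leaf 1)) (leaf 0)) (leaf 0)) (leaf 0)) (node (leaf 1) (leaf
  0)))) (node (leaf 1) (node (node (leaf 2) (leaf 1)) (leaf 0))))) (node (node (node (leaf 1) (node (leaf 1) (node (node (node (node (leaf 2) (leaf 1))
  (leaf 0)) (leaf 1)) (leaf 1)))) (leaf 2)) (node (node (leaf 1) (leaf 2)) (node (leaf 2) (leaf 0))))) (node (node (node (node (node (node (leaf 2)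
  (leaf 1)) (leaf 0)) (leaf 2)) (leaf 0)) (node (node (node (node (node (leaf 0) (leaf 2)) (leaf 0)) (leaf 0)) (leaf 0)) (node (leaf 1) (leaf 0))))
  (node (node (node (node (leaf 0) (node (leaf 0) (leaf 2))) (node (leaf 0) (leaf 2))) (node (leaf 2) (leaf 0))) (node (node (node (leaf 1) (leaf 2))
  (leaf 1)) (node (node (leaf 2) (node (leaf 2) (leaf 0))) (node (leaf 1) (leaf 0)))))))) (node (node (node (node (node (node (node (node (leaf 0) (node
  (node (node (leaf 0) (leaf 2)) (leaf 0)) (node (leaf 1) (leaf 0)))) (leaf 0)) (node (leaf 0) (node (leaf 0) (node (node (leaf 0) (leaf 1)) (leaf
  0))))) (node (leaf 0) (node (node (node (node (leaf 1) (leaf 2)) (leaf 0)) (leaf 1)) (leaf 0)))) (leaf 1)) (node (node (node (leaf 0) (node (leaf 0)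
  (node (node (leaf 1) (leaf 2)) (node (node (node (leaf 1) (leaf 2)) (leaf 0)) (leaf 0))))) (node (node (node (leaf 2) (leaf 1)) (leaf 1)) (leaf 0)))
  (node (leaf 2) (node (node (node (node (leaf 0) (node (leaf 2) (leaf 1))) (leaf 0)) (leaf 0)) (node (node (node (node (leaf 2) (leaf 0)) (leaf 0))
  (leaf 0)) (leaf 0)))))) (node (node (node (node (node (leaf 1) (node (leaf 0) (leaf 2))) (node (node (node (leaf 0) (leaf 2)) (leaf 1)) (leaf 2)))
  (node (leaf 2) (node (leaf 0) (leaf 2)))) (node (node (node (leaf 2) (leaf 1)) (node (leaf 0) (leaf 1))) (node (node (node (node (leaf 2) (leaf 1))
  (leaf 2)) (leaf 0)) (leaf 0)))) (node (node (node (leaf 1) (node (leaf 2) (leaf 0))) (leaf 1)) (node (node (node (leaf 2) (leaf 0)) (node (leaf 0)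
  (node (leaf 0) (node (node (leaf 0) (leaf 2)) (leaf 0))))) (node (node (leaf 0) (leaf 2)) (node (leaf 0) (node (leaf 0) (leaf 2)))))))) (node (node
  (node (node (node (node (node (leaf 0) (node (leaf 0) (node (leaf 0) (leaf 1)))) (leaf 2)) (node (node (leaf 0) (node (node (leaf 1) (leaf 0)) (leaf
  0))) (leaf 1))) (leaf 2)) (node (node (node (leaf 0) (node (leaf 2) (leaf 0))) (leaf 0)) (node (node (leaf 2) (leaf 0)) (node (leaf 0) (node (node
  (leaf 0) (leaf 2)) (leaf 0)))))) (node (node (node (node (node (leaf 2) (leaf 0)) (leaf 2)) (node (leaf 2) (leaf 0))) (node (node (leaf 0) (node (leaf
  0) (leaf 2))) (leaf 0))) (node (node (leaf 1) (leaf 0)) (node (node (node (leaf 0) (leaf 2)) (node (node (leaf 2) (leaf 0)) (leaf 1))) (leaf 1)))))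
  (node (node (node (node (node (node (leaf 2) (leaf 1)) (leaf 2)) (leaf 0)) (node (node (leaf 1) (leaf 2)) (leaf 2))) (node (node (node (leaf 2) (leaf
  0)) (node (leaf 0) (leaf 1))) (node (node (leaf 2) (leaf 0)) (leaf 0)))) (node (node (node (leaf 2) (node (leaf 2) (node (leaf 0) (leaf 2)))) (node
  (node (node (leaf 0) (leaf 2)) (leaf 1)) (node (leaf 1) (node (leaf 0) (node (node (leaf 2) (leaf 1)) (leaf 0)))))) (node (node (leaf 2) (node (leaf
  0) (leaf 2))) (node (node (leaf 1) (node (leaf 2) (leaf 1))) (leaf 0)))))))) (node (node (node (node (node (node (node (node (leaf 1) (leaf 2)) (node
  (leaf 0) (leaf 2))) (node (node (node (node (leaf 0) (node (node (leaf 0) (leaf 1)) (leaf 2))) (leaf 0)) (leaf 0)) (node (leaf 1) (leaf 0)))) (node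
  (node (node (leaf 2) (leaf 0)) (node (node (leaf 0) (leaf 1)) (leaf 0))) (node (node (leaf 2) (node (node (leaf 2) (leaf 1)) (leaf 0))) (node (node
  (leaf 2) (leaf 1)) (leaf 1))))) (node (node (node (node (node (node (node (leaf 1) (leaf 0)) (leaf 0)) (leaf 1)) (leaf 2)) (node (leaf 0) (leaf 1)))
  (node (node (node (node (leaf 0) (leaf 1)) (leaf 0)) (node (node (leaf 1) (leaf 0)) (leaf 0))) (leaf 0))) (node (node (node (leaf 2) (node (leaf 1)
  (leaf 2))) (leaf 0)) (node (node (leaf 0) (node (node (leaf 0) (node (node (leaf 1) (leaf 2)) (leaf 0))) (leaf 0))) (node (leaf 0) (leaf 2)))))) (node
  (node (node (node (node (leaf 1) (leaf 0)) (node (leaf 0) (node (node (leaf 0) (node (node (node (leaf 0) (leaf 1)) (leaf 0)) (leaf 0))) (leaf 2))))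
  (node (node (leaf 0) (node (leaf 0) (node (leaf 2) (leaf 1)))) (leaf 0))) (node (leaf 2) (node (leaf 0) (node (node (leaf 1) (leaf 0)) (leaf 0)))))
  (node (node (node (node (leaf 0) (node (leaf 1) (leaf 0))) (node (leaf 2) (leaf 0))) (node (node (node (node (node (leaf 2) (leaf 1)) (leaf 2)) (leaf
  0)) (node (leaf 0) (node (leaf 0) (node (leaf 0) (node (leaf 2) (leaf 0)))))) (node (node (leaf 2) (leaf 0)) (leaf 1)))) (node (node (node (leaf 1)
  (node (leaf 0) (leaf 1))) (leaf 0)) (node (node (leaf 1) (leaf 2)) (node (node (node (leaf 2) (leaf 1)) (leaf 0)) (leaf 0))))))) (node (node (node
  (node (leaf 2) (node (node (node (leaf 0) (node (leaf 1) (leaf 2))) (leaf 0)) (node (leaf 2) (leaf 1)))) (node (node (leaf 1) (leaf 0)) (node (node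
  (node (node (leaf 0) (leaf 2)) (leaf 0)) (leaf 1)) (node (leaf 2) (node (leaf 0) (node (leaf 0) (node (leaf 0) (node (node (leaf 0) (leaf 2)) (leaf
  0))))))))) (node (node (node (leaf 0) (node (leaf 0) (node (leaf 0) (node (leaf 1) (leaf 2))))) (node (leaf 2) (leaf 0))) (node (node (leaf 0) (node
  (leaf 1) (node (leaf 0) (leaf 2)))) (node (leaf 1) (node (leaf 0) (leaf 1)))))) (node (node (node (node (node (node (leaf 0) (node (leaf 1) (leaf 2)))
  (leaf 0)) (leaf 0)) (node (node (leaf 0) (leaf 2)) (leaf 0))) (node (node (node (node (node (leaf 2) (leaf 1)) (leaf 0)) (leaf 0)) (leaf 0)) (node
  (node (node (node (node (leaf 1) (leaf 2)) (leaf 0)) (leaf 2)) (node (leaf 0) (leaf 2))) (node (leaf 1) (leaf 2))))) (node (node (leaf 1) (leaf 0))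
  (node (node (node (leaf 1) (leaf 0)) (node (node (node (leaf 0) (leaf 1)) (leaf 2)) (node (leaf 1) (node (leaf 0) (leaf 1))))) (node (leaf 1) (node
  (leaf 2) (leaf 0)))))))) (node (node (node (node (node (leaf 1) (leaf 2)) (node (node (leaf 1) (node (node (leaf 2) (leaf 1)) (leaf 0))) (leaf 2)))
  (node (node (leaf 0) (node (node (leaf 2) (node (leaf 1) (leaf 2))) (node (leaf 0) (node (leaf 2) (node (leaf 1) (leaf 2)))))) (node (node (leaf 2)
  (node (leaf 0) (node (node (leaf 0) (node (node (leaf 0) (leaf 2)) (leaf 0))) (leaf 1)))) (node (leaf 1) (leaf 0))))) (node (node (node (node (node
  (leaf 1) (leaf 2)) (leaf 1)) (node (node (leaf 0) (node (leaf 0) (leaf 2))) (node (leaf 0) (node (leaf 0) (node (leaf 2) (leaf 0)))))) (node (node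
  (node (leaf 0) (leaf 2)) (node (node (leaf 0) (node (leaf 0) (node (leaf 0) (node (leaf 0) (node (leaf 0) (leaf 1)))))) (leaf 2))) (node (node (node
  (leaf 0) (leaf 1)) (node (leaf 0) (node (leaf 0) (leaf 1)))) (leaf 1)))) (node (node (leaf 0) (node (node (node (leaf 0) (leaf 1)) (node (leaf 1)
  (leaf 0))) (leaf 0))) (node (leaf 0) (node (node (leaf 2) (node (node (leaf 0) (node (leaf 2) (leaf 1))) (leaf 0))) (leaf 0)))))) (node (node (node
  (node (leaf 2) (leaf 0)) (node (node (leaf 1) (leaf 2)) (node (node (node (node (leaf 0) (node (leaf 2) (leaf 0))) (leaf 0)) (leaf 0)) (leaf 1))))
  (node (node (node (node (leaf 0) (leaf 2)) (node (leaf 0) (leaf 1))) (node (node (node (node (leaf 0) (node (leaf 1) (leaf 2))) (node (node (leaf 0)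
  (node (leaf 0) (leaf 2))) (leaf 0))) (leaf 1)) (node (leaf 0) (leaf 2)))) (node (node (node (leaf 0) (leaf 1)) (node (node (leaf 0) (node (node (node
  (node (leaf 0) (leaf 1)) (leaf 0)) (leaf 0)) (leaf 0))) (leaf 2))) (node (node (leaf 1) (node (node (leaf 0) (node (leaf 2) (leaf 1))) (leaf 0)))
  (node (leaf 1) (leaf 2)))))) (node (node (node (node (leaf 1) (leaf 0)) (node (node (node (leaf 0) (node (leaf 0) (leaf 2))) (leaf 2)) (leaf 0)))
  (node (node (leaf 1) (node (leaf 1) (leaf 0))) (leaf 0))) (node (node (leaf 1) (node (node (node (node (leaf 2) (leaf 0)) (leaf 1)) (leaf 0)) (leaf
  0))) (node (node (leaf 1) (node (leaf 2) (leaf 1))) (node (node (leaf 1) (leaf 0)) (node (leaf 1) (leaf 2))))))))))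

-- Since 66 - (2⁴ - 1) = 51 and 5 · 51 = 255, the scaling condition holds exactly for multiples δ of
-- 5. As 15 is 0 modulo 3, a leading term would not rotate the colours, and it is switched off.
colour₄ : Gr 8 4 → Fin 3
colour₄ = baseColour false 66 (lookupⁿ colour₄-tree)

colour₄-×α⁵ : Acts colour₄ ×α⁵
colour₄-×α⁵ = shift-Acts false 66 (lookupⁿ colour₄-tree) ×α⁵ 5 (∀-points (is-shift 5 ×α⁵) refl) refl

colour₄-×α⁸⁰ : Acts colour₄ ×α⁸⁰
colour₄-×α⁸⁰ = shift-Acts false 66 (lookupⁿ colour₄-tree) ×α⁸⁰ 80 (∀-points (is-shift 80 ×α⁸⁰) refl) refl

colour₄-frobenius : Acts colour₄ frobenius
colour₄-frobenius = double-Acts false 66 (lookupⁿ colour₄-tree) frobenius refl frobenius-doubles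

colour₄-balanced : allᵇ (checkᵇ colour₄) lines₄ ≡ true
colour₄-balanced = refl

colour₄-PGood : PGood 8 4 2 colour₄
colour₄-PGood = certificate⇒PGood lines₄ colour₄-balanced lg bases₄ refl refl (s≤s (s≤s z≤n))
  where open Reduce colour₄ ×α⁵ ×α⁸⁰ frobenius colour₄-×α⁵ colour₄-×α⁸⁰ colour₄-frobenius

theorem1 : (v k : ℕ) → 8 ≤ v → k ≤ v →
    ((v % 6 ≡ 2 × (k % 6 ≡ 3 ⊎ k % 6 ≡ 4 ⊎ k % 6 ≡ 5))
    ⊎ (v % 6 ≡ 3 × (k % 6 ≡ 4 ⊎ k % 6 ≡ 5))
    ⊎ (v % 6 ≡ 4 × k % 6 ≡ 5)) →
    LargeSet₂ 3 2 k v
theorem1 v k _ k≤v cond = large-set v k k≤v (proj₁ (residues v k cond)) (proj₂ (residues v k cond))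
  where open Assembly colour₃ colour₄ colour₅ colour₃-PGood colour₄-PGood colour₅-PGood using (large-set)
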